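{- Let $\mu=(1^{m_1}2^{m_2}\cdots)$ be a partition of $n$ (with $m_i$ parts equal to $i$), and let $C(\mu)=\sum_{\lambda}\chi^\lambda_\mu$, the sum over all partitions $\lambda$ of $n$ (i.e. the sum of the entries in the column indexed by $\mu$ of the character table of the symmetric group $\mathfrak{S}_n$). Then $C(\mu)=\prod_{i>0}c_{i,m_i}$, where $$c_{i,m_i}=\begin{cases}0 & \text{if } i \text{ is even and } m_i \text{ is odd},\\ (m_i-1)!!\cdot i^{m_i/2} & \text{if } i \text{ is even and } m_i \text{ is even},\\ \displaystyle\sum_{k=0}^{\lfloor m_i/2\rfloor}\binom{m_i}{m_i-2k}\,(2k-1)!!\; i^k & \text{if } i \text{ is odd}.\end{cases}$$
   Context: $\chi^\lambda$ is the irreducible (complex) character of $\mathfrak{S}_n$ indexed by the partition $\lambda$ of $n$, and $\chi^\lambda_\mu$ is its value on a permutation of cycle type $\mu$, i.e. having $m_i$ cycles of length $i$ for each $i$. Double factorials are $(2k-1)!!=1\cdot3\cdots(2k-1)$, with $(-1)!!=1$ (so $c_{i,0}=1$ for all $i$). By the (known) Murnaghan–Nakayama rule, $\chi^\lambda_\mu=\sum_P\varepsilon(P)$, the sum being over all ribbon tableaux $P$ of shape $\lambda$ and content $\mu$, that is, sequences of partitions $\emptyset=\lambda^0\subset\lambda^1\subset\cdots\subset\lambda^\ell=\lambda$ such that each $\lambda^{i}/\lambda^{i-1}$ is a connected skew shape of size $\mu_i$ without $2\times2$ square of cells (a ribbon), where $\varepsilon(P)$ is the product over the ribbons of $(-1)^{(\text{number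 of rows occupied})-1}$. -}

module Defs where

open import Algebra.Apartness using (HeytingCommutativeRing; HeytingField)
open import Algebra.Bundles using (CommutativeRing; Semiring)
import Algebra.Definitions.RawSemiring as RawSemiringDefinitions
open import Data.Bool.Base using (if_then_else_)
open import Data.Fin.Base using (Fin; toℕ)
import Data.Fin.Properties as Fin
open import Data.Fin.Permutation using (Permutation′; _⟨$⟩ʳ_; _∘ₚ_)
  renaming (id to idₚ; _≈_ to _≈ₚ_)
open import Data.Fin.Subset as Subset using (Subset; Nonempty; ∁)
open import Data.Fin.Subset.Properties using (nonempty?; anySubset?)
  renaming (_∈?_ to _∈ₛ?_)
open import Data.Integer.Base as ℤ using (ℤ; -1ℤ; 0ℤ; 1ℤ)
open import Data.List.Base
  using (List; []; _∷_; _∷ʳ_; map; filter; foldr; length; concat; concatMap;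
         applyUpTo; upTo; allFin; cartesianProduct; cartesianProductWith; mapMaybe;
         lookup)
open import Data.List.Membership.Propositional using (_∈_)
open import Data.List.Membership.DecPropositional using (_∈?_)
import Data.List.Properties as List
open import Data.List.Relation.Binary.Permutation.Propositional using (_↭_)
open import Data.List.Relation.Unary.All using (All; all?)
open import Data.List.Relation.Unary.Linked using (Linked; linked?)
open import Data.Maybe.Base using (Maybe; just; nothing)
open import Data.Nat.Base
  using (ℕ; zero; suc; _+_; _*_; _∸_; _^_; _/_; _≤_; _<_; _≥_; ∣_-_∣)
open import Data.Nat.Combinatorics using (_C_)
open import Data.Nat.Divisibility using (_∣?_)
open import Data.Nat.ListAction using (sum; product)
open import Data.Nat.Properties using (_≟_; _≤?_; _<?_; _≥?_)
open import Data.Product.Base using (∃; _×_; _,_)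
open import Data.Product.Properties using (≡-dec)
open import Level using (Level; _⊔_) renaming (suc to lsuc)
open import Relation.Binary.Definitions using (DecidableEquality)
open import Relation.Binary.PropositionalEquality using (_≡_)
open import Relation.Nullary using (¬_; Dec; yes; no; does; ¬?; _×-dec_; _→-dec_)
open import Relation.Unary using (Pred)

------------------------------------------------------------------------
-- Partitions

record Partition (n : ℕ) : Set where
  field
    parts      : List ℕ
    decreasing : Linked _≥_ parts
    positive   : All (0 <_) parts
    size       : sum parts ≡ n

open Partition public

asPartition : ∀ n → List ℕ → Maybe (Partition n)
asPartition n ps with linked? _≥?_ ps | all? (0 <?_) ps | sum ps ≟ n
... | yes d | yes p | yes s = just record { parts = ps ; decreasing = d ; positive = p ; size = s }
... | _     | _     | _     = nothing

-- Each word is listed once: the words of length at most l over {1,…,n}.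
words : ℕ → ℕ → List (List ℕ)
words n zero    = [] ∷ []
words n (suc l) = [] ∷ cartesianProductWith _∷_ (applyUpTo suc n) (words n l)

-- A partition of n has at most n parts, each at most n, so this lists every
-- partition of n exactly once.
partitions : ∀ n → List (Partition n)
partitions n = mapMaybe (asPartition n) (words n n)

multiplicity : ℕ → List ℕ → ℕ
multiplicity i ps = length (filter (i ≟_) ps)

------------------------------------------------------------------------
-- Ribbon tableaux
--
-- Diagrams are in English notation with rows and columns numbered from 0, and
-- partitions are given by their lists of parts.

Cell : Set
Cell = ℕ × ℕ

_≟ᶜ_ : DecidableEquality Cell
_≟ᶜ_ = ≡-dec _≟_ _≟_

row : List ℕ → ℕ → ℕ
row []       _       = 0
row (p ∷ _)  zero    = p
row (_ ∷ ps) (suc i) = row ps i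

-- Contained κ ν : the diagram of κ is contained in that of ν; row indices beyond the
-- length of κ impose no condition.
Contained : List ℕ → List ℕ → Set
Contained κ ν = All (λ i → row κ i ≤ row ν i) (upTo (length κ))

skewCells : List ℕ → List ℕ → List Cell
skewCells κ ν =
  concatMap (λ i → applyUpTo (λ j → i , row κ i + j) (row ν i ∸ row κ i)) (upTo (length ν))

-- The two cells share an edge.
Adjacent : Cell → Cell → Set
Adjacent (i , j) (i′ , j′) = ∣ i - i′ ∣ + ∣ j - j′ ∣ ≡ 1

Separates : (cs : List Cell) → Subset (length cs) → Set
Separates cs S =
  Nonempty S × Nonempty (∁ S) ×
  (∀ a b → a Subset.∈ S → b Subset.∈ ∁ S → ¬ Adjacent (lookup cs a) (lookup cs b))

Connected : List Cell → Set
Connected cs = ¬ ∃ (Separates cs)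

No2×2 : List Cell → Set
No2×2 cs =
  All (λ (i , j) → ¬ ((suc i , j) ∈ cs × (i , suc j) ∈ cs × (suc i , suc j) ∈ cs)) cs

IsRibbon : List ℕ → List ℕ → Set
IsRibbon κ ν = Contained κ ν × Connected (skewCells κ ν) × No2×2 (skewCells κ ν)

connected? : ∀ cs → Dec (Connected cs)
connected? cs = ¬? (anySubset? λ S →
  nonempty? S ×-dec nonempty? (∁ S) ×-dec
  Fin.all? λ a → Fin.all? λ b →
    (a ∈ₛ? S) →-dec ((b ∈ₛ? ∁ S) →-dec ¬? (_ ≟ 1)))

isRibbon? : ∀ κ ν → Dec (IsRibbon κ ν)
isRibbon? κ ν =
  all? (λ i → row κ i ≤? row ν i) _ ×-dec
  connected? (skewCells κ ν) ×-dec
  all? (λ (i , j) → ¬? (mem (suc i , j) ×-dec mem (i , suc j) ×-dec mem (suc i , suc j))) _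
  where mem = λ c → _∈?_ _≟ᶜ_ c (skewCells κ ν)

-- ribbonTableaux κ μ ν lists the sequences κ = λ⁰ ⊂ λ¹ ⊂ ⋯ ⊂ λˡ = ν in which λⁱ/λⁱ⁻¹
-- is a ribbon of size μᵢ.
ribbonTableaux : List ℕ → List ℕ → List ℕ → List (List (List ℕ))
ribbonTableaux κ []      ν = if does (List.≡-dec _≟_ κ ν) then (κ ∷ []) ∷ [] else []
ribbonTableaux κ (m ∷ μ) ν =
  concatMap (λ κ′ → map (κ ∷_) (ribbonTableaux κ′ μ ν))
            (filter (isRibbon? κ) (map parts (partitions (sum κ + m))))

occupiedRows : List ℕ → List ℕ → ℕ
occupiedRows κ ν = length (filter (λ i → row κ i <? row ν i) (upTo (length ν)))

ε : List (List ℕ) → ℤ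
ε (κ ∷ κ′ ∷ P) = (-1ℤ ℤ.^ (occupiedRows κ κ′ ∸ 1)) ℤ.* ε (κ′ ∷ P)
ε _            = 1ℤ

signedRibbonCount : List ℕ → List ℕ → ℤ
signedRibbonCount ν μ = foldr ℤ._+_ 0ℤ (map ε (ribbonTableaux [] μ ν))

------------------------------------------------------------------------
-- Cycle type

-- The list (a₁ , … , aₖ), k ≥ 1, is a cycle of w, given that its entries are distinct:
-- w aⱼ = aⱼ₊₁ and w aₖ = a₁.
data IsCycle {n} (w : Permutation′ n) : List (Fin n) → Set where
  cycle : ∀ {a as} → map (w ⟨$⟩ʳ_) (a ∷ as) ≡ as ∷ʳ a → IsCycle w (a ∷ as)

-- w has a decomposition into disjoint cycles, fixed points included, whose lengths are
-- the parts of μ.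
HasCycleType : ∀ {n} → Permutation′ n → List ℕ → Set
HasCycleType {n} w μ =
  ∃ λ cs → All (IsCycle w) cs × concat cs ↭ allFin n × map length cs ↭ μ

------------------------------------------------------------------------
-- Representations and characters of the symmetric groups

module _ {c ℓ₁ ℓ₂ : Level} (K : HeytingField c ℓ₁ ℓ₂) where

  open HeytingField K
    using (Carrier; _≈_; _#_; 0#; 1#; heytingCommutativeRing)
    renaming (_+_ to _+ᴷ_; _*_ to _*ᴷ_; -_ to -ᴷ_)
  open CommutativeRing (HeytingCommutativeRing.commutativeRing heytingCommutativeRing)
    using (semiring)
  open RawSemiringDefinitions (Semiring.rawSemiring semiring)
    using () renaming (_×_ to _×ᴷ_; _^_ to _^ᴷ_; sum to ∑)

  CharacteristicZero : Set ℓ₂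
  CharacteristicZero = ∀ k → (suc k ×ᴷ 1#) # 0#

  AlgebraicallyClosed : Set (c ⊔ ℓ₁)
  AlgebraicallyClosed = ∀ d (a : Fin (suc d) → Carrier) →
    ∃ λ x → (x ^ᴷ suc d) +ᴷ ∑ (λ i → a i *ᴷ (x ^ᴷ toℕ i)) ≈ 0#

  fromℕ : ℕ → Carrier
  fromℕ k = k ×ᴷ 1#

  fromℤ : ℤ → Carrier
  fromℤ (ℤ.+ k)    = fromℕ k
  fromℤ ℤ.-[1+ k ] = -ᴷ fromℕ (suc k)

  Matrix : ℕ → ℕ → Set c
  Matrix d e = Fin d → Fin e → Carrier

  _≈ᴹ_ : ∀ {d e} → Matrix d e → Matrix d e → Set ℓ₁
  A ≈ᴹ B = ∀ i j → A i j ≈ B i j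

  identity : ∀ d → Matrix d d
  identity d i j = if does (i Fin.≟ j) then 1# else 0#

  _·_ : ∀ {d e f} → Matrix d e → Matrix e f → Matrix d f
  (A · B) i k = ∑ (λ j → A i j *ᴷ B j k)

  record Representation (n : ℕ) : Set (c ⊔ ℓ₁) where
    field
      dim  : ℕ
      mat  : Permutation′ n → Matrix dim dim
      cong : ∀ {π σ} → π ≈ₚ σ → mat π ≈ᴹ mat σ
      id   : mat idₚ ≈ᴹ identity dim
      -- σ ∘ₚ π applies σ first.
      homo : ∀ π σ → mat (σ ∘ₚ π) ≈ᴹ (mat π · mat σ)

  open Representation

  character : ∀ {n} → Representation n → Permutation′ n → Carrier
  character V π = ∑ (λ i → mat V π i i)

  record Isomorphic {n} (V W : Representation n) : Set (c ⊔ ℓ₁) where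
    field
      to          : Matrix (dim W) (dim V)
      from        : Matrix (dim V) (dim W)
      to-from     : (to · from) ≈ᴹ identity (dim W)
      from-to     : (from · to) ≈ᴹ identity (dim V)
      intertwines : ∀ π → (to · mat V π) ≈ᴹ (mat W π · to)

  record IsSubrepresentation {n} (V : Representation n)
                             (U : Pred (Fin (dim V) → Carrier) (c ⊔ ℓ₁)) :
                             Set (c ⊔ ℓ₁) where
    field
      resp      : ∀ {u v} → (∀ i → u i ≈ v i) → U u → U v
      origin    : U (λ _ → 0#)
      add       : ∀ {u v} → U u → U v → U (λ i → u i +ᴷ v i)
      scale     : ∀ a {u} → U u → U (λ i → a *ᴷ u i)
      invariant : ∀ π {u} → U u → U (λ i → ∑ (λ j → mat V π i j *ᴷ u j))

  -- V is nonzero and a subrepresentation containing a nonzero vector is all of V.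
  Irreducible : ∀ {n} → Representation n → Set (lsuc (c ⊔ ℓ₁) ⊔ ℓ₂)
  Irreducible V = 0 < dim V ×
    (∀ U → IsSubrepresentation V U → ∀ u → U u → ∃ (λ i → u i # 0#) → ∀ v → U v)

  -- Representatives of the isomorphism classes of irreducible representations,
  -- indexed bijectively by partitions.
  record IrreducibleRepresentations (n : ℕ) : Set (lsuc (c ⊔ ℓ₁) ⊔ ℓ₂) where
    field
      rep         : Partition n → Representation n
      irreducible : ∀ ν → Irreducible (rep ν)
      distinct    : ∀ ν ν′ → Isomorphic (rep ν) (rep ν′) → ν ≡ ν′
      complete    : ∀ V → Irreducible V → ∃ λ ν → Isomorphic V (rep ν)

  open IrreducibleRepresentations

  χ : ∀ {n} → IrreducibleRepresentations n → Partition n → Permutation′ n → Carrier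
  χ R ν = character (rep R ν)

  -- Being irreducible and pairwise non-isomorphic does not determine which representation
  -- is indexed by which partition; the Murnaghan–Nakayama rule does.
  MurnaghanNakayama : ∀ {n} → IrreducibleRepresentations n → Set ℓ₁
  MurnaghanNakayama {n} R = ∀ (ν μ : Partition n) w → HasCycleType w (parts μ) →
    χ R ν w ≈ fromℤ (signedRibbonCount (parts ν) (parts μ))

  -- The sum of the entries of the character table in the column of the class of w.
  columnSum : ∀ {n} → IrreducibleRepresentations n → Permutation′ n → Carrier
  columnSum {n} R w = foldr _+ᴷ_ 0# (map (λ ν → χ R ν w) (partitions n))

------------------------------------------------------------------------
-- The factors of the product formula

-- With truncated subtraction, (m ∸ 1) ‼ is 1 for m = 0, in accordance with (-1)!! = 1.
_‼ : ℕ → ℕ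
0             ‼ = 1
1             ‼ = 1
suc (suc k)   ‼ = suc (suc k) * (k ‼)

factor : ℕ → ℕ → ℕ
factor i m with 2 ∣? i | 2 ∣? m
... | yes _ | no  _ = 0
... | yes _ | yes _ = ((m ∸ 1) ‼) * i ^ (m / 2)
... | no  _ | _     =
  sum (map (λ k → (m C (m ∸ 2 * k)) * ((2 * k ∸ 1) ‼) * i ^ k) (upTo (suc (m / 2))))

-- The product over i > 0 stops at n: no part of μ exceeds n, and factor i 0 ≡ 1.
factorProduct : ∀ {n} → Partition n → ℕ
factorProduct {n} μ =
  product (map (λ i → factor i (multiplicity i (parts μ))) (applyUpTo suc n))

module Submission where

-- Write a partition with at most N parts as its N beads ρ i + (N - 1 - i).  Adding or removing
-- an m-ribbon moves one bead by m, with the sign of the permutation that re-sorts the beads, so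
-- on alternating functions of N positions these operations become A m and B m, the sums over all
-- entries of shifting that entry up or down by m (up m, down m and der below).  By the
-- Murnaghan–Nakayama rule the column sum is the value at the empty partition of
-- A μ₁ (⋯ (A μₗ Sgn)), where Sgn is the alternating function equal to 1 on decreasing sequences.
--
-- Three facts determine it: A k and B m commute up to m δ(k,m); A m Sgn = B m Sgn, plus Sgn if m
-- is odd; and B m g vanishes at the empty partition.  Moving B m to the left gives, for the
-- column sum C, C(ρ ∪ m) = m · mₘ(ρ) · C(ρ \ m) + [m odd] · C(ρ), which is also the recurrence
-- satisfied by the product formula.
open import Defs
open import Algebra.Apartness using (HeytingCommutativeRing; HeytingField)
open import Algebra.Bundles using (CommutativeRing)
import Algebra.Properties.AbelianGroup as AbelianGroupProperties
import Algebra.Properties.CommutativeSemigroup as CommutativeSemigroupProperties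
import Algebra.Properties.Monoid.Mult as MonoidMult
open import Data.Bool.Base using (true)
import Data.Fin.Base as Fin
open import Data.Fin.Permutation using (Permutation′)
open import Data.Fin.Subset as Subset using (Subset)
open import Data.Fin.Subset.Properties using (x∉p⇒x∈∁p; x∈∁p⇒x∉p) renaming (_∈?_ to _∈ₛ?_)
open import Data.Integer.Base as ℤ using (ℤ; -_; 0ℤ; 1ℤ; -1ℤ) renaming (_+_ to _⊕_; _*_ to _⊛_; _-_ to _⊖_)
import Data.Integer.Properties as ℤ
open import Data.Integer.Tactic.RingSolver using (solve-∀)
open import Data.List.Base hiding (sum; product)
import Data.List.Properties as List
open import Data.List.Properties using (∷-injective; ∷-injectiveˡ; ∷-injectiveʳ)
open import Data.List.Membership.Propositional using (_∈_; _∉_)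
open import Data.List.Membership.Propositional.Properties
open import Data.List.Membership.Propositional.Properties.WithK using (unique∧set⇒bag)
open import Data.List.Relation.Binary.BagAndSetEquality using (∼bag⇒↭)
open import Data.List.Relation.Binary.Disjoint.Propositional using (Disjoint)
open import Data.List.Relation.Binary.Permutation.Propositional as Perm using (_↭_)
open import Data.List.Relation.Binary.Permutation.Propositional.Properties using (filter-↭; ↭-length; All-resp-↭; shift; ∷↭∷ʳ; map⁺)
open import Data.List.Relation.Unary.All as All using (All; []; _∷_; all?)
import Data.List.Relation.Unary.All.Properties as All
open import Data.List.Relation.Unary.AllPairs as AllPairs using ([]; _∷_)
import Data.List.Relation.Unary.AllPairs.Properties as AllPairs
open import Data.List.Relation.Unary.Any as Any using (here; there)
import Data.List.Relation.Unary.Any.Properties as Any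
open import Data.List.Relation.Unary.Linked using (Linked; []; [-]; _∷_; linked?)
open import Data.List.Relation.Unary.Unique.Propositional using (Unique)
import Data.List.Relation.Unary.Unique.Propositional.Properties as Unique
open import Data.Maybe.Base as Maybe using (Maybe; just; nothing; maybe′)
open import Data.Maybe.Properties using (just-injective)
open import Data.Nat.Base using (ℕ; zero; suc; pred; _+_; _*_; _∸_; _^_; _/_; _≤_; _<_; _≥_; z≤n; s≤s; s≤s⁻¹; ∣_-_∣; >-nonZero)
open import Data.Nat.Combinatorics using (_C_; nCk+nC[k+1]≡[n+1]C[k+1]; nCk≡nC[n∸k]; k>n⇒nCk≡0)
open import Data.Nat.Divisibility using (_∣_; _∣?_; ∣m+n∣m⇒∣n; ∣m∣n⇒∣m+n; ∣-refl; _∣0; ∣1⇒≡1)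
open import Data.Nat.DivMod using (m/n*n≤m; m/n≡1+[m∸n]/n; m/n≤m; m*n/n≡m; /-monoˡ-≤)
open import Data.Nat.ListAction using (sum; product)
open import Data.Nat.ListAction.Properties using (sum-↭; product-↭)
open import Data.Nat.Properties as ℕ using (_≤?_; _<?_; _≟_; _≥?_; <-cmp)
import Data.Nat.Tactic.RingSolver as ℕSolver
open import Data.Product.Base using (∃; _×_; _,_; proj₁; proj₂)
import Data.Vec.Base as Vec
open import Data.Vec.Properties using (lookup∘tabulate; lookup⇒[]=; []=⇒lookup)
open import Function.Base using (_∘_; id)
open import Function.Bundles using (mk⇔)
open import Relation.Binary.Definitions using (tri<; tri≈; tri>)
open import Relation.Binary.PropositionalEquality using (_≡_; _≢_; refl; sym; trans; cong; cong₂; subst; subst₂; module ≡-Reasoning)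
import Relation.Binary.Reasoning.Setoid as SetoidReasoning
open import Relation.Nullary using (¬_; Dec; does; yes; no; contradiction)
open import Relation.Nullary.Decidable using (dec-true)

-- Read a function on partitions as a linear functional on Schur functions. Then A m is composition
-- with multiplication by the power sum p_m, B m is composition with its adjoint m ∂/∂p_m, and Sgn,
-- being 1 on every Schur function, is the pairing with H = Σ s_λ. The reflection of A m into B m on
-- Sgn is the equation m ∂H/∂p_m = (p_m + [m odd]) H, whose solution H = exp(Σ p_k²/2k + Σ_{k odd}
-- p_k/k) explains why the answer is a product over part sizes. Here that equation is proved
-- directly, by a telescoping sum over bead positions.
--
-- The obstacle is finiteness: the commutation rule presupposes an infinite sea of beads below,
-- whereas here a bead can only be lowered within the natural numbers. With N = 2n beads every
-- partition of size at most n still fills all positions below n, and the relations hold at the bead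
-- lists of such partitions. Equalities are therefore stated only there. Raising a bead may give an
-- unsorted or colliding list; alternation leads from it back to a partition or to 0.

private
  infixl 4 _∙_
  _∙_ : ∀ {a} {A : Set a} {x y z : A} → x ≡ y → y ≡ z → x ≡ z
  _∙_ = trans

-- Finite sums of integers over lists.

∑ : ∀ {a} {A : Set a} → (A → ℤ) → List A → ℤ
∑ f xs = foldr _⊕_ 0ℤ (map f xs)

∑-cong : ∀ {a} {A : Set a} {f g : A → ℤ} xs → (∀ {x} → x ∈ xs → f x ≡ g x) → ∑ f xs ≡ ∑ g xs
∑-cong []       _   = refl
∑-cong (x ∷ xs) f≡g = cong₂ _⊕_ (f≡g (here refl)) (∑-cong xs (f≡g ∘ there))

∑-zero : ∀ {a} {A : Set a} {f : A → ℤ} xs → (∀ {x} → x ∈ xs → f x ≡ 0ℤ) → ∑ f xs ≡ 0ℤ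
∑-zero []       _   = refl
∑-zero (x ∷ xs) f≡0 = cong₂ _⊕_ (f≡0 (here refl)) (∑-zero xs (f≡0 ∘ there))

∑-++ : ∀ {a} {A : Set a} (f : A → ℤ) xs ys → ∑ f (xs ++ ys) ≡ ∑ f xs ⊕ ∑ f ys
∑-++ f []       ys = sym (ℤ.+-identityˡ _)
∑-++ f (x ∷ xs) ys = trans (cong (f x ⊕_) (∑-++ f xs ys)) (sym (ℤ.+-assoc (f x) _ _))

∑-map : ∀ {a b} {A : Set a} {B : Set b} (f : B → ℤ) (g : A → B) xs → ∑ f (map g xs) ≡ ∑ (f ∘ g) xs
∑-map f g []       = refl
∑-map f g (x ∷ xs) = cong (f (g x) ⊕_) (∑-map f g xs)

+-exchange : ∀ a b c d → (a ⊕ b) ⊕ (c ⊕ d) ≡ (a ⊕ c) ⊕ (b ⊕ d)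
+-exchange = solve-∀

*-exchange : ∀ a b c → a ⊛ (b ⊛ c) ≡ b ⊛ (a ⊛ c)
*-exchange = solve-∀

∑-+ : ∀ {a} {A : Set a} (f g : A → ℤ) xs → ∑ (λ x → f x ⊕ g x) xs ≡ ∑ f xs ⊕ ∑ g xs
∑-+ f g []       = refl
∑-+ f g (x ∷ xs) = trans (cong (f x ⊕ g x ⊕_) (∑-+ f g xs)) (+-exchange (f x) (g x) _ _)

∑-*ˡ : ∀ {a} {A : Set a} c (f : A → ℤ) xs → ∑ (λ x → c ⊛ f x) xs ≡ c ⊛ ∑ f xs
∑-*ˡ c f []       = sym (ℤ.*-zeroʳ c)
∑-*ˡ c f (x ∷ xs) = trans (cong (c ⊛ f x ⊕_) (∑-*ˡ c f xs)) (sym (ℤ.*-distribˡ-+ c (f x) _))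

∑-swap : ∀ {a b} {A : Set a} {B : Set b} (f : A → B → ℤ) xs ys →
         ∑ (λ x → ∑ (f x) ys) xs ≡ ∑ (λ y → ∑ (λ x → f x y) xs) ys
∑-swap f []       ys = sym (∑-zero ys λ _ → refl)
∑-swap f (x ∷ xs) ys = trans (cong (∑ (f x) ys ⊕_) (∑-swap f xs ys))
                             (sym (∑-+ (f x) (λ y → ∑ (λ x → f x y) xs) ys))

∑-concatMap : ∀ {a b} {A : Set a} {B : Set b} (f : B → ℤ) (g : A → List B) xs →
              ∑ f (concatMap g xs) ≡ ∑ (λ x → ∑ f (g x)) xs
∑-concatMap f g []       = refl
∑-concatMap f g (x ∷ xs) = trans (∑-++ f (g x) _) (cong (∑ f (g x) ⊕_) (∑-concatMap f g xs))

-- Alternating functions and the operators der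

-- Adjacent swaps generate all permutations. The prefix `as` makes the property pass to
-- `g ∘ (x ∷_)`, on which the inductions over the entries run.
record Alternating (g : List ℕ → ℤ) : Set where
  constructor alternating
  field
    transpose : ∀ as x y bs → g (as ++ x ∷ y ∷ bs) ≡ - g (as ++ y ∷ x ∷ bs)

open Alternating

Alternating-tail : ∀ {g} → Alternating g → ∀ x → Alternating (g ∘ (x ∷_))
Alternating-tail alt x .transpose as = transpose alt (x ∷ as)

x≡-x⇒x≡0 : ∀ {x} → x ≡ - x → x ≡ 0ℤ
x≡-x⇒x≡0 {ℤ.+ zero} _ = refl
x≡-x⇒x≡0 {ℤ.+ suc _} ()
x≡-x⇒x≡0 {ℤ.-[1+ _ ]} ()

move : ∀ {g} → Alternating g → ∀ z as bs → g (as ++ z ∷ bs) ≡ (-1ℤ ℤ.^ length as) ⊛ g (z ∷ as ++ bs)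
move {g} alt z []       bs = sym (ℤ.*-identityˡ _)
move {g} alt z (a ∷ as) bs = begin
  g (a ∷ as ++ z ∷ bs)                                  ≡⟨ move (Alternating-tail alt a) z as bs ⟩
  (-1ℤ ℤ.^ length as) ⊛ g (a ∷ z ∷ as ++ bs)            ≡⟨ cong ((-1ℤ ℤ.^ length as) ⊛_) (transpose alt [] a z _) ⟩
  (-1ℤ ℤ.^ length as) ⊛ - g (z ∷ a ∷ as ++ bs)          ≡⟨ lemma (-1ℤ ℤ.^ length as) _ ⟩
  -1ℤ ⊛ (-1ℤ ℤ.^ length as) ⊛ g (z ∷ a ∷ as ++ bs)      ∎
  where
  open ≡-Reasoning
  lemma : ∀ s t → s ⊛ - t ≡ -1ℤ ⊛ s ⊛ t
  lemma = solve-∀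

vanish-head : ∀ {g} → Alternating g → ∀ {z xs} → z ∈ xs → g (z ∷ xs) ≡ 0ℤ
vanish-head {g} alt {z} z∈xs with ∈-∃++ z∈xs
... | as , bs , refl = begin
  g (z ∷ as ++ z ∷ bs)                          ≡⟨ move (Alternating-tail alt z) z as bs ⟩
  (-1ℤ ℤ.^ length as) ⊛ g (z ∷ z ∷ as ++ bs)    ≡⟨ cong ((-1ℤ ℤ.^ length as) ⊛_) (x≡-x⇒x≡0 (transpose alt [] z z _)) ⟩
  (-1ℤ ℤ.^ length as) ⊛ 0ℤ                      ≡⟨ ℤ.*-zeroʳ (-1ℤ ℤ.^ length as) ⟩
  0ℤ                                            ∎
  where open ≡-Reasoning

vanish : ∀ {g} → Alternating g → ∀ {z} as bs → z ∈ as ++ bs → g (as ++ z ∷ bs) ≡ 0ℤ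
vanish {g} alt {z} as bs z∈ = begin
  g (as ++ z ∷ bs)                            ≡⟨ move alt z as bs ⟩
  (-1ℤ ℤ.^ length as) ⊛ g (z ∷ as ++ bs)      ≡⟨ cong ((-1ℤ ℤ.^ length as) ⊛_) (vanish-head alt z∈) ⟩
  (-1ℤ ℤ.^ length as) ⊛ 0ℤ                    ≡⟨ ℤ.*-zeroʳ (-1ℤ ℤ.^ length as) ⟩
  0ℤ                                          ∎
  where open ≡-Reasoning

at : Maybe ℕ → (ℕ → ℤ) → ℤ
at m f = maybe′ f 0ℤ m

-- The extension of a one-bead map `s` to many beads by the Leibniz rule; `nothing` drops the term,
-- as when a bead would go below 0. A commutator of two such operators is again of this form and can
-- be computed on a single bead.
der : (ℕ → Maybe ℕ) → (List ℕ → ℤ) → List ℕ → ℤ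
der s g []       = 0ℤ
der s g (x ∷ xs) = at (s x) (λ y → g (y ∷ xs)) ⊕ der s (g ∘ (x ∷_)) xs

at-cong : ∀ m {f h : ℕ → ℤ} → (∀ y → f y ≡ h y) → at m f ≡ at m h
at-cong nothing  _   = refl
at-cong (just y) f≡h = f≡h y

at-+ : ∀ m f h → at m (λ y → f y ⊕ h y) ≡ at m f ⊕ at m h
at-+ nothing  f h = refl
at-+ (just y) f h = refl

at-swap : ∀ m n (f : ℕ → ℕ → ℤ) → at m (λ y → at n (f y)) ≡ at n (λ z → at m (λ y → f y z))
at-swap nothing  nothing  f = refl
at-swap nothing  (just z) f = refl
at-swap (just y) nothing  f = refl
at-swap (just y) (just z) f = refl

der-cong : ∀ s {g h} b → (∀ c → g c ≡ h c) → der s g b ≡ der s h b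
der-cong s []       _   = refl
der-cong s (x ∷ xs) g≡h = cong₂ _⊕_ (at-cong (s x) λ y → g≡h (y ∷ xs)) (der-cong s xs λ c → g≡h (x ∷ c))

der-+ : ∀ s g h b → der s (λ c → g c ⊕ h c) b ≡ der s g b ⊕ der s h b
der-+ s g h []       = refl
der-+ s g h (x ∷ xs) =
  trans (cong₂ _⊕_ (at-+ (s x) _ _) (der-+ s (g ∘ (x ∷_)) (h ∘ (x ∷_)) xs))
        (+-exchange (at (s x) λ y → g (y ∷ xs)) _ _ _)

der-0 : ∀ s b → der s (λ _ → 0ℤ) b ≡ 0ℤ
der-0 s []       = refl
der-0 s (x ∷ xs) with s x
... | nothing = trans (ℤ.+-identityˡ _) (der-0 s xs)
... | just _  = trans (ℤ.+-identityˡ _) (der-0 s xs)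

der-* : ∀ s a g b → der s (λ c → a ⊛ g c) b ≡ a ⊛ der s g b
der-* s a g []       = sym (ℤ.*-zeroʳ a)
der-* s a g (x ∷ xs) =
  trans (cong₂ _⊕_ (at-* (s x)) (der-* s a (g ∘ (x ∷_)) xs)) (sym (ℤ.*-distribˡ-+ a _ _))
  where
  at-* : ∀ m {f} → at m (λ y → a ⊛ f y) ≡ a ⊛ at m f
  at-* nothing  = sym (ℤ.*-zeroʳ a)
  at-* (just y) = refl

der-∑ : ∀ s {A : Set} (g : A → List ℕ → ℤ) rs b → der s (λ c → ∑ (λ r → g r c) rs) b ≡ ∑ (λ r → der s (g r) b) rs
der-∑ s g []       b = der-0 s b
der-∑ s g (r ∷ rs) b = trans (der-+ s (g r) _ b) (cong (der s (g r) b ⊕_) (der-∑ s g rs b))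

der-at : ∀ s m (g : ℕ → List ℕ → ℤ) b → at m (λ y → der s (g y) b) ≡ der s (λ c → at m λ y → g y c) b
der-at s nothing  g b = sym (der-0 s b)
der-at s (just y) g b = refl

der-Alternating : ∀ s {g} → Alternating g → Alternating (der s g)
der-Alternating s {g} alt .transpose [] x y bs = begin
  at (s x) (λ z → g (z ∷ y ∷ bs)) ⊕ (at (s y) (λ z → g (x ∷ z ∷ bs)) ⊕ der s (g ∘ (x ∷_) ∘ (y ∷_)) bs)
    ≡⟨ cong₂ _⊕_ (at-neg (s x) λ z → transpose alt [] z y bs)
                 (cong₂ _⊕_ (at-neg (s y) λ z → transpose alt [] x z bs)
                            (trans (der-cong s bs λ c → trans (transpose alt [] x y c) (sym (ℤ.-1*i≡-i _)))
                                   (trans (der-* s -1ℤ (g ∘ (y ∷_) ∘ (x ∷_)) bs) (ℤ.-1*i≡-i _)))) ⟩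
  - at (s x) (λ z → g (y ∷ z ∷ bs)) ⊕ (- at (s y) (λ z → g (z ∷ x ∷ bs)) ⊕ - der s (g ∘ (y ∷_) ∘ (x ∷_)) bs)
    ≡⟨ lemma (at (s x) λ z → g (y ∷ z ∷ bs)) (at (s y) λ z → g (z ∷ x ∷ bs)) _ ⟩
  - (at (s y) (λ z → g (z ∷ x ∷ bs)) ⊕ (at (s x) (λ z → g (y ∷ z ∷ bs)) ⊕ der s (g ∘ (y ∷_) ∘ (x ∷_)) bs))
    ∎
  where
  open ≡-Reasoning
  at-neg : ∀ m {f h : ℕ → ℤ} → (∀ z → f z ≡ - h z) → at m f ≡ - at m h
  at-neg nothing  _ = refl
  at-neg (just z) e = e z
  lemma : ∀ a b c → - a ⊕ (- b ⊕ - c) ≡ - (b ⊕ (a ⊕ c))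
  lemma = solve-∀
der-Alternating s {g} alt .transpose (a ∷ as) x y bs =
  trans (cong₂ _⊕_ (at-neg (s a)) (transpose (der-Alternating s (Alternating-tail alt a)) as x y bs))
        (sym (ℤ.neg-distrib-+ (at (s a) (λ z → g (z ∷ as ++ y ∷ x ∷ bs))) _))
  where
  at-neg : ∀ m → at m (λ z → g (z ∷ as ++ x ∷ y ∷ bs)) ≡ - at m (λ z → g (z ∷ as ++ y ∷ x ∷ bs))
  at-neg nothing  = refl
  at-neg (just z) = transpose alt (z ∷ as) x y bs

-- The cross terms, in which s and t act on different entries, cancel.
der-comm : ∀ s t u →
  (∀ x f → at (s x) (λ y → at (t y) f) ≡ at (t x) (λ y → at (s y) f) ⊕ at (u x) f) →
  ∀ g b → der s (der t g) b ≡ der t (der s g) b ⊕ der u g b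
der-comm s t u stu g []       = refl
der-comm s t u stu g (x ∷ xs) = begin
  at (s x) (λ y → at (t y) (λ z → g (z ∷ xs)) ⊕ der t (g ∘ (y ∷_)) xs) ⊕
  der s (λ ys → at (t x) (λ z → g (z ∷ ys)) ⊕ der t (g ∘ (x ∷_)) ys) xs
    ≡⟨ expand s t ⟩
  (at (s x) (λ y → at (t y) (λ z → g (z ∷ xs))) ⊕ der t (λ ys → at (s x) λ y → g (y ∷ ys)) xs) ⊕
  (der s (λ ys → at (t x) (λ z → g (z ∷ ys))) xs ⊕ der s (der t (g ∘ (x ∷_))) xs)
    ≡⟨ cong₂ _⊕_ (cong (_⊕ der t (λ ys → at (s x) λ y → g (y ∷ ys)) xs) (stu x λ z → g (z ∷ xs)))
                 (cong (der s (λ ys → at (t x) (λ z → g (z ∷ ys))) xs ⊕_) (der-comm s t u stu (g ∘ (x ∷_)) xs)) ⟩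
  ((at (t x) (λ y → at (s y) (λ z → g (z ∷ xs))) ⊕ at (u x) (λ z → g (z ∷ xs))) ⊕ der t (λ ys → at (s x) λ y → g (y ∷ ys)) xs) ⊕
  (der s (λ ys → at (t x) (λ z → g (z ∷ ys))) xs ⊕ (der t (der s (g ∘ (x ∷_))) xs ⊕ der u (g ∘ (x ∷_)) xs))
    ≡⟨ lemma (at (t x) (λ y → at (s y) (λ z → g (z ∷ xs)))) _ _ _ _ _ ⟩
  ((at (t x) (λ y → at (s y) (λ z → g (z ∷ xs))) ⊕ der s (λ ys → at (t x) λ y → g (y ∷ ys)) xs) ⊕
   (der t (λ ys → at (s x) (λ z → g (z ∷ ys))) xs ⊕ der t (der s (g ∘ (x ∷_))) xs)) ⊕
  (at (u x) (λ z → g (z ∷ xs)) ⊕ der u (g ∘ (x ∷_)) xs)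
    ≡⟨ cong (_⊕ der u g (x ∷ xs)) (sym (expand t s)) ⟩
  der t (der s g) (x ∷ xs) ⊕ der u g (x ∷ xs) ∎
  where
  open ≡-Reasoning
  expand : ∀ s t → der s (der t g) (x ∷ xs) ≡
    (at (s x) (λ y → at (t y) (λ z → g (z ∷ xs))) ⊕ der t (λ ys → at (s x) λ y → g (y ∷ ys)) xs) ⊕
    (der s (λ ys → at (t x) (λ z → g (z ∷ ys))) xs ⊕ der s (der t (g ∘ (x ∷_))) xs)
  expand s t = cong₂ _⊕_
    (trans (at-+ (s x) _ _) (cong (at (s x) (λ y → at (t y) (λ z → g (z ∷ xs))) ⊕_) (der-at t (s x) (λ y ys → g (y ∷ ys)) xs)))
    (der-+ s (λ ys → at (t x) (λ z → g (z ∷ ys))) _ xs)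
  lemma : ∀ a b c d e f → ((a ⊕ b) ⊕ c) ⊕ (d ⊕ (e ⊕ f)) ≡ ((a ⊕ d) ⊕ (c ⊕ e)) ⊕ (b ⊕ f)
  lemma = solve-∀

der-cong-at : ∀ s {g h} b →
  (∀ as x bs → b ≡ as ++ x ∷ bs → at (s x) (λ y → g (as ++ y ∷ bs)) ≡ at (s x) (λ y → h (as ++ y ∷ bs))) →
  der s g b ≡ der s h b
der-cong-at s []       _ = refl
der-cong-at s (x ∷ xs) e =
  cong₂ _⊕_ (e [] x xs refl) (der-cong-at s xs λ as y bs xs≡ → e (x ∷ as) y bs (cong (x ∷_) xs≡))

-- The mechanism by which unwanted terms disappear: a bead that lands on an occupied position
-- produces a repeated entry.
der-vanish : ∀ s {g} → Alternating g → ∀ b →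
  (∀ as x bs → b ≡ as ++ x ∷ bs → ∀ {y} → s x ≡ just y → y ∈ as ++ bs) → der s g b ≡ 0ℤ
der-vanish s {g} alt b hit = trans (der-cong-at s b zeros) (der-0 s b)
  where
  zeros : ∀ as x bs → b ≡ as ++ x ∷ bs → at (s x) (λ y → g (as ++ y ∷ bs)) ≡ at (s x) (λ _ → 0ℤ)
  zeros as x bs b≡ with s x in sx
  ... | nothing = refl
  ... | just y  = vanish alt as bs (hit as x bs b≡ sx)

-- Beads and the commutation relation

up : ℕ → ℕ → Maybe ℕ
up k x = just (x + k)

down : ℕ → ℕ → Maybe ℕ
down m x with m ≤? x
... | yes _ = just (x ∸ m)
... | no  _ = nothing

-- The one-bead commutator. Raising by `k` and then lowering by `m` succeeds where the opposite
-- order fails exactly for a bead below `m` that is carried to `m` or beyond.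
cross : ℕ → ℕ → ℕ → Maybe ℕ
cross k m x with m ≤? x | m ≤? x + k
... | no _ | yes _ = just (x + k ∸ m)
... | _    | _     = nothing

up-down : ∀ k m g b → der (up k) (der (down m) g) b ≡ der (down m) (der (up k) g) b ⊕ der (cross k m) g b
up-down k m = der-comm (up k) (down m) (cross k m) commute
  where
  commute : ∀ x f → at (down m (x + k)) f ≡ at (down m x) (λ y → f (y + k)) ⊕ at (cross k m x) f
  commute x f with m ≤? x | m ≤? x + k
  ... | yes m≤x | yes _    = trans (cong f (ℕ.+-∸-comm k m≤x)) (sym (ℤ.+-identityʳ _))
  ... | yes m≤x | no m≰x+k = contradiction (ℕ.≤-trans m≤x (ℕ.m≤m+n x k)) m≰x+k
  ... | no _    | yes _    = sym (ℤ.+-identityˡ _)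
  ... | no _    | no _     = refl

∈-delete : ∀ {A : Set} {x y : A} as {bs} → y ≢ x → y ∈ as ++ x ∷ bs → y ∈ as ++ bs
∈-delete []       y≢x (here y≡x)  = contradiction y≡x y≢x
∈-delete []       y≢x (there y∈)  = y∈
∈-delete (a ∷ as) y≢x (here y≡a)  = here y≡a
∈-delete (a ∷ as) y≢x (there y∈)  = there (∈-delete as y≢x y∈)

∉-delete : ∀ {A : Set} {x : A} as {bs} → Unique (as ++ x ∷ bs) → x ∉ as ++ bs
∉-delete []       (x≢ ∷ _) x∈         = All.lookup x≢ x∈ refl
∉-delete (a ∷ as) (a≢ ∷ _) (here refl) = All.lookup a≢ (∈-insert as) refl
∉-delete (a ∷ as) (_ ∷ u)  (there x∈) = ∉-delete as u x∈

-- The bead lands at x + k - m, which is below `k` because x is below `m`, and which differs from x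
-- because `k ≢ m`. As every position below `k` is occupied, it meets another bead.
cross-vanish : ∀ {k m g} → Alternating g → k ≢ m → ∀ b → (∀ {y} → y < k → y ∈ b) → der (cross k m) g b ≡ 0ℤ
cross-vanish {k} {m} alt k≢m b full = der-vanish (cross k m) alt b hit
  where
  hit : ∀ as x bs → b ≡ as ++ x ∷ bs → ∀ {y} → cross k m x ≡ just y → y ∈ as ++ bs
  hit as x bs refl eq with m ≤? x | m ≤? x + k
  hit as x bs refl refl | no m≰x | yes m≤x+k = ∈-delete as moved (full small)
    where
    moved : x + k ∸ m ≢ x
    moved e = k≢m (ℕ.+-cancelˡ-≡ x k m (trans (sym (ℕ.m∸n+n≡m m≤x+k)) (cong (_+ m) e)))
    small : x + k ∸ m < k
    small = ℕ.+-cancelʳ-< m _ k (subst (_< k + m) (sym (ℕ.m∸n+n≡m m≤x+k))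
              (subst (x + k <_) (ℕ.+-comm m k) (ℕ.+-monoˡ-< k (ℕ.≰⇒> m≰x))))

below : ℕ → List ℕ → ℕ
below m []       = 0
below m (x ∷ xs) with m ≤? x
... | yes _ = below m xs
... | no  _ = suc (below m xs)

-- For k = m the bead returns to its place, so each bead below `m` contributes `g b` once. When all
-- positions below `m` are filled this count is m, the constant of the commutation rule.
cross-diagonal : ∀ m g b → der (cross m m) g b ≡ ℤ.+ below m b ⊛ g b
cross-diagonal m g []       = refl
cross-diagonal m g (x ∷ xs) with m ≤? x | m ≤? x + m
... | yes _ | yes _ = trans (ℤ.+-identityˡ _) (cross-diagonal m (g ∘ (x ∷_)) xs)
... | yes _ | no _  = trans (ℤ.+-identityˡ _) (cross-diagonal m (g ∘ (x ∷_)) xs)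
... | no _  | no m≰ = contradiction (ℕ.m≤n+m m x) m≰
... | no _  | yes _ = begin
  g (x + m ∸ m ∷ xs) ⊕ der (cross m m) (g ∘ (x ∷_)) xs  ≡⟨ cong₂ _⊕_ (cong (λ y → g (y ∷ xs)) (ℕ.m+n∸n≡m x m)) (cross-diagonal m (g ∘ (x ∷_)) xs) ⟩
  g (x ∷ xs) ⊕ ℤ.+ below m xs ⊛ g (x ∷ xs)                ≡⟨ ℤ.suc-* (ℤ.+ below m xs) (g (x ∷ xs)) ⟨
  ℤ.+ suc (below m xs) ⊛ g (x ∷ xs)                       ∎
  where open ≡-Reasoning

-- The i-th bead, i < N, is at ρ i + (N - 1 - i).
β : ℕ → (ℕ → ℕ) → List ℕ
β zero    ρ = []
β (suc N) ρ = ρ 0 + N ∷ β N (ρ ∘ suc)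

Decreasing : (ℕ → ℕ) → Set
Decreasing ρ = ∀ r → ρ (suc r) ≤ ρ r

VanishesFrom : ℕ → (ℕ → ℕ) → Set
VanishesFrom L ρ = ∀ r → L ≤ r → ρ r ≡ 0

β-below-head : ∀ N {ρ} → Decreasing ρ → All (_< ρ 0 + N) (β N ρ)
β-below-head zero    dec = []
β-below-head (suc N) {ρ} dec =
  ℕ.+-monoʳ-< (ρ 0) (ℕ.n<1+n N) ∷
  All.map (λ y< → ℕ.<-≤-trans y< (ℕ.+-mono-≤ (dec 0) (ℕ.n≤1+n N))) (β-below-head N (dec ∘ suc))

β-head> : ∀ N {ρ} → Decreasing ρ → All (_< ρ 0 + N) (β N (ρ ∘ suc))
β-head> N dec = All.map (λ y< → ℕ.<-≤-trans y< (ℕ.+-monoˡ-≤ N (dec 0))) (β-below-head N (dec ∘ suc))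

β-unique : ∀ N {ρ} → Decreasing ρ → Unique (β N ρ)
β-unique zero    dec = []
β-unique (suc N) dec = All.map ℕ.>⇒≢ (β-head> N dec) ∷ β-unique N (dec ∘ suc)

-- At most `L` nonzero rows disturb at most the top `L` beads. The induction strips these rows,
-- after which the remaining beads occupy an initial segment of positions.
β-full : ∀ N L {ρ y} → VanishesFrom L ρ → y + L < N → y ∈ β N ρ
β-full (suc N) (suc L) {y = y} van y+L<N =
  there (β-full N L (λ r → van (suc r) ∘ s≤s) (s≤s⁻¹ (subst (_< suc N) (ℕ.+-suc y L) y+L<N)))
β-full (suc N) zero {ρ} {y} van y<N with y ≟ N
... | yes refl = here (cong (_+ y) (sym (van 0 z≤n)))
... | no y≢N   =
  there (β-full N zero (λ r _ → van (suc r) z≤n)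
    (subst (_< N) (sym (ℕ.+-identityʳ y)) (ℕ.≤∧≢⇒< (s≤s⁻¹ (subst (_< suc N) (ℕ.+-identityʳ y) y<N)) y≢N)))

below-all : ∀ {m} b → All (_< m) b → below m b ≡ length b
below-all []      []         = refl
below-all {m} (x ∷ b) (x<m ∷ b<m) with m ≤? x
... | yes m≤x = contradiction x<m (ℕ.≤⇒≯ m≤x)
... | no _    = cong suc (below-all b b<m)

β-length : ∀ N ρ → length (β N ρ) ≡ N
β-length zero    ρ = refl
β-length (suc N) ρ = cong suc (β-length N (ρ ∘ suc))

β-cong : ∀ N {ρ σ} → (∀ r → ρ r ≡ σ r) → β N ρ ≡ β N σ
β-cong zero    ρ≡σ = refl
β-cong (suc N) ρ≡σ = cong₂ (λ p b → p + N ∷ b) (ρ≡σ 0) (β-cong N (ρ≡σ ∘ suc))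

-- While `L` is positive, `m + L ≤ N` keeps the head bead at or above `m`. In the remaining vacuum,
-- heads are skipped until exactly `m` beads are left, and all of those lie below `m`.
below-β : ∀ N L {ρ m} → VanishesFrom L ρ → m + L ≤ N → below m (β N ρ) ≡ m
below-β zero zero {m = zero} van m≤N = refl
below-β (suc N) (suc L) {ρ} {m} van m≤N with m ≤? ρ 0 + N
... | yes _ = below-β N L (λ r → van (suc r) ∘ s≤s) (s≤s⁻¹ (subst (_≤ suc N) (ℕ.+-suc m L) m≤N))
... | no m≰ = contradiction (ℕ.≤-trans (ℕ.m≤m+n m L) (ℕ.≤-trans (s≤s⁻¹ (subst (_≤ suc N) (ℕ.+-suc m L) m≤N)) (ℕ.m≤n+m N _))) m≰
below-β (suc N) zero {ρ} {m} van m≤N with m ≟ suc N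
... | yes refl = trans (below-all (β m ρ) (subst (λ p → All (_< p + m) (β m ρ)) (van 0 z≤n) (β-below-head m dec))) (β-length m ρ)
  where
  dec : Decreasing ρ
  dec r = ℕ.≤-reflexive (trans (van (suc r) z≤n) (sym (van r z≤n)))
... | no m≢ with m ≤? ρ 0 + N
...   | yes _ = below-β N zero (λ r _ → van (suc r) z≤n) (subst (_≤ N) (sym (ℕ.+-identityʳ m)) m≤N′)
  where
  m≤N′ : m ≤ N
  m≤N′ = s≤s⁻¹ (ℕ.≤∧≢⇒< (subst (_≤ suc N) (ℕ.+-identityʳ m) m≤N) m≢)
...   | no m≰ = contradiction (ℕ.≤-trans (s≤s⁻¹ (ℕ.≤∧≢⇒< (subst (_≤ suc N) (ℕ.+-identityʳ m) m≤N) m≢)) (ℕ.m≤n+m N _)) m≰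

-- The empty partition fills the positions 0, ..., N - 1, so a lowered bead always collides: there
-- is no ribbon to remove.
down-vacuum : ∀ {m g} → Alternating g → 0 < m → ∀ N → der (down m) g (β N (λ _ → 0)) ≡ 0ℤ
down-vacuum {m} alt 0<m N = der-vanish (down m) alt (β N _) hit
  where
  hit : ∀ as x bs → β N (λ _ → 0) ≡ as ++ x ∷ bs → ∀ {y} → down m x ≡ just y → y ∈ as ++ bs
  hit as x bs b≡ eq with m ≤? x
  hit as x bs b≡ refl | yes m≤x = ∈-delete as (ℕ.<⇒≢ x∸m<x)
    (subst (x ∸ m ∈_) b≡ (β-full N 0 (λ _ _ → refl) (subst (_< N) (sym (ℕ.+-identityʳ _)) (ℕ.<-trans x∸m<x x<N))))
    where
    x∸m<x : x ∸ m < x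
    x∸m<x = ℕ.∸-monoʳ-< 0<m m≤x
    x<N : x < N
    x<N = All.lookup (β-below-head N (λ _ → z≤n)) (subst (x ∈_) (sym b≡) (∈-insert as))

-- The sign function and the effect of replacing one entry.

sg : ℕ → ℕ → ℤ
sg zero    zero    = 0ℤ
sg zero    (suc _) = -1ℤ
sg (suc _) zero    = 1ℤ
sg (suc x) (suc y) = sg x y

sgs : ℕ → List ℕ → ℤ
sgs z []       = 1ℤ
sgs z (y ∷ ys) = sg z y ⊛ sgs z ys

-- The sign of the Vandermonde product: 0 at a repetition, otherwise the sign of the permutation
-- that sorts the list into decreasing order.
Sgn : List ℕ → ℤ
Sgn []       = 1ℤ
Sgn (x ∷ xs) = sgs x xs ⊛ Sgn xs

sg-antisym : ∀ x y → sg x y ≡ - sg y x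
sg-antisym zero    zero    = refl
sg-antisym zero    (suc y) = refl
sg-antisym (suc x) zero    = refl
sg-antisym (suc x) (suc y) = sg-antisym x y

sg-> : ∀ {x y} → y < x → sg x y ≡ 1ℤ
sg-> {suc x} {zero}  _         = refl
sg-> {suc x} {suc y} (s≤s y<x) = sg-> y<x

sg-square : ∀ {x y} → x ≢ y → sg x y ⊛ sg x y ≡ 1ℤ
sg-square {zero}  {zero}  x≢y = contradiction refl x≢y
sg-square {zero}  {suc _} x≢y = refl
sg-square {suc _} {zero}  x≢y = refl
sg-square {suc _} {suc _} x≢y = sg-square (x≢y ∘ cong suc)

sgs-middle : ∀ z as x bs → sgs z (as ++ x ∷ bs) ≡ sg z x ⊛ sgs z (as ++ bs)
sgs-middle z []       x bs = refl
sgs-middle z (a ∷ as) x bs = trans (cong (sg z a ⊛_) (sgs-middle z as x bs)) (*-exchange (sg z a) (sg z x) _)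

sgs-square : ∀ {z} b → z ∉ b → sgs z b ⊛ sgs z b ≡ 1ℤ
sgs-square []      _  = refl
sgs-square {z} (y ∷ b) z∉ =
  trans (lemma (sg z y) (sgs z b)) (cong₂ _⊛_ (sg-square (z∉ ∘ here)) (sgs-square b (z∉ ∘ there)))
  where
  lemma : ∀ a c → (a ⊛ c) ⊛ (a ⊛ c) ≡ (a ⊛ a) ⊛ (c ⊛ c)
  lemma = solve-∀

Sgn-Alternating : Alternating Sgn
Sgn-Alternating .transpose [] x y bs =
  trans (cong (λ s → (s ⊛ sgs x bs) ⊛ (sgs y bs ⊛ Sgn bs)) (sg-antisym x y))
        (lemma (sg y x) (sgs x bs) (sgs y bs) (Sgn bs))
  where
  lemma : ∀ s a b c → (- s ⊛ a) ⊛ (b ⊛ c) ≡ - ((s ⊛ b) ⊛ (a ⊛ c))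
  lemma = solve-∀
Sgn-Alternating .transpose (a ∷ as) x y bs =
  trans (cong₂ _⊛_ swapped (transpose Sgn-Alternating as x y bs)) (sym (ℤ.neg-distribʳ-* (sgs a (as ++ y ∷ x ∷ bs)) _))
  where
  swapped : sgs a (as ++ x ∷ y ∷ bs) ≡ sgs a (as ++ y ∷ x ∷ bs)
  swapped = trans (sgs-middle a as x (y ∷ bs)) (trans (cong (sg a x ⊛_) (sgs-middle a as y bs))
           (trans (*-exchange (sg a x) (sg a y) _)
           (sym (trans (sgs-middle a as y (x ∷ bs)) (cong (sg a y ⊛_) (sgs-middle a as x bs))))))

Sgn-β : ∀ N {ρ} → Decreasing ρ → Sgn (β N ρ) ≡ 1ℤ
Sgn-β zero    dec = refl
Sgn-β (suc N) dec = cong₂ _⊛_ (ones (β-head> N dec)) (Sgn-β N (dec ∘ suc))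
  where
  ones : ∀ {z b} → All (_< z) b → sgs z b ≡ 1ℤ
  ones []           = refl
  ones (y<z ∷ b<z) = cong₂ _⊛_ (sg-> y<z) (ones b<z)

-- Bringing `z` or `x` to the front costs the same sign, and `sgs x (as ++ bs)` is its own inverse
-- because `x` does not occur among the other entries.
Sgn-replace : ∀ z as x bs → Unique (as ++ x ∷ bs) →
  Sgn (as ++ z ∷ bs) ≡ (sgs x (as ++ bs) ⊛ sgs z (as ++ bs)) ⊛ Sgn (as ++ x ∷ bs)
Sgn-replace z as x bs u = begin
  Sgn (as ++ z ∷ bs)                   ≡⟨ move Sgn-Alternating z as bs ⟩
  s ⊛ (Z ⊛ C)                          ≡⟨ ℤ.*-identityˡ _ ⟨
  1ℤ ⊛ (s ⊛ (Z ⊛ C))                   ≡⟨ cong (_⊛ (s ⊛ (Z ⊛ C))) (sgs-square (as ++ bs) (∉-delete as u)) ⟨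
  (X ⊛ X) ⊛ (s ⊛ (Z ⊛ C))              ≡⟨ lemma X s Z C ⟩
  (X ⊛ Z) ⊛ (s ⊛ (X ⊛ C))              ≡⟨ cong ((X ⊛ Z) ⊛_) (move Sgn-Alternating x as bs) ⟨
  (X ⊛ Z) ⊛ Sgn (as ++ x ∷ bs)         ∎
  where
  open ≡-Reasoning
  s = -1ℤ ℤ.^ length as
  X = sgs x (as ++ bs)
  Z = sgs z (as ++ bs)
  C = Sgn (as ++ bs)
  lemma : ∀ X s Z C → (X ⊛ X) ⊛ (s ⊛ (Z ⊛ C)) ≡ (X ⊛ Z) ⊛ (s ⊛ (X ⊛ C))
  lemma = solve-∀

-- Removal against addition of ribbons for the sign function

-- The sign of (t - 1/2) - y. A threshold between two positions never ties with a bead, so it is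
-- never 0, unlike `sg`.
side : ℕ → ℕ → ℤ
side zero    y       = -1ℤ
side (suc t) zero    = 1ℤ
side (suc t) (suc y) = side t y

-- (-1) to the number of beads of b at positions ≥ t.
τ : List ℕ → ℕ → ℤ
τ []      t = 1ℤ
τ (y ∷ b) t = side t y ⊛ τ b t

2ℤ : ℤ
2ℤ = ℤ.+ 2

side-sg : ∀ {z y} → y ≢ z → side z y ≡ sg z y
side-sg {zero}  {zero}  y≢z = contradiction refl y≢z
side-sg {zero}  {suc y} y≢z = refl
side-sg {suc z} {zero}  y≢z = refl
side-sg {suc z} {suc y} y≢z = side-sg (y≢z ∘ cong suc)

side-suc : ∀ {z y} → y ≢ z → side (suc z) y ≡ side z y
side-suc {zero}  {zero}  y≢z = contradiction refl y≢z
side-suc {zero}  {suc y} y≢z = refl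
side-suc {suc z} {zero}  y≢z = refl
side-suc {suc z} {suc y} y≢z = side-suc (y≢z ∘ cong suc)

side-diag : ∀ z → side z z ≡ -1ℤ
side-diag zero    = refl
side-diag (suc z) = side-diag z

side-suc-diag : ∀ z → side (suc z) z ≡ 1ℤ
side-suc-diag zero    = refl
side-suc-diag (suc z) = side-suc-diag z

side-> : ∀ {t y} → y < t → side t y ≡ 1ℤ
side-> {suc t} {zero}  _         = refl
side-> {suc t} {suc y} (s≤s y<t) = side-> y<t

side-≤ : ∀ {t y} → t ≤ y → side t y ≡ -1ℤ
side-≤ z≤n       = refl
side-≤ (s≤s t≤y) = side-≤ t≤y

sg-diag : ∀ z → sg z z ≡ 0ℤ
sg-diag zero    = refl
sg-diag (suc z) = sg-diag z

τ-∉ : ∀ {t} b → t ∉ b → τ b (suc t) ≡ τ b t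
τ-∉ []      _  = refl
τ-∉ (y ∷ b) t∉ = cong₂ _⊛_ (side-suc (t∉ ∘ here ∘ sym)) (τ-∉ b (t∉ ∘ there))

sgs-∉ : ∀ {z} b → z ∉ b → sgs z b ≡ τ b z
sgs-∉ []      _  = refl
sgs-∉ (y ∷ b) z∉ = cong₂ _⊛_ (sym (side-sg (z∉ ∘ here ∘ sym))) (sgs-∉ b (z∉ ∘ there))

τ-middle : ∀ as x bs t → τ (as ++ x ∷ bs) t ≡ side t x ⊛ τ (as ++ bs) t
τ-middle []       x bs t = refl
τ-middle (a ∷ as) x bs t = trans (cong (side t a ⊛_) (τ-middle as x bs t)) (*-exchange (side t a) (side t x) _)

-- The threshold x + 1 lies just above `x`, so `x` contributes 1 and can be put back into the
-- product. This makes the sign depend on the whole bead list rather than on a list with one bead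
-- deleted.
sgs-others : ∀ as x bs → Unique (as ++ x ∷ bs) → sgs x (as ++ bs) ≡ τ (as ++ x ∷ bs) (suc x)
sgs-others as x bs u = begin
  sgs x (as ++ bs)                        ≡⟨ sgs-∉ (as ++ bs) x∉ ⟩
  τ (as ++ bs) x                          ≡⟨ τ-∉ (as ++ bs) x∉ ⟨
  τ (as ++ bs) (suc x)                    ≡⟨ ℤ.*-identityˡ _ ⟨
  1ℤ ⊛ τ (as ++ bs) (suc x)               ≡⟨ cong (_⊛ τ (as ++ bs) (suc x)) (side-suc-diag x) ⟨
  side (suc x) x ⊛ τ (as ++ bs) (suc x)   ≡⟨ τ-middle as x bs (suc x) ⟨
  τ (as ++ x ∷ bs) (suc x)                ∎
  where
  open ≡-Reasoning
  x∉ = ∉-delete as u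

-- The mean over the thresholds on the two sides of `z`: they agree if `z` is free, and are opposite
-- if `z` is occupied, where `sgs z b` is 0.
double-sgs : ∀ z b → Unique b → 2ℤ ⊛ sgs z b ≡ τ b z ⊕ τ b (suc z)
double-sgs z []      _ = refl
double-sgs z (y ∷ b) (y≢ ∷ u) with y ≟ z
... | yes refl rewrite sg-diag z | side-diag z | side-suc-diag z | τ-∉ b (λ z∈ → All.lookup y≢ z∈ refl) = lemma (τ b z)
  where
  lemma : ∀ a → 0ℤ ≡ -1ℤ ⊛ a ⊕ 1ℤ ⊛ a
  lemma = solve-∀
... | no y≢z rewrite side-suc y≢z | side-sg y≢z = begin
  2ℤ ⊛ (sg z y ⊛ sgs z b)                 ≡⟨ lemma (sg z y) (sgs z b) ⟩
  sg z y ⊛ (2ℤ ⊛ sgs z b)                 ≡⟨ cong (sg z y ⊛_) (double-sgs z b u) ⟩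
  sg z y ⊛ (τ b z ⊕ τ b (suc z))          ≡⟨ ℤ.*-distribˡ-+ (sg z y) _ _ ⟩
  sg z y ⊛ τ b z ⊕ sg z y ⊛ τ b (suc z)   ∎
  where
  open ≡-Reasoning
  lemma : ∀ a c → 2ℤ ⊛ (a ⊛ c) ≡ a ⊛ (2ℤ ⊛ c)
  lemma = solve-∀

∑< : ℕ → (ℕ → ℤ) → ℤ
∑< zero    f = 0ℤ
∑< (suc n) f = ∑< n f ⊕ f n

∑<-cong : ∀ n {f g : ℕ → ℤ} → (∀ t → f t ≡ g t) → ∑< n f ≡ ∑< n g
∑<-cong zero    f≡g = refl
∑<-cong (suc n) f≡g = cong₂ _⊕_ (∑<-cong n f≡g) (f≡g n)

∑<-+ : ∀ n f g → ∑< n (λ t → f t ⊕ g t) ≡ ∑< n f ⊕ ∑< n g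
∑<-+ zero    f g = refl
∑<-+ (suc n) f g = trans (cong (_⊕ (f n ⊕ g n)) (∑<-+ n f g)) (+-exchange (∑< n f) _ _ _)

∑<-*ˡ : ∀ n c f → ∑< n (λ t → c ⊛ f t) ≡ c ⊛ ∑< n f
∑<-*ˡ zero    c f = sym (ℤ.*-zeroʳ c)
∑<-*ˡ (suc n) c f = trans (cong (_⊕ c ⊛ f n) (∑<-*ˡ n c f)) (sym (ℤ.*-distribˡ-+ c _ _))

∑<-zero : ∀ n {f} → (∀ {t} → t < n → f t ≡ 0ℤ) → ∑< n f ≡ 0ℤ
∑<-zero zero    f≡0 = refl
∑<-zero (suc n) f≡0 = cong₂ _⊕_ (∑<-zero n λ t<n → f≡0 (ℕ.m<n⇒m<1+n t<n)) (f≡0 (ℕ.n<1+n n))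

∑<-split : ∀ m n f → ∑< (n + m) f ≡ ∑< m f ⊕ ∑< n (λ t → f (t + m))
∑<-split m zero    f = sym (ℤ.+-identityʳ _)
∑<-split m (suc n) f = trans (cong (_⊕ f (n + m)) (∑<-split m n f)) (ℤ.+-assoc (∑< m f) _ _)

∑<-telescope : ∀ n (f : ℕ → ℤ) → ∑< n (λ t → f (suc t) ⊖ f t) ≡ f n ⊖ f 0
∑<-telescope zero    f = sym (ℤ.+-inverseʳ (f 0))
∑<-telescope (suc n) f = trans (cong (_⊕ (f (suc n) ⊖ f n)) (∑<-telescope n f)) (lemma (f n) (f 0) (f (suc n)))
  where
  lemma : ∀ a b c → (a ⊖ b) ⊕ (c ⊖ a) ≡ c ⊖ b
  lemma = solve-∀

δ : ℕ → ℕ → ℤ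
δ y t with y ≟ t
... | yes _ = 1ℤ
... | no  _ = 0ℤ

∑<-δ : ∀ {n y} (f : ℕ → ℤ) → y < n → ∑< n (λ t → δ y t ⊛ f t) ≡ f y
∑<-δ {suc n} {y} f y<1+n with y ≟ n
... | yes refl = trans (cong₂ _⊕_ (∑<-zero n away) (ℤ.*-identityˡ (f n))) (ℤ.+-identityˡ (f n))
  where
  away : ∀ {t} → t < n → δ n t ⊛ f t ≡ 0ℤ
  away {t} t<n with n ≟ t
  ... | yes refl = contradiction t<n (ℕ.n≮n n)
  ... | no _     = refl
... | no y≢n = trans (cong₂ _⊕_ (∑<-δ f (ℕ.≤∧≢⇒< (s≤s⁻¹ y<1+n) y≢n)) refl) (ℤ.+-identityʳ (f y))

count : List ℕ → ℕ → ℤ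
count b t = ∑ (λ y → δ y t) b

-- A sum over the beads becomes a sum over all positions, where it telescopes.
∑-positions : ∀ {n} b f → All (_< n) b → ∑ f b ≡ ∑< n (λ t → count b t ⊛ f t)
∑-positions {n} []      f []           = sym (∑<-zero n λ _ → refl)
∑-positions {n} (y ∷ b) f (y<n ∷ b<n) = begin
  f y ⊕ ∑ f b
    ≡⟨ cong₂ _⊕_ (sym (∑<-δ f y<n)) (∑-positions b f b<n) ⟩
  ∑< n (λ t → δ y t ⊛ f t) ⊕ ∑< n (λ t → count b t ⊛ f t)
    ≡⟨ ∑<-+ n _ _ ⟨
  ∑< n (λ t → δ y t ⊛ f t ⊕ count b t ⊛ f t)
    ≡⟨ ∑<-cong n (λ t → sym (ℤ.*-distribʳ-+ (f t) (δ y t) (count b t))) ⟩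
  ∑< n (λ t → count (y ∷ b) t ⊛ f t) ∎
  where open ≡-Reasoning

count-∉ : ∀ {t} b → t ∉ b → count b t ≡ 0ℤ
count-∉ {t} b t∉ = ∑-zero b away
  where
  away : ∀ {y} → y ∈ b → δ y t ≡ 0ℤ
  away {y} y∈ with y ≟ t
  ... | yes refl = contradiction y∈ t∉
  ... | no _     = refl

-- `τ b` changes sign exactly when the threshold crosses a bead, so its differences mark the
-- occupied positions.
double-count : ∀ t b → Unique b → (2ℤ ⊛ count b t) ⊛ τ b (suc t) ≡ τ b (suc t) ⊖ τ b t
double-count t []      _ = refl
double-count t (y ∷ b) (y≢ ∷ u) with y ≟ t
... | yes refl rewrite count-∉ b (λ t∈ → All.lookup y≢ t∈ refl) | side-diag t | side-suc-diag t
                     | τ-∉ b (λ t∈ → All.lookup y≢ t∈ refl) = lemma (τ b t)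
  where
  lemma : ∀ a → 2ℤ ⊛ (1ℤ ⊛ a) ≡ 1ℤ ⊛ a ⊖ -1ℤ ⊛ a
  lemma = solve-∀
... | no y≢t rewrite side-suc y≢t = begin
  (2ℤ ⊛ (0ℤ ⊕ count b t)) ⊛ (side t y ⊛ τ b (suc t))      ≡⟨ lemma (count b t) (side t y) (τ b (suc t)) ⟩
  side t y ⊛ ((2ℤ ⊛ count b t) ⊛ τ b (suc t))             ≡⟨ cong (side t y ⊛_) (double-count t b u) ⟩
  side t y ⊛ (τ b (suc t) ⊖ τ b t)                        ≡⟨ lemma′ (side t y) (τ b (suc t)) (τ b t) ⟩
  side t y ⊛ τ b (suc t) ⊖ side t y ⊛ τ b t                  ∎
  where
  open ≡-Reasoning
  lemma : ∀ c a d → (2ℤ ⊛ (0ℤ ⊕ c)) ⊛ (a ⊛ d) ≡ a ⊛ ((2ℤ ⊛ c) ⊛ d)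
  lemma = solve-∀
  lemma′ : ∀ a c d → a ⊛ (c ⊖ d) ≡ a ⊛ c ⊖ a ⊛ d
  lemma′ = solve-∀

double-∑ : ∀ {n} b (h : ℕ → ℤ) → Unique b → All (_< n) b →
  2ℤ ⊛ ∑ (λ x → τ b (suc x) ⊛ h x) b ≡ ∑< n (λ t → (τ b (suc t) ⊖ τ b t) ⊛ h t)
double-∑ {n} b h u b<n = begin
  2ℤ ⊛ ∑ (λ x → τ b (suc x) ⊛ h x) b
    ≡⟨ cong (2ℤ ⊛_) (∑-positions b (λ x → τ b (suc x) ⊛ h x) b<n) ⟩
  2ℤ ⊛ ∑< n (λ t → count b t ⊛ (τ b (suc t) ⊛ h t))
    ≡⟨ ∑<-*ˡ n 2ℤ _ ⟨
  ∑< n (λ t → 2ℤ ⊛ (count b t ⊛ (τ b (suc t) ⊛ h t)))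
    ≡⟨ ∑<-cong n (λ t → trans (lemma (count b t) (τ b (suc t)) (h t)) (cong (_⊛ h t) (double-count t b u))) ⟩
  ∑< n (λ t → (τ b (suc t) ⊖ τ b t) ⊛ h t) ∎
  where
  open ≡-Reasoning
  lemma : ∀ c a h → 2ℤ ⊛ (c ⊛ (a ⊛ h)) ≡ ((2ℤ ⊛ c) ⊛ a) ⊛ h
  lemma = solve-∀

der-∑-beads : ∀ s g f b →
  (∀ as x bs → b ≡ as ++ x ∷ bs → at (s x) (λ y → g (as ++ y ∷ bs)) ≡ f x) → der s g b ≡ ∑ f b
der-∑-beads s g f []       _ = refl
der-∑-beads s g f (x ∷ xs) h =
  cong₂ _⊕_ (h [] x xs refl) (der-∑-beads s (g ∘ (x ∷_)) f xs λ as y bs xs≡ → h (x ∷ as) y bs (cong (x ∷_) xs≡))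

-- The minus sign undoes the factor `sg (x ∸ m) x`, equal to -1, that enters because the product
-- runs over all of `b`, moving bead included. For a raised bead the corresponding factor is 1.
downTerm : List ℕ → ℕ → ℕ → ℤ
downTerm b m x = at (down m x) (λ z → - sgs z b)

module _ {m b} (0<m : 0 < m) (u : Unique b) (Sgn≡1 : Sgn b ≡ 1ℤ) where

  der-up-Sgn : der (up m) Sgn b ≡ ∑ (λ x → τ b (suc x) ⊛ sgs (x + m) b) b
  der-up-Sgn = der-∑-beads (up m) Sgn _ b term
    where
    term : ∀ as x bs → b ≡ as ++ x ∷ bs → Sgn (as ++ (x + m) ∷ bs) ≡ τ b (suc x) ⊛ sgs (x + m) b
    term as x bs refl = begin
      Sgn (as ++ (x + m) ∷ bs)
        ≡⟨ Sgn-replace (x + m) as x bs u ⟩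
      (sgs x (as ++ bs) ⊛ sgs (x + m) (as ++ bs)) ⊛ Sgn b
        ≡⟨ trans (cong ((sgs x (as ++ bs) ⊛ sgs (x + m) (as ++ bs)) ⊛_) Sgn≡1) (ℤ.*-identityʳ _) ⟩
      sgs x (as ++ bs) ⊛ sgs (x + m) (as ++ bs)
        ≡⟨ cong₂ _⊛_ (sgs-others as x bs u) (sym (ℤ.*-identityˡ _)) ⟩
      τ b (suc x) ⊛ (1ℤ ⊛ sgs (x + m) (as ++ bs))
        ≡⟨ cong (λ s → τ b (suc x) ⊛ (s ⊛ sgs (x + m) (as ++ bs))) (sym (sg-> (ℕ.m<m+n x 0<m))) ⟩
      τ b (suc x) ⊛ (sg (x + m) x ⊛ sgs (x + m) (as ++ bs))
        ≡⟨ cong (τ b (suc x) ⊛_) (sgs-middle (x + m) as x bs) ⟨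
      τ b (suc x) ⊛ sgs (x + m) b ∎
      where open ≡-Reasoning

  der-down-Sgn : der (down m) Sgn b ≡ ∑ (λ x → τ b (suc x) ⊛ downTerm b m x) b
  der-down-Sgn = der-∑-beads (down m) Sgn _ b term
    where
    term : ∀ as x bs → b ≡ as ++ x ∷ bs →
           at (down m x) (λ y → Sgn (as ++ y ∷ bs)) ≡ τ b (suc x) ⊛ downTerm b m x
    term as x bs refl with m ≤? x
    ... | no _    = sym (ℤ.*-zeroʳ (τ b (suc x)))
    ... | yes m≤x = begin
      Sgn (as ++ (x ∸ m) ∷ bs)
        ≡⟨ Sgn-replace (x ∸ m) as x bs u ⟩
      (sgs x (as ++ bs) ⊛ sgs (x ∸ m) (as ++ bs)) ⊛ Sgn b
        ≡⟨ trans (cong ((sgs x (as ++ bs) ⊛ sgs (x ∸ m) (as ++ bs)) ⊛_) Sgn≡1) (ℤ.*-identityʳ _) ⟩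
      sgs x (as ++ bs) ⊛ sgs (x ∸ m) (as ++ bs)
        ≡⟨ cong₂ _⊛_ (sgs-others as x bs u) (lemma (sgs (x ∸ m) (as ++ bs))) ⟩
      τ b (suc x) ⊛ - (-1ℤ ⊛ sgs (x ∸ m) (as ++ bs))
        ≡⟨ cong (λ s → τ b (suc x) ⊛ - (s ⊛ sgs (x ∸ m) (as ++ bs)))
                (sym (trans (sg-antisym (x ∸ m) x) (cong -_ (sg-> (ℕ.∸-monoʳ-< 0<m m≤x))))) ⟩
      τ b (suc x) ⊛ - (sg (x ∸ m) x ⊛ sgs (x ∸ m) (as ++ bs))
        ≡⟨ cong (λ s → τ b (suc x) ⊛ - s) (sgs-middle (x ∸ m) as x bs) ⟨
      τ b (suc x) ⊛ - sgs (x ∸ m) b ∎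
      where
      open ≡-Reasoning
      lemma : ∀ a → a ≡ - (-1ℤ ⊛ a)
      lemma = solve-∀

τ-beyond : ∀ {t} b → All (_< t) b → τ b t ≡ 1ℤ
τ-beyond []      []           = refl
τ-beyond (y ∷ b) (y<t ∷ b<t) = cong₂ _⊛_ (side-> y<t) (τ-beyond b b<t)

-- Beads at or above `m` contribute -1 to both factors and cancel; those below contribute only to
-- `τ b 0`.
τ-below : ∀ m b → τ b 0 ⊛ τ b m ≡ -1ℤ ℤ.^ below m b
τ-below m []      = refl
τ-below m (y ∷ b) with m ≤? y
... | yes m≤y rewrite side-≤ m≤y = trans (lemma (τ b 0) (τ b m)) (τ-below m b)
  where
  lemma : ∀ a c → (-1ℤ ⊛ a) ⊛ (-1ℤ ⊛ c) ≡ a ⊛ c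
  lemma = solve-∀
... | no m≰y rewrite side-> (ℕ.≰⇒> m≰y) = trans (lemma (τ b 0) (τ b m)) (cong (-1ℤ ⊛_) (τ-below m b))
  where
  lemma : ∀ a c → (-1ℤ ⊛ a) ⊛ (1ℤ ⊛ c) ≡ -1ℤ ⊛ (a ⊛ c)
  lemma = solve-∀

parity : ℕ → ℤ
parity zero    = 0ℤ
parity (suc m) = 1ℤ ⊖ parity m

double-parity : ∀ m → 2ℤ ⊛ parity m ≡ 1ℤ ⊖ -1ℤ ℤ.^ m
double-parity zero    = refl
double-parity (suc m) = trans (lemma (parity m)) (trans (cong (2ℤ ⊖_) (double-parity m)) (lemma′ (-1ℤ ℤ.^ m)))
  where
  lemma : ∀ a → 2ℤ ⊛ (1ℤ ⊖ a) ≡ 2ℤ ⊖ 2ℤ ⊛ a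
  lemma = solve-∀
  lemma′ : ∀ a → 2ℤ ⊖ (1ℤ ⊖ a) ≡ 1ℤ ⊖ -1ℤ ⊛ a
  lemma′ = solve-∀

-- After multiplication by 4 both sides become sums over all positions of products of sums
-- and differences of τ, and their difference is the telescoping sum of τ t τ (t + m).
up≡down+parity : ∀ {m b n} → 0 < m → Unique b → Sgn b ≡ 1ℤ → All (_< n) b → below m b ≡ m →
  der (up m) Sgn b ≡ der (down m) Sgn b ⊕ parity m
up≡down+parity {m} {b} {n} 0<m u Sgn≡1 b<n full = ℤ.*-cancelˡ-≡ (ℤ.+ 4) _ _ (begin
  ℤ.+ 4 ⊛ der (up m) Sgn b
    ≡⟨ four-up ⟩
  ∑< n U
    -- The product rule for finite differences in symmetric form: twice the difference of a product
    -- is each difference times the sum of the two values of the other factor.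
    ≡⟨ ∑<-cong n (λ t → lemma (τ b t) (τ b (suc t)) (τ b (t + m)) (τ b (suc (t + m)))) ⟩
  ∑< n (λ t → D t ⊕ 2ℤ ⊛ (T (suc t) ⊖ T t))
    ≡⟨ trans (∑<-+ n D _) (cong (∑< n D ⊕_) (trans (∑<-*ˡ n 2ℤ (λ t → T (suc t) ⊖ T t)) (cong (2ℤ ⊛_) (∑<-telescope n T)))) ⟩
  ∑< n D ⊕ 2ℤ ⊛ (T n ⊖ T 0)
    ≡⟨ cong₂ (λ d p → d ⊕ 2ℤ ⊛ p) (sym four-down) ends ⟩
  ℤ.+ 4 ⊛ der (down m) Sgn b ⊕ 2ℤ ⊛ (2ℤ ⊛ parity m)
    ≡⟨ lemma′ (der (down m) Sgn b) (parity m) ⟩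
  ℤ.+ 4 ⊛ (der (down m) Sgn b ⊕ parity m) ∎)
  where
  open ≡-Reasoning
  T U D : ℕ → ℤ
  T t = τ b t ⊛ τ b (t + m)
  U t = (τ b (suc t) ⊖ τ b t) ⊛ (τ b (t + m) ⊕ τ b (suc (t + m)))
  D t = (τ b (suc (t + m)) ⊖ τ b (t + m)) ⊛ - (τ b t ⊕ τ b (suc t))
  lemma : ∀ a a′ c c′ → (a′ ⊖ a) ⊛ (c ⊕ c′) ≡ (c′ ⊖ c) ⊛ - (a ⊕ a′) ⊕ 2ℤ ⊛ (a′ ⊛ c′ ⊖ a ⊛ c)
  lemma = solve-∀
  lemma′ : ∀ a c → ℤ.+ 4 ⊛ a ⊕ 2ℤ ⊛ (2ℤ ⊛ c) ≡ ℤ.+ 4 ⊛ (a ⊕ c)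
  lemma′ = solve-∀
  four : ∀ a → ℤ.+ 4 ⊛ a ≡ 2ℤ ⊛ (2ℤ ⊛ a)
  four = solve-∀
  comm : ∀ a c → 2ℤ ⊛ (a ⊛ c) ≡ a ⊛ (2ℤ ⊛ c)
  comm = solve-∀
  b<n+m : All (_< n + m) b
  b<n+m = All.map (λ y<n → ℕ.<-≤-trans y<n (ℕ.m≤m+n n m)) b<n
  four-up : ℤ.+ 4 ⊛ der (up m) Sgn b ≡ ∑< n U
  four-up = begin
    ℤ.+ 4 ⊛ der (up m) Sgn b
      ≡⟨ trans (cong (ℤ.+ 4 ⊛_) (der-up-Sgn 0<m u Sgn≡1)) (four _) ⟩
    2ℤ ⊛ (2ℤ ⊛ ∑ (λ x → τ b (suc x) ⊛ sgs (x + m) b) b)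
      ≡⟨ cong (2ℤ ⊛_) (double-∑ b (λ x → sgs (x + m) b) u b<n) ⟩
    2ℤ ⊛ ∑< n (λ t → (τ b (suc t) ⊖ τ b t) ⊛ sgs (t + m) b)
      ≡⟨ ∑<-*ˡ n 2ℤ _ ⟨
    ∑< n (λ t → 2ℤ ⊛ ((τ b (suc t) ⊖ τ b t) ⊛ sgs (t + m) b))
      ≡⟨ ∑<-cong n (λ t → trans (comm (τ b (suc t) ⊖ τ b t) _) (cong ((τ b (suc t) ⊖ τ b t) ⊛_) (double-sgs (t + m) b u))) ⟩
    ∑< n U ∎
  four-down : ℤ.+ 4 ⊛ der (down m) Sgn b ≡ ∑< n D
  four-down = begin
    ℤ.+ 4 ⊛ der (down m) Sgn b
      ≡⟨ trans (cong (ℤ.+ 4 ⊛_) (der-down-Sgn 0<m u Sgn≡1)) (four _) ⟩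
    2ℤ ⊛ (2ℤ ⊛ ∑ (λ x → τ b (suc x) ⊛ downTerm b m x) b)
      -- The range is enlarged to n + m: the first m positions, from which nothing can be lowered,
      -- give 0, and the shift by m then leaves exactly the range n of the other sum.
      ≡⟨ cong (2ℤ ⊛_) (double-∑ b (downTerm b m) u b<n+m) ⟩
    2ℤ ⊛ ∑< (n + m) (λ t → (τ b (suc t) ⊖ τ b t) ⊛ downTerm b m t)
      ≡⟨ cong (2ℤ ⊛_) (∑<-split m n _) ⟩
    2ℤ ⊛ (∑< m (λ t → (τ b (suc t) ⊖ τ b t) ⊛ downTerm b m t) ⊕
          ∑< n (λ t → (τ b (suc (t + m)) ⊖ τ b (t + m)) ⊛ downTerm b m (t + m)))
      ≡⟨ cong (2ℤ ⊛_) (trans (cong₂ _⊕_ (∑<-zero m low) (∑<-cong n shifted)) (ℤ.+-identityˡ _)) ⟩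
    2ℤ ⊛ ∑< n (λ t → (τ b (suc (t + m)) ⊖ τ b (t + m)) ⊛ - sgs t b)
      ≡⟨ ∑<-*ˡ n 2ℤ _ ⟨
    ∑< n (λ t → 2ℤ ⊛ ((τ b (suc (t + m)) ⊖ τ b (t + m)) ⊛ - sgs t b))
      ≡⟨ ∑<-cong n (λ t → trans (comm′ (τ b (suc (t + m)) ⊖ τ b (t + m)) (sgs t b))
                                (cong (λ s → (τ b (suc (t + m)) ⊖ τ b (t + m)) ⊛ - s) (double-sgs t b u))) ⟩
    ∑< n D ∎
    where
    comm′ : ∀ a c → 2ℤ ⊛ (a ⊛ - c) ≡ a ⊛ - (2ℤ ⊛ c)
    comm′ = solve-∀
    low : ∀ {t} → t < m → (τ b (suc t) ⊖ τ b t) ⊛ downTerm b m t ≡ 0ℤ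
    low {t} t<m with m ≤? t
    ... | yes m≤t = contradiction t<m (ℕ.≤⇒≯ m≤t)
    ... | no _    = ℤ.*-zeroʳ (τ b (suc t) ⊖ τ b t)
    shifted : ∀ t → (τ b (suc (t + m)) ⊖ τ b (t + m)) ⊛ downTerm b m (t + m) ≡
                    (τ b (suc (t + m)) ⊖ τ b (t + m)) ⊛ - sgs t b
    shifted t with m ≤? t + m
    ... | yes _  = cong (λ z → (τ b (suc (t + m)) ⊖ τ b (t + m)) ⊛ - sgs z b) (ℕ.m+n∸n≡m t m)
    ... | no m≰ = contradiction (ℕ.m≤n+m m t) m≰
  -- At n the threshold is above all beads, so `T n` is 1. At 0, `T 0` is (-1)^m because exactly m
  -- beads lie below m.
  ends : T n ⊖ T 0 ≡ 2ℤ ⊛ parity m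
  ends = trans (cong₂ _⊖_ (cong₂ _⊛_ (τ-beyond b b<n) (τ-beyond b b<n+m))
                          (trans (τ-below m b) (cong (-1ℤ ℤ.^_) full)))
               (sym (double-parity m))

-- Bead moves and ribbons

∈-mapMaybe⁺ : ∀ {A B : Set} {f : A → Maybe B} {x y xs} → x ∈ xs → f x ≡ just y → y ∈ mapMaybe f xs
∈-mapMaybe⁺ {f = f} {xs = x ∷ xs} (here refl) fx with f x | fx
... | just _ | refl = here refl
∈-mapMaybe⁺ {f = f} {xs = x ∷ xs} (there x∈) fx with f x
... | just _  = there (∈-mapMaybe⁺ x∈ fx)
... | nothing = ∈-mapMaybe⁺ x∈ fx

∈-mapMaybe⁻ : ∀ {A B : Set} (f : A → Maybe B) {y} xs → y ∈ mapMaybe f xs → ∃ λ x → x ∈ xs × f x ≡ just y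
∈-mapMaybe⁻ f (x ∷ xs) y∈ with f x in fx
∈-mapMaybe⁻ f (x ∷ xs) (here refl) | just _ = x , here refl , fx
∈-mapMaybe⁻ f (x ∷ xs) (there y∈)  | just _ with ∈-mapMaybe⁻ f xs y∈
... | x′ , x′∈ , fx′ = x′ , there x′∈ , fx′
∈-mapMaybe⁻ f (x ∷ xs) y∈          | nothing with ∈-mapMaybe⁻ f xs y∈
... | x′ , x′∈ , fx′ = x′ , there x′∈ , fx′

mapMaybe-unique : ∀ {A B : Set} (f : A → Maybe B) → (∀ {x x′ y} → f x ≡ just y → f x′ ≡ just y → x ≡ x′) →
                  ∀ {xs} → Unique xs → Unique (mapMaybe f xs)
mapMaybe-unique f inj []                 = []
mapMaybe-unique f inj {x ∷ xs} (x≢ ∷ u) with f x in fx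
... | nothing = mapMaybe-unique f inj u
... | just y  = All.tabulate fresh ∷ mapMaybe-unique f inj u
  where
  fresh : ∀ {y′} → y′ ∈ mapMaybe f xs → y ≢ y′
  fresh y′∈ refl with ∈-mapMaybe⁻ f xs y′∈
  ... | x′ , x′∈ , fx′ = All.lookup x≢ x′∈ (inj fx fx′)

-- (z , ys , h) stands for the bead list z ∷ ys, reached with h transpositions.
Move : Set
Move = ℕ × List ℕ × ℕ

-- Puts an unmoved bead `x` back in front of a moved list with top bead `z`. If `z` is smaller
-- nothing is to be sorted; at equality the term is 0 by alternation; if `z` is larger it has
-- overtaken `x`, at the cost of one transposition.
push : ℕ → Move → Maybe Move
push x (z , ys , h) with <-cmp z x
... | tri< _ _ _ = just (x , z ∷ ys , h)
... | tri≈ _ _ _ = nothing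
... | tri> _ _ _ = just (z , x ∷ ys , suc h)

push-< : ∀ {x z} ys h → z < x → push x (z , ys , h) ≡ just (x , z ∷ ys , h)
push-< {x} {z} ys h z<x with <-cmp z x
... | tri< _ _ _    = refl
... | tri≈ z≮x _ _ = contradiction z<x z≮x
... | tri> z≮x _ _ = contradiction z<x z≮x

push-> : ∀ {x z} ys h → x < z → push x (z , ys , h) ≡ just (z , x ∷ ys , suc h)
push-> {x} {z} ys h x<z with <-cmp z x
... | tri< _ _ x≮z = contradiction x<z x≮z
... | tri≈ _ _ x≮z = contradiction x<z x≮z
... | tri> _ _ _   = refl

moves : ℕ → List ℕ → List Move
moves k []       = []
moves k (x ∷ xs) = (x + k , xs , 0) ∷ mapMaybe (push x) (moves k xs)

signed : (List ℕ → ℤ) → Move → ℤ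
signed g (z , ys , h) = (-1ℤ ℤ.^ h) ⊛ g (z ∷ ys)

∑-push : ∀ {g} → Alternating g → ∀ x ms → ∑ (signed g) (mapMaybe (push x) ms) ≡ ∑ (signed (g ∘ (x ∷_))) ms
∑-push alt x []                    = refl
∑-push {g} alt x ((z , ys , h) ∷ ms) with <-cmp z x
... | tri< _ _ _    = cong (signed g (x , z ∷ ys , h) ⊕_) (∑-push alt x ms)
... | tri≈ _ refl _ = trans (∑-push alt x ms) (sym (trans (cong (_⊕ ∑ (signed (g ∘ (x ∷_))) ms) collision) (ℤ.+-identityˡ _)))
  where
  collision : (-1ℤ ℤ.^ h) ⊛ g (x ∷ x ∷ ys) ≡ 0ℤ
  collision = trans (cong ((-1ℤ ℤ.^ h) ⊛_) (vanish-head alt (here refl))) (ℤ.*-zeroʳ (-1ℤ ℤ.^ h))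
... | tri> _ _ _    = cong₂ _⊕_ (trans (cong ((-1ℤ ⊛ (-1ℤ ℤ.^ h)) ⊛_) (transpose alt [] z x ys)) (lemma (-1ℤ ℤ.^ h) (g (x ∷ z ∷ ys))))
                                (∑-push alt x ms)
  where
  lemma : ∀ s a → (-1ℤ ⊛ s) ⊛ - a ≡ s ⊛ a
  lemma = solve-∀

der-up-moves : ∀ {g} → Alternating g → ∀ k b → der (up k) g b ≡ ∑ (signed g) (moves k b)
der-up-moves alt k []           = refl
der-up-moves {g} alt k (x ∷ xs) = cong₂ _⊕_ (sym (ℤ.*-identityˡ (g (x + k ∷ xs))))
  (trans (der-up-moves (Alternating-tail alt x) k xs) (sym (∑-push alt x (moves k xs))))

push-injective : ∀ {x m m′ n} → push x m ≡ just n → push x m′ ≡ just n → m ≡ m′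
push-injective {x} {z , ys , h} {z′ , ys′ , h′} eq eq′ with <-cmp z x | <-cmp z′ x
push-injective refl refl | tri< _ _ _   | tri< _ _ _   = refl
push-injective refl refl | tri< _ _ _   | tri> _ z≢z _ = contradiction refl z≢z
push-injective refl refl | tri> _ z≢z _ | tri< _ _ _   = contradiction refl z≢z
push-injective refl refl | tri> _ _ _   | tri> _ _ _   = refl

moves-unique : ∀ {k} → 0 < k → ∀ b → Unique (moves k b)
moves-unique 0<k []           = []
moves-unique {k} 0<k (x ∷ xs) =
  All.tabulate fresh ∷ mapMaybe-unique (push x) push-injective (moves-unique 0<k xs)
  where
  fresh : ∀ {m} → m ∈ mapMaybe (push x) (moves k xs) → (x + k , xs , 0) ≢ m
  fresh m∈ refl with ∈-mapMaybe⁻ (push x) (moves k xs) m∈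
  ... | (z , ys , h) , _ , eq with <-cmp z x
  ...   | tri< _ _ _ = contradiction (sym (cong proj₁ (just-injective eq))) (ℕ.>⇒≢ (ℕ.m<m+n x 0<k))
  fresh m∈ refl | (z , ys , h) , _ , () | tri> _ _ _

-- Ribbons in terms of row lengths: `thin` lets consecutive rows of the skew shape share at most one
-- column, which excludes 2×2 squares, and `connected` makes them share at least one wherever there
-- are new cells on both sides. Inside a ribbon this forces σ (r + 1) = ρ r + 1, so bead r + 1 of σ
-- is bead r of ρ: all beads but the moving one are merely renumbered.
record Ribbon (ρ σ : ℕ → ℕ) : Set where
  constructor ribbon
  field
    grows     : ∀ r → ρ r ≤ σ r
    thin      : ∀ r → σ (suc r) ≤ suc (ρ r)
    connected : ∀ r {s t} → s ≤ r → r < t → ρ s < σ s → ρ t < σ t → ρ r < σ (suc r)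

open Ribbon

Ribbon-tail : ∀ {ρ σ} → Ribbon ρ σ → Ribbon (ρ ∘ suc) (σ ∘ suc)
Ribbon-tail rib .grows r                       = grows rib (suc r)
Ribbon-tail rib .thin r                        = thin rib (suc r)
Ribbon-tail rib .connected r s≤r r<t s-new t-new = connected rib (suc r) (s≤s s≤r) (s≤s r<t) s-new t-new

newRows : ℕ → (ℕ → ℕ) → (ℕ → ℕ) → ℕ
newRows zero    ρ σ = 0
newRows (suc N) ρ σ with ρ 0 <? σ 0
... | yes _ = suc (newRows N (ρ ∘ suc) (σ ∘ suc))
... | no  _ = newRows N (ρ ∘ suc) (σ ∘ suc)

newRows-0 : ∀ N {ρ σ} → (∀ r → ρ r ≡ σ r) → newRows N ρ σ ≡ 0
newRows-0 zero    ρ≡σ = refl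
newRows-0 (suc N) {ρ} {σ} ρ≡σ with ρ 0 <? σ 0
... | yes new = contradiction (ρ≡σ 0) (ℕ.<⇒≢ new)
... | no _    = newRows-0 N (ρ≡σ ∘ suc)

newRows-new : ∀ N ρ σ → ρ 0 < σ 0 → newRows (suc N) ρ σ ≡ suc (newRows N (ρ ∘ suc) (σ ∘ suc))
newRows-new N ρ σ new with ρ 0 <? σ 0
... | yes _    = refl
... | no ¬new = contradiction new ¬new

newRows-old : ∀ N ρ σ → ρ 0 ≡ σ 0 → newRows (suc N) ρ σ ≡ newRows N (ρ ∘ suc) (σ ∘ suc)
newRows-old N ρ σ old with ρ 0 <? σ 0
... | yes new = contradiction old (ℕ.<⇒≢ new)
... | no _    = refl

-- z need not be the actual top bead of σ, so that the induction can descend a ribbon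
-- with the moving bead held fixed.
top-move : ∀ N {k ρ σ z} → Ribbon ρ σ → Decreasing ρ → VanishesFrom (suc N) σ → ρ 0 < σ 0 → ρ 0 + N < z →
  z + sum (β N (σ ∘ suc)) ≡ sum (β (suc N) ρ) + k →
  (z , β N (σ ∘ suc) , newRows N (ρ ∘ suc) (σ ∘ suc)) ∈ moves k (β (suc N) ρ)
top-move N {k} {ρ} {σ} {z} rib dec van new z> total with ρ 0 <? σ 1
... | no ended = here (cong₂ _,_ z≡ (cong₂ _,_ (β-cong N (sym ∘ same)) (newRows-0 N same)))
  where
  same : ∀ r → ρ (suc r) ≡ σ (suc r)
  same r = ℕ.≤-antisym (grows rib (suc r))
    (ℕ.≮⇒≥ λ later → ended (connected rib 0 z≤n (s≤s z≤n) new later))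
  S = sum (β N (ρ ∘ suc))
  -- The ribbon has ended, so the remaining beads agree and comparing the two sums of beads
  -- determines `z`.
  z≡ : z ≡ ρ 0 + N + k
  z≡ = ℕ.+-cancelʳ-≡ S z _ (begin
    z + S                        ≡⟨ cong (λ b → z + sum b) (β-cong N same) ⟩
    z + sum (β N (σ ∘ suc))      ≡⟨ total ⟩
    ρ 0 + N + S + k              ≡⟨ lemma (ρ 0 + N) S k ⟩
    ρ 0 + N + k + S              ∎)
    where
    open ≡-Reasoning
    lemma : ∀ x s k → x + s + k ≡ x + k + s
    lemma = ℕSolver.solve-∀
top-move zero {ρ = ρ} rib dec van new z> total | yes next =
  contradiction (van 1 (s≤s z≤n)) (ℕ.m<n⇒n≢0 next)
top-move (suc N) {k} {ρ} {σ} {z} rib dec van new z> total | yes next =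
  subst (_∈ moves k (β (suc (suc N)) ρ))
    (cong₂ (λ y h → z , y ∷ β N (σ ∘ suc ∘ suc) , h) x≡ (sym (newRows-new N (ρ ∘ suc) (σ ∘ suc) new′)))
    (there (∈-mapMaybe⁺ {f = push (ρ 0 + suc N)} pushed (push-> _ _ z>)))
  where
  σ1≡ : σ 1 ≡ suc (ρ 0)
  σ1≡ = ℕ.≤-antisym (thin rib 0) next
  -- The ribbon continues into the next row, so the top bead of ρ is the second bead of σ: it is the
  -- one overtaken.
  x≡ : ρ 0 + suc N ≡ σ 1 + N
  x≡ = trans (ℕ.+-suc (ρ 0) N) (cong (_+ N) (sym σ1≡))
  new′ : ρ 1 < σ 1
  new′ = ℕ.≤-<-trans (dec 0) next
  total′ : z + sum (β N (σ ∘ suc ∘ suc)) ≡ sum (β (suc N) (ρ ∘ suc)) + k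
  total′ = ℕ.+-cancelˡ-≡ (ρ 0 + suc N) _ _ (begin
    ρ 0 + suc N + (z + S)                        ≡⟨ lemma (ρ 0 + suc N) z S ⟩
    z + (ρ 0 + suc N + S)                        ≡⟨ cong (λ x → z + (x + S)) x≡ ⟩
    z + (σ 1 + N + S)                            ≡⟨ total ⟩
    ρ 0 + suc N + sum (β (suc N) (ρ ∘ suc)) + k  ≡⟨ ℕ.+-assoc (ρ 0 + suc N) _ k ⟩
    ρ 0 + suc N + (sum (β (suc N) (ρ ∘ suc)) + k) ∎)
    where
    open ≡-Reasoning
    S = sum (β N (σ ∘ suc ∘ suc))
    lemma : ∀ x z s → x + (z + s) ≡ z + (x + s)
    lemma = ℕSolver.solve-∀
  pushed = top-move N {k} {ρ ∘ suc} {σ ∘ suc} {z} (Ribbon-tail rib) (dec ∘ suc) (λ r → van (suc r) ∘ s≤s) new′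
    (ℕ.≤-<-trans (ℕ.+-mono-≤ (dec 0) (ℕ.n≤1+n N)) z>) total′

-- Rows above the ribbon carry unmoved beads and are pushed back without a transposition; from the
-- first new row on `top-move` applies. The moving bead overtakes one bead for each new row after
-- the first, whence `∸ 1`.
ribbon⇒move : ∀ N {k ρ σ} → 0 < k → Ribbon ρ σ → Decreasing ρ → Decreasing σ → VanishesFrom N σ →
  sum (β N σ) ≡ sum (β N ρ) + k →
  ∃ λ z → ∃ λ ys → β N σ ≡ z ∷ ys × (z , ys , newRows N ρ σ ∸ 1) ∈ moves k (β N ρ)
ribbon⇒move zero 0<k rib decρ decσ van total = contradiction total (ℕ.<⇒≢ 0<k)
ribbon⇒move (suc N) {k} {ρ} {σ} 0<k rib decρ decσ van total with ρ 0 <? σ 0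
... | yes new = σ 0 + N , β N (σ ∘ suc) , refl , top-move N rib decρ van new (ℕ.+-monoˡ-< N new) total
... | no ¬new with ρ0≡ ← ℕ.≤-antisym (grows rib 0) (ℕ.≮⇒≥ ¬new)
  with z , ys , β≡ , z∈ ← ribbon⇒move N 0<k (Ribbon-tail rib) (decρ ∘ suc) (decσ ∘ suc) (λ r → van (suc r) ∘ s≤s)
         (ℕ.+-cancelˡ-≡ (σ 0 + N) _ _ (trans total (trans (cong (λ p → p + N + sum (β N (ρ ∘ suc)) + k) ρ0≡) (ℕ.+-assoc (σ 0 + N) _ k))))
  = σ 0 + N , β N (σ ∘ suc) , refl ,
    subst₂ (λ x ys → (x , ys , newRows N (ρ ∘ suc) (σ ∘ suc) ∸ 1) ∈ moves k (β (suc N) ρ)) (cong (_+ N) ρ0≡) (sym β≡)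
      (there (∈-mapMaybe⁺ {f = push (ρ 0 + N)} z∈ (push-< ys _ z<)))
  where
  z< : z < ρ 0 + N
  z< = subst (λ p → z < p + N) (sym ρ0≡) (All.head (subst (All (_< σ 0 + N)) β≡ (β-head> N decσ)))

infixr 5 _◂_
_◂_ : ℕ → (ℕ → ℕ) → ℕ → ℕ
(p ◂ ρ) zero    = p
(p ◂ ρ) (suc r) = ρ r

record RibbonFrom (k N : ℕ) (ρ : ℕ → ℕ) (z : ℕ) (ys : List ℕ) (h : ℕ) : Set where
  field
    σ          : ℕ → ℕ
    decreasing : Decreasing σ
    vanishes   : VanishesFrom N σ
    beads      : β N σ ≡ z ∷ ys
    isRibbon   : Ribbon ρ σ
    height     : newRows N ρ σ ≡ suc h
    total      : sum (z ∷ ys) ≡ sum (β N ρ) + k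

move⇒ribbon : ∀ N {k ρ z ys h} → 0 < k → Decreasing ρ → VanishesFrom N ρ →
  (z , ys , h) ∈ moves k (β N ρ) → RibbonFrom k N ρ z ys h
move⇒ribbon (suc N) {k} {ρ} 0<k dec van (here refl) = record
  { σ          = ρ 0 + k ◂ ρ ∘ suc
  ; decreasing = λ { zero → ℕ.≤-trans (dec 0) (ℕ.m≤m+n (ρ 0) k) ; (suc r) → dec (suc r) }
  ; vanishes   = λ { (suc r) → van (suc r) }
  ; beads      = cong (_∷ β N (ρ ∘ suc)) (lemma (ρ 0) k N)
  ; isRibbon   = record
    { grows     = λ { zero → ℕ.m≤m+n (ρ 0) k ; (suc r) → ℕ.≤-refl }
    ; thin      = λ r → ℕ.m≤n⇒m≤1+n (dec r)
    ; connected = λ { r {t = suc t} _ _ _ t-new → contradiction t-new (ℕ.n≮n _) }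
    }
  ; height     = trans (newRows-new N ρ (ρ 0 + k ◂ ρ ∘ suc) (ℕ.m<m+n (ρ 0) 0<k)) (cong suc (newRows-0 N λ _ → refl))
  ; total      = lemma′ (ρ 0 + N) k (sum (β N (ρ ∘ suc)))
  }
  where
  lemma : ∀ p k N → p + k + N ≡ p + N + k
  lemma = ℕSolver.solve-∀
  lemma′ : ∀ x k s → x + k + s ≡ x + s + k
  lemma′ = ℕSolver.solve-∀
move⇒ribbon (suc N) {k} {ρ} 0<k dec van (there m∈) with ∈-mapMaybe⁻ (push (ρ 0 + N)) (moves k (β N (ρ ∘ suc))) m∈
... | (z , ys , h) , z∈ , eq with move⇒ribbon N 0<k (dec ∘ suc) (λ r → van (suc r) ∘ s≤s) z∈ | <-cmp z (ρ 0 + N)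
move⇒ribbon (suc (suc N)) {k} {ρ} 0<k dec van (there m∈) | (z , ys , h) , z∈ , refl
  | record { σ = σ ; decreasing = decσ ; vanishes = vanσ ; beads = refl ; isRibbon = rib ; height = height ; total = total }
  | tri< z< _ _ = record
  { σ          = ρ 0 ◂ σ
  ; decreasing = λ { zero → σ0≤ ; (suc r) → decσ r }
  ; vanishes   = λ { (suc r) (s≤s N≤r) → vanσ r N≤r }
  ; beads      = refl
  ; isRibbon   = record
    { grows     = λ { zero → ℕ.≤-refl ; (suc r) → grows rib r }
    ; thin      = λ { zero → ℕ.m≤n⇒m≤1+n σ0≤ ; (suc r) → thin rib r }
    ; connected = λ { r {zero} _ _ s-new _ → contradiction s-new (ℕ.n≮n _)
                    ; (suc r) {suc s} {suc t} (s≤s s≤r) (s≤s r<t) → connected rib r s≤r r<t }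
    }
  ; height     = trans (newRows-old (suc N) ρ (ρ 0 ◂ σ) refl) height
  ; total      = trans (cong (ρ 0 + suc N +_) total) (sym (ℕ.+-assoc (ρ 0 + suc N) _ k))
  }
  where
  σ0≤ : σ 0 ≤ ρ 0
  σ0≤ = ℕ.+-cancelʳ-≤ N _ _ (s≤s⁻¹ (subst (σ 0 + N <_) (ℕ.+-suc (ρ 0) N) z<))
move⇒ribbon (suc (suc N)) {k} {ρ} 0<k dec van (there m∈) | (z , ys , h) , z∈ , refl
  | record { σ = σ ; decreasing = decσ ; vanishes = vanσ ; beads = refl ; isRibbon = rib ; height = height ; total = total }
  | tri> _ _ z> = record
  -- A row length is a bead minus the number of beads after it. The overtaking bead has one more
  -- bead after it, so its row is shortened to `pred (σ 0)`; the overtaken bead has one fewer, so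
  -- its row grows to `suc (ρ 0)`.
  { σ          = p ◂ suc (ρ 0) ◂ σ ∘ suc
  ; decreasing = λ { zero → p> ; (suc zero) → ℕ.≤-trans (thin rib 0) (s≤s (dec 0)) ; (suc (suc r)) → decσ (suc r) }
  ; vanishes   = λ { (suc (suc r)) (s≤s (s≤s N≤r)) → vanσ (suc r) (s≤s N≤r) }
  ; beads      = cong₂ (λ z x → z ∷ x ∷ β N (σ ∘ suc)) (trans (ℕ.+-suc p N) (cong (_+ N) σ0≡)) (sym (ℕ.+-suc (ρ 0) N))
  ; isRibbon   = record
    { grows     = λ { zero → ℕ.<⇒≤ p> ; (suc zero) → ℕ.m≤n⇒m≤1+n (dec 0) ; (suc (suc r)) → grows rib (suc r) }
    ; thin      = λ { zero → ℕ.≤-refl ; (suc r) → thin rib r }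
    ; connected = conn
    }
  ; height     = trans (newRows-new (suc N) ρ (p ◂ suc (ρ 0) ◂ σ ∘ suc) p>) (cong suc (trans (newRows-new N (ρ ∘ suc) (suc (ρ 0) ◂ σ ∘ suc) (s≤s (dec 0)))
                   (trans (sym (newRows-new N (ρ ∘ suc) σ new)) height)))
  ; total      = trans (lemma (σ 0 + N) (ρ 0 + suc N) (sum (β N (σ ∘ suc))))
                   (trans (cong (ρ 0 + suc N +_) total) (sym (ℕ.+-assoc (ρ 0 + suc N) _ k)))
  }
  where
  p = pred (σ 0)
  suc< : suc (ρ 0) < σ 0
  suc< = ℕ.+-cancelʳ-< N _ _ (subst (_< σ 0 + N) (ℕ.+-suc (ρ 0) N) z>)
  σ0≡ : suc p ≡ σ 0
  σ0≡ = ℕ.suc-pred (σ 0) {{>-nonZero (ℕ.≤-<-trans z≤n suc<)}}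
  p> : ρ 0 < p
  p> = s≤s⁻¹ (subst (suc (ρ 0) <_) (sym σ0≡) suc<)
  new : ρ 1 < σ 0
  new = ℕ.≤-<-trans (dec 0) (ℕ.<-trans (ℕ.n<1+n (ρ 0)) suc<)
  lemma : ∀ z x s → z + (x + s) ≡ x + (z + s)
  lemma = ℕSolver.solve-∀
  conn : ∀ r {s t} → s ≤ r → r < t → ρ s < (p ◂ suc (ρ 0) ◂ σ ∘ suc) s → ρ t < (p ◂ suc (ρ 0) ◂ σ ∘ suc) t →
         ρ r < (suc (ρ 0) ◂ σ ∘ suc) r
  conn zero    _ _ _ _ = ℕ.n<1+n (ρ 0)
  -- The top row of the tail is new, so it can serve as the upper witness whatever `s` was.
  conn (suc r) {t = suc (suc t)} _ (s≤s r<t@(s≤s _)) _ t-new = connected rib r z≤n r<t new t-new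

-- Ribbons as sets of cells

row-decreasing : ∀ {ps} → Linked _≥_ ps → Decreasing (row ps)
row-decreasing []            r       = ℕ.≤-refl
row-decreasing [-]           r       = z≤n
row-decreasing (p≥q ∷ link) zero    = p≥q
row-decreasing (p≥q ∷ link) (suc r) = row-decreasing link r

row-vanishes : ∀ ps → VanishesFrom (length ps) (row ps)
row-vanishes []       r       _         = refl
row-vanishes (p ∷ ps) (suc r) (s≤s l≤r) = row-vanishes ps r l≤r

row-positive⇒< : ∀ {j r} ps → j < row ps r → r < length ps
row-positive⇒< {r = r} ps j<row = ℕ.≰⇒> λ l≤r → contradiction (row-vanishes ps r l≤r) (ℕ.m<n⇒n≢0 j<row)

module _ (κ ν : List ℕ) where

  private
    rowCells : ℕ → List Cell
    rowCells i = applyUpTo (λ j → i , row κ i + j) (row ν i ∸ row κ i)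

    ∈-rowCells⁺ : ∀ {i j} → row κ i ≤ j → j < row ν i → (i , j) ∈ rowCells i
    ∈-rowCells⁺ {i} {j} κ≤j j<ν =
      subst (λ j → (i , j) ∈ rowCells i) (ℕ.m+[n∸m]≡n κ≤j)
        (∈-applyUpTo⁺ (λ j → i , row κ i + j) (ℕ.∸-monoˡ-< j<ν κ≤j))

    ∈-rowCells⁻ : ∀ {r i j} → (i , j) ∈ rowCells r → i ≡ r × row κ i ≤ j × j < row ν i
    ∈-rowCells⁻ {r} c∈ with ∈-applyUpTo⁻ (λ j → r , row κ r + j) c∈
    ... | j , j< , refl = refl , ℕ.m≤m+n (row κ r) j , 
      subst (row κ r + j <_) (ℕ.m+[n∸m]≡n (ℕ.<⇒≤ (ℕ.m∸n≢0⇒n<m {row ν r} {row κ r} (ℕ.m<n⇒n≢0 j<)))) (ℕ.+-monoʳ-< (row κ r) j<)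

  ∈-skewCells⁺ : ∀ {i j} → row κ i ≤ j → j < row ν i → (i , j) ∈ skewCells κ ν
  ∈-skewCells⁺ κ≤j j<ν =
    ∈-concatMap⁺ rowCells (Any.map (λ { refl → ∈-rowCells⁺ κ≤j j<ν }) (∈-upTo⁺ (row-positive⇒< ν j<ν)))

  ∈-skewCells⁻ : ∀ {i j} → (i , j) ∈ skewCells κ ν → row κ i ≤ j × j < row ν i
  ∈-skewCells⁻ c∈ = proj₂ (∈-rowCells⁻ (proj₂ (Any.satisfied (∈-concatMap⁻ rowCells {upTo (length ν)} c∈))))

  skewCells-unique : Unique (skewCells κ ν)
  skewCells-unique = Unique.concat⁺
    (All.map⁺ (All.tabulate λ {i} _ → Unique.applyUpTo⁺₁ _ _ λ j<j′ _ eq → ℕ.<⇒≢ j<j′ (ℕ.+-cancelˡ-≡ (row κ i) _ _ (cong proj₂ eq))))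
    (AllPairs.map⁺ (AllPairs.map disjoint (Unique.upTo⁺ (length ν))))
    where
    disjoint : ∀ {i i′} → i ≢ i′ → Disjoint (rowCells i) (rowCells i′)
    disjoint i≢i′ (c∈ , c∈′) = i≢i′ (trans (sym (proj₁ (∈-rowCells⁻ c∈))) (proj₁ (∈-rowCells⁻ c∈′)))

lookup-injective : ∀ {A : Set} {xs : List A} → Unique xs → ∀ a b → lookup xs a ≡ lookup xs b → a ≡ b
lookup-injective (x≢ ∷ u) Fin.zero    Fin.zero    eq = refl
lookup-injective (x≢ ∷ u) Fin.zero    (Fin.suc b) eq = contradiction eq (All.lookup x≢ (∈-lookup b))
lookup-injective (x≢ ∷ u) (Fin.suc a) Fin.zero    eq = contradiction (sym eq) (All.lookup x≢ (∈-lookup a))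
lookup-injective (x≢ ∷ u) (Fin.suc a) (Fin.suc b) eq = cong Fin.suc (lookup-injective u a b eq)

Adjacent-sym : ∀ c c′ → Adjacent c c′ → Adjacent c′ c
Adjacent-sym (i , j) (i′ , j′) adj = trans (cong₂ _+_ (ℕ.∣-∣-comm i′ i) (ℕ.∣-∣-comm j′ j)) adj

∣n-1+n∣≡1 : ∀ n → ∣ n - suc n ∣ ≡ 1
∣n-1+n∣≡1 zero    = refl
∣n-1+n∣≡1 (suc n) = ∣n-1+n∣≡1 n

Adjacent-right : ∀ i j → Adjacent (i , j) (i , suc j)
Adjacent-right i j = cong₂ _+_ (ℕ.∣n-n∣≡0 i) (∣n-1+n∣≡1 j)

Adjacent-down : ∀ i j → Adjacent (i , j) (suc i , j)
Adjacent-down i j = cong₂ _+_ (∣n-1+n∣≡1 i) (ℕ.∣n-n∣≡0 j)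

Adjacent-rows : ∀ {i j i′ j′ r} → i ≤ r → r < i′ → Adjacent (i , j) (i′ , j′) → i ≡ r × i′ ≡ suc r × j ≡ j′
Adjacent-rows {i} {j} {i′} {j′} {r} i≤r r<i′ adj
  rewrite ℕ.m≤n⇒∣m-n∣≡n∸m (ℕ.<⇒≤ (ℕ.≤-<-trans i≤r r<i′)) =
  i≡r , i′≡ , ℕ.∣m-n∣≡0⇒m≡n (ℕ.n≤0⇒n≡0 (s≤s⁻¹ (ℕ.≤-trans (ℕ.+-monoˡ-≤ ∣ j - j′ ∣ i<) (ℕ.≤-reflexive adj))))
  where
  i< : 1 ≤ i′ ∸ i
  i< = ℕ.m<n⇒0<n∸m (ℕ.≤-<-trans i≤r r<i′)
  i′≤ : i′ ≤ suc i
  i′≤ = ℕ.≤-trans (ℕ.m≤n+m∸n i′ i) (ℕ.≤-trans (ℕ.+-monoʳ-≤ i (ℕ.≤-trans (ℕ.m≤m+n _ _) (ℕ.≤-reflexive adj)))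
          (ℕ.≤-reflexive (ℕ.+-comm i 1)))
  i≡r : i ≡ r
  i≡r = ℕ.≤-antisym i≤r (s≤s⁻¹ (ℕ.≤-trans r<i′ i′≤))
  i′≡ : i′ ≡ suc r
  i′≡ = ℕ.≤-antisym (ℕ.≤-trans i′≤ (s≤s i≤r)) r<i′

module _ {κ ν : List ℕ} (decκ : Decreasing (row κ)) (decν : Decreasing (row ν)) (rib : Ribbon (row κ) (row ν)) where

  private
    cs = skewCells κ ν

    module _ (P : Cell → Set) (closed : ∀ {c c′} → c ∈ cs → c′ ∈ cs → Adjacent c c′ → P c → P c′) where

      -- Connectedness without paths: a predicate `P` closed under adjacency is carried along a row
      -- here and from row to row by `descend`. Both implications are kept because the target cell
      -- may lie above or below the source.
      sweep : ∀ {i j} d → row κ i ≤ j → d + j < row ν i → (P (i , j) → P (i , d + j)) × (P (i , d + j) → P (i , j))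
      sweep zero    κ≤j <ν = id , id
      sweep {i} {j} (suc d) κ≤j <ν with to , from ← sweep d κ≤j (ℕ.<-trans (ℕ.n<1+n _) <ν)
        = closed here∈ next∈ adj ∘ to , from ∘ closed next∈ here∈ (Adjacent-sym (i , d + j) (i , suc d + j) adj)
        where
        κ≤d+j : row κ i ≤ d + j
        κ≤d+j = ℕ.≤-trans κ≤j (ℕ.m≤n+m j d)
        here∈ : (i , d + j) ∈ cs
        here∈ = ∈-skewCells⁺ κ ν κ≤d+j (ℕ.<-trans (ℕ.n<1+n _) <ν)
        next∈ : (i , suc d + j) ∈ cs
        next∈ = ∈-skewCells⁺ κ ν (ℕ.m≤n⇒m≤1+n κ≤d+j) <ν
        adj = Adjacent-right i (d + j)

      sweep-row : ∀ {i j} → row κ i ≤ j → j < row ν i → (P (i , row κ i) → P (i , j)) × (P (i , j) → P (i , row κ i))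
      sweep-row {i} {j} κ≤j j<ν =
        subst (λ j → (P (i , row κ i) → P (i , j)) × (P (i , j) → P (i , row κ i))) (ℕ.m∸n+n≡m κ≤j)
          (sweep (j ∸ row κ i) ℕ.≤-refl (subst (_< row ν i) (sym (ℕ.m∸n+n≡m κ≤j)) j<ν))

      -- Row r is left downwards at column `row κ r`, that of its leftmost new cell; by `connected`
      -- this column still meets row r + 1.
      descend : ∀ {s} d → row κ s < row ν s → row κ (d + s) < row ν (d + s) →
                (P (s , row κ s) → P (d + s , row κ (d + s))) × (P (d + s , row κ (d + s)) → P (s , row κ s))
      descend zero    s-new t-new = id , id
      descend {s} (suc d) s-new t-new
        with contact ← connected rib (d + s) (ℕ.m≤n+m s d) (ℕ.n<1+n _) s-new t-new
        with r-new ← ℕ.<-≤-trans contact (decν (d + s))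
        with to , from ← descend d s-new r-new | along , back ← sweep-row (decκ (d + s)) contact
        = back ∘ closed (∈-skewCells⁺ κ ν ℕ.≤-refl r-new) (∈-skewCells⁺ κ ν (decκ (d + s)) contact) adj ∘ to
        , from ∘ closed (∈-skewCells⁺ κ ν (decκ (d + s)) contact) (∈-skewCells⁺ κ ν ℕ.≤-refl r-new)
                        (Adjacent-sym (d + s , row κ (d + s)) (suc d + s , row κ (d + s)) adj) ∘ along
        where
        adj = Adjacent-down (d + s) (row κ (d + s))

      spread-down : ∀ {i j i′ j′} → i ≤ i′ → (i , j) ∈ cs → (i′ , j′) ∈ cs →
                    (P (i , j) → P (i′ , j′)) × (P (i′ , j′) → P (i , j))
      spread-down {i} {j} {i′} {j′} i≤i′ c∈ c′∈
        with κ≤j , j<ν ← ∈-skewCells⁻ κ ν c∈ | κ≤j′ , j′<ν ← ∈-skewCells⁻ κ ν c′∈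
        with along , back ← sweep-row κ≤j j<ν | along′ , back′ ← sweep-row κ≤j′ j′<ν
        with to , from ← subst (λ r → row κ r < row ν r → (P (i , row κ i) → P (r , row κ r)) × (P (r , row κ r) → P (i , row κ i)))
                               (ℕ.m∸n+n≡m i≤i′) (descend (i′ ∸ i) (ℕ.≤-<-trans κ≤j j<ν)) (ℕ.≤-<-trans κ≤j′ j′<ν)
        = along′ ∘ to ∘ back , along ∘ from ∘ back′

      spread : ∀ {c c′} → c ∈ cs → c′ ∈ cs → P c → P c′
      spread {i , _} {i′ , _} c∈ c′∈ with i ≤? i′
      ... | yes i≤i′ = proj₁ (spread-down i≤i′ c∈ c′∈)
      ... | no i≰i′  = proj₂ (spread-down (ℕ.<⇒≤ (ℕ.≰⇒> i≰i′)) c′∈ c∈)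

  -- No adjacency leaves the set `S` of a separation, so membership in it spreads to every cell,
  -- including one of the complement. Cells are listed without repetition, so equal cells have equal
  -- indices.
  Ribbon⇒Connected : Connected cs
  Ribbon⇒Connected (S , (a , a∈S) , (b , b∈∁S) , separated) = x∈∁p⇒x∉p b∈∁S b∈S
    where
    InS : Cell → Set
    InS c = ∃ λ a → lookup cs a ≡ c × a Subset.∈ S
    closed : ∀ {c c′} → c ∈ cs → c′ ∈ cs → Adjacent c c′ → InS c → InS c′
    closed {c} {c′} _ c′∈ adj (a , refl , a∈S) with Any.index c′∈ ∈ₛ? S
    ... | yes b∈S = Any.index c′∈ , sym (Any.lookup-index c′∈) , b∈S
    ... | no b∉S  = contradiction (subst (Adjacent c) (Any.lookup-index c′∈) adj) (separated a (Any.index c′∈) a∈S (x∉p⇒x∈∁p b∉S))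
    b∈S : b Subset.∈ S
    b∈S with a′ , a′≡b , a′∈S ← spread InS closed (∈-lookup a) (∈-lookup b) (a , refl , a∈S)
      = subst (Subset._∈ S) (lookup-injective (skewCells-unique κ ν) a′ b a′≡b) a′∈S

  Ribbon⇒IsRibbon : IsRibbon κ ν
  Ribbon⇒IsRibbon = All.tabulate (λ {r} _ → grows rib r) , Ribbon⇒Connected , All.tabulate no-square
    where
    no-square : ∀ {c} → c ∈ cs → let i , j = c in ¬ ((suc i , j) ∈ cs × (i , suc j) ∈ cs × (suc i , suc j) ∈ cs)
    no-square {i , j} c∈ (_ , _ , c′∈) = contradiction
      (ℕ.<-≤-trans (proj₂ (∈-skewCells⁻ κ ν c′∈)) (ℕ.≤-trans (thin rib i) (s≤s (proj₁ (∈-skewCells⁻ κ ν c∈)))))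
      (ℕ.n≮n (suc j))

module _ {κ ν : List ℕ} (decκ : Decreasing (row κ)) (decν : Decreasing (row ν)) (isRibbon : IsRibbon κ ν) where

  private
    cs = skewCells κ ν

    -- The cut below row `r`. It separates the shape if rows r and r + 1 share no column while new
    -- cells lie on both sides.
    upper : ℕ → Subset (length cs)
    upper r = Vec.tabulate (λ a → does (proj₁ (lookup cs a) ≤? r))

    ∈-upper⁺ : ∀ {r} a → proj₁ (lookup cs a) ≤ r → a Subset.∈ upper r
    ∈-upper⁺ {r} a ≤r = lookup⇒[]= a (upper r) (trans (lookup∘tabulate _ a) (dec-true (_ ≤? r) ≤r))

    ∈-upper⁻ : ∀ {r} a → a Subset.∈ upper r → proj₁ (lookup cs a) ≤ r
    ∈-upper⁻ {r} a a∈ = does⇒ (_ ≤? r) (trans (sym (lookup∘tabulate _ a)) ([]=⇒lookup a∈))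
      where
      does⇒ : ∀ {P : Set} (P? : Dec P) → does P? ≡ true → P
      does⇒ (yes p) _ = p

  IsRibbon⇒Ribbon : Ribbon (row κ) (row ν)
  IsRibbon⇒Ribbon = record { grows = contained ; thin = thin′ ; connected = connected′ }
    where
    contained : ∀ r → row κ r ≤ row ν r
    contained r with r <? length κ
    ... | yes r<l = All.lookup (proj₁ isRibbon) (∈-upTo⁺ r<l)
    ... | no r≮l  = subst (_≤ row ν r) (sym (row-vanishes κ r (ℕ.≮⇒≥ r≮l))) z≤n
    thin′ : ∀ r → row ν (suc r) ≤ suc (row κ r)
    -- Two shared columns would give the 2×2 square whose upper left cell is the first new cell of
    -- row r.
    thin′ r = ℕ.≮⇒≥ λ thick → All.lookup (proj₂ (proj₂ isRibbon))
      (∈-skewCells⁺ κ ν ℕ.≤-refl (ℕ.<-≤-trans (ℕ.<-trans (ℕ.n<1+n _) thick) (decν r)))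
      ( ∈-skewCells⁺ κ ν (decκ r) (ℕ.<-trans (ℕ.n<1+n _) thick)
      , ∈-skewCells⁺ κ ν (ℕ.n≤1+n _) (ℕ.<-≤-trans thick (decν r))
      , ∈-skewCells⁺ κ ν (ℕ.m≤n⇒m≤1+n (decκ r)) thick)
    connected′ : ∀ r {s t} → s ≤ r → r < t → row κ s < row ν s → row κ t < row ν t → row κ r < row ν (suc r)
    connected′ r {s} {t} s≤r r<t s-new t-new = ℕ.≰⇒> λ gap → proj₁ (proj₂ isRibbon)
      ( upper r
      , (Any.index s∈ , ∈-upper⁺ (Any.index s∈) (subst (λ c → proj₁ c ≤ r) (Any.lookup-index s∈) s≤r))
      , (Any.index t∈ , x∉p⇒x∈∁p λ t∈S → ℕ.<⇒≱ r<t (subst (λ c → proj₁ c ≤ r) (sym (Any.lookup-index t∈)) (∈-upper⁻ (Any.index t∈) t∈S)))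
      , λ a b a∈S b∈∁S adj → apart gap (∈-lookup a) (∈-lookup b) (∈-upper⁻ a a∈S)
          (ℕ.≰⇒> λ ≤r → x∈∁p⇒x∉p b∈∁S (∈-upper⁺ b ≤r)) adj)
      where
      s∈ : (s , row κ s) ∈ cs
      s∈ = ∈-skewCells⁺ κ ν ℕ.≤-refl s-new
      t∈ : (t , row κ t) ∈ cs
      t∈ = ∈-skewCells⁺ κ ν ℕ.≤-refl t-new
      apart : row ν (suc r) ≤ row κ r → ∀ {c c′} → c ∈ cs → c′ ∈ cs → proj₁ c ≤ r → r < proj₁ c′ → ¬ Adjacent c c′
      apart gap {i , j} {i′ , j′} c∈ c′∈ i≤r r<i′ adj with Adjacent-rows {i} {j} {i′} {j′} i≤r r<i′ adj
      ... | refl , refl , refl = ℕ.<⇒≱ (proj₂ (∈-skewCells⁻ κ ν c′∈)) (ℕ.≤-trans gap (proj₁ (∈-skewCells⁻ κ ν c∈)))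

newRows-beyond : ∀ l N {ρ σ} → l ≤ N → VanishesFrom l σ → newRows N ρ σ ≡ newRows l ρ σ
newRows-beyond zero    zero    _ _ = refl
newRows-beyond zero    (suc N) {ρ} {σ} _ van with ρ 0 <? σ 0
... | yes new = contradiction (van 0 z≤n) (ℕ.m<n⇒n≢0 new)
... | no _    = newRows-beyond zero N z≤n (λ r _ → van (suc r) z≤n)
newRows-beyond (suc l) (suc N) {ρ} {σ} (s≤s l≤N) van with ρ 0 <? σ 0
... | yes _ = cong suc (newRows-beyond l N l≤N (λ r → van (suc r) ∘ s≤s))
... | no _  = newRows-beyond l N l≤N (λ r → van (suc r) ∘ s≤s)

newRows-count : ∀ N (ρ σ f : ℕ → ℕ) →
  newRows N (ρ ∘ f) (σ ∘ f) ≡ length (filter (λ r → ρ r <? σ r) (applyUpTo f N))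
newRows-count zero    ρ σ f = refl
newRows-count (suc N) ρ σ f with ρ (f 0) <? σ (f 0)
... | yes new = trans (cong suc (newRows-count N ρ σ (f ∘ suc)))
                      (cong length (sym (List.filter-accept (λ r → ρ r <? σ r) new)))
... | no ¬new = trans (newRows-count N ρ σ (f ∘ suc))
                      (cong length (sym (List.filter-reject (λ r → ρ r <? σ r) ¬new)))

newRows≡occupiedRows : ∀ κ ν {N} → length ν ≤ N → newRows N (row κ) (row ν) ≡ occupiedRows κ ν
newRows≡occupiedRows κ ν l≤N =
  trans (newRows-beyond (length ν) _ l≤N (row-vanishes ν)) (newRows-count (length ν) (row κ) (row ν) id)

-- Enumeration of partitions and of ribbons

∑-↭ : ∀ {a} {A : Set a} (f : A → ℤ) {xs ys} → xs ↭ ys → ∑ f xs ≡ ∑ f ys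
∑-↭ f Perm.refl          = refl
∑-↭ f (Perm.prep x p)    = cong (f x ⊕_) (∑-↭ f p)
∑-↭ f (Perm.swap x y p)  = cong (λ s → f x ⊕ (f y ⊕ s)) (∑-↭ f p) ∙ exchange (f x) (f y) _
  where
  exchange : ∀ a b c → a ⊕ (b ⊕ c) ≡ b ⊕ (a ⊕ c)
  exchange = solve-∀
∑-↭ f (Perm.trans p q)   = ∑-↭ f p ∙ ∑-↭ f q

map-unique : ∀ {A B : Set} (f : A → B) {xs} → (∀ {x y} → x ∈ xs → y ∈ xs → f x ≡ f y → x ≡ y) →
             Unique xs → Unique (map f xs)
map-unique f inj []       = []
map-unique f {x ∷ xs} inj (x≢ ∷ u) = All.map⁺ (All.tabulate fresh) ∷ map-unique f (λ x∈ y∈ → inj (there x∈) (there y∈)) u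
  where
  fresh : ∀ {y} → y ∈ xs → f x ≢ f y
  fresh y∈ fx≡fy = All.lookup x≢ y∈ (inj (here refl) (there y∈) fx≡fy)

-- The conditions of `Partition` as a predicate, so that partitions are compared as lists and not
-- together with the proofs stored in the record.
record IsPartition (n : ℕ) (ps : List ℕ) : Set where
  constructor isPartition
  field
    linked : Linked _≥_ ps
    pos    : All (0 <_) ps
    total  : sum ps ≡ n

open IsPartition

partitionLists : ℕ → List (List ℕ)
partitionLists n = map parts (partitions n)

∈-partitionLists⁻ : ∀ {n ps} → ps ∈ partitionLists n → IsPartition n ps
∈-partitionLists⁻ ps∈ with ν , _ , refl ← ∈-map⁻ parts ps∈ = isPartition (decreasing ν) (positive ν) (size ν)

private
  asParts : ℕ → List ℕ → Maybe (List ℕ)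
  asParts n ps = Maybe.map parts (asPartition n ps)

  asParts-just : ∀ {n ps} → IsPartition n ps → asParts n ps ≡ just ps
  asParts-just {n} {ps} p with linked? _≥?_ ps | all? (0 <?_) ps | sum ps ≟ n
  ... | yes _  | yes _  | yes _  = refl
  ... | yes _  | yes _  | no ¬s = contradiction (total p) ¬s
  ... | yes _  | no ¬p | _      = contradiction (pos p) ¬p
  ... | no ¬l | _      | _      = contradiction (linked p) ¬l

  asParts-≡ : ∀ {n ps qs} → asParts n ps ≡ just qs → ps ≡ qs
  asParts-≡ {n} {ps} eq with linked? _≥?_ ps | all? (0 <?_) ps | sum ps ≟ n
  asParts-≡ refl | yes _ | yes _ | yes _ = refl

  partitionLists≡ : ∀ n → partitionLists n ≡ mapMaybe (asParts n) (words n n)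
  partitionLists≡ n = go (words n n)
    where
    go : ∀ ws → map parts (mapMaybe (asPartition n) ws) ≡ mapMaybe (asParts n) ws
    go []       = refl
    go (w ∷ ws) with asPartition n w
    ... | just ν  = cong (parts ν ∷_) (go ws)
    ... | nothing = go ws

  words-unique : ∀ n l → Unique (words n l)
  words-unique n zero    = [] ∷ []
  words-unique n (suc l) = All.tabulate nonempty ∷
    Unique.cartesianProductWith⁺ _∷_ ∷-injective (Unique.applyUpTo⁺₁ suc n λ i<j _ → ℕ.<⇒≢ i<j ∘ ℕ.suc-injective) (words-unique n l)
    where
    nonempty : ∀ {w} → w ∈ cartesianProductWith _∷_ (applyUpTo suc n) (words n l) → [] ≢ w
    nonempty w∈ refl with ∈-cartesianProductWith⁻ _∷_ (applyUpTo suc n) (words n l) w∈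
    ... | _ , _ , _ , _ , ()

  ∈-words : ∀ {n} l ps → length ps ≤ l → All (0 <_) ps → All (_≤ n) ps → ps ∈ words n l
  ∈-words zero    []       _         _            _            = here refl
  ∈-words (suc l) []       _         _            _            = here refl
  ∈-words (suc l) (suc p ∷ ps) (s≤s ≤l) (_ ∷ pos) (p≤n ∷ ≤n) =
    there (∈-cartesianProductWith⁺ _∷_ (∈-applyUpTo⁺ suc p≤n) (∈-words l ps ≤l pos ≤n))

parts-≤-sum : ∀ ps → All (_≤ sum ps) ps
parts-≤-sum []       = []
parts-≤-sum (p ∷ ps) = ℕ.m≤m+n p _ ∷ All.map (λ ≤s → ℕ.≤-trans ≤s (ℕ.m≤n+m _ p)) (parts-≤-sum ps)

length-≤-sum : ∀ {ps} → All (0 <_) ps → length ps ≤ sum ps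
length-≤-sum []         = z≤n
length-≤-sum (p>0 ∷ ps) = ℕ.+-mono-≤ p>0 (length-≤-sum ps)

∈-partitionLists⁺ : ∀ {n ps} → IsPartition n ps → ps ∈ partitionLists n
∈-partitionLists⁺ {n} {ps} p@(isPartition _ pos refl) rewrite partitionLists≡ n =
  ∈-mapMaybe⁺ {f = asParts n} (∈-words n ps (length-≤-sum pos) pos (parts-≤-sum ps)) (asParts-just p)

partitionLists-unique : ∀ n → Unique (partitionLists n)
partitionLists-unique n rewrite partitionLists≡ n =
  mapMaybe-unique (asParts n) (λ eq eq′ → asParts-≡ eq ∙ sym (asParts-≡ eq′)) (words-unique n n)

fromRows : ℕ → (ℕ → ℕ) → List ℕ
fromRows zero    σ = []
fromRows (suc N) σ with σ 0
... | zero  = []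
... | suc p = suc p ∷ fromRows N (σ ∘ suc)

decreasing-from-0 : ∀ {σ} → Decreasing σ → σ 0 ≡ 0 → ∀ r → σ r ≡ 0
decreasing-from-0 dec σ0 zero    = σ0
decreasing-from-0 {σ} dec σ0 (suc r) = ℕ.n≤0⇒n≡0 (subst (σ (suc r) ≤_) (decreasing-from-0 dec σ0 r) (dec r))

row-fromRows : ∀ N {σ} → Decreasing σ → VanishesFrom N σ → ∀ r → row (fromRows N σ) r ≡ σ r
row-fromRows zero    dec van r = sym (van r z≤n)
row-fromRows (suc N) {σ} dec van r with σ 0 in σ0
... | zero = sym (decreasing-from-0 dec σ0 r)
row-fromRows (suc N) dec van zero    | suc p = sym σ0
row-fromRows (suc N) dec van (suc r) | suc p = row-fromRows N (dec ∘ suc) (λ r → van (suc r) ∘ s≤s) r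

fromRows-positive : ∀ N σ → All (0 <_) (fromRows N σ)
fromRows-positive zero    σ = []
fromRows-positive (suc N) σ with σ 0
... | zero  = []
... | suc p = s≤s z≤n ∷ fromRows-positive N (σ ∘ suc)

fromRows-length : ∀ N σ → length (fromRows N σ) ≤ N
fromRows-length zero    σ = z≤n
fromRows-length (suc N) σ with σ 0
... | zero  = z≤n
... | suc p = s≤s (fromRows-length N (σ ∘ suc))

row-linked : ∀ ps → Decreasing (row ps) → Linked _≥_ ps
row-linked []           dec = []
row-linked (p ∷ [])     dec = [-]
row-linked (p ∷ q ∷ ps) dec = dec 0 ∷ row-linked (q ∷ ps) (dec ∘ suc)

row-injective : ∀ {ps qs} → All (0 <_) ps → All (0 <_) qs → (∀ r → row ps r ≡ row qs r) → ps ≡ qs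
row-injective []         []         eq = refl
row-injective []         (q>0 ∷ _)  eq = contradiction (sym (eq 0)) (ℕ.m<n⇒n≢0 q>0)
row-injective (p>0 ∷ _)  []         eq = contradiction (eq 0) (ℕ.m<n⇒n≢0 p>0)
row-injective (_ ∷ pos)  (_ ∷ pos′) eq = cong₂ _∷_ (eq 0) (row-injective pos pos′ (eq ∘ suc))

β-injective : ∀ N {ρ σ r} → β N ρ ≡ β N σ → r < N → ρ r ≡ σ r
β-injective (suc N) {r = zero}  eq _         = ℕ.+-cancelʳ-≡ N _ _ (∷-injectiveˡ eq)
β-injective (suc N) {r = suc r} eq (s≤s r<N) = β-injective N (∷-injectiveʳ eq) r<N

beads : ℕ → List ℕ → List ℕ
beads N κ = β N (row κ)

beads-injective : ∀ {N ps qs} → All (0 <_) ps → All (0 <_) qs → length ps ≤ N → length qs ≤ N →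
                  beads N ps ≡ beads N qs → ps ≡ qs
beads-injective {N} {ps} {qs} pos pos′ l≤ l′≤ eq = row-injective pos pos′ rows
  where
  rows : ∀ r → row ps r ≡ row qs r
  rows r with r <? N
  ... | yes r<N = β-injective N eq r<N
  ... | no r≮N  = row-vanishes ps r (ℕ.≤-trans l≤ N≤r) ∙ sym (row-vanishes qs r (ℕ.≤-trans l′≤ N≤r))
    where N≤r = ℕ.≮⇒≥ r≮N

sum-beads : ∀ N ps → length ps ≤ N → sum (beads N ps) ≡ sum ps + sum (beads N [])
sum-beads N       []       _         = refl
sum-beads (suc N) (p ∷ ps) (s≤s l≤N) = cong (p + N +_) (sum-beads N ps l≤N) ∙ lemma p N (sum ps) _
  where
  lemma : ∀ p N s t → p + N + (s + t) ≡ p + s + (N + t)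
  lemma = ℕSolver.solve-∀

ribbonSign : List ℕ → List ℕ → ℤ
ribbonSign κ κ′ = -1ℤ ℤ.^ (occupiedRows κ κ′ ∸ 1)

ribbons : List ℕ → ℕ → List (List ℕ)
ribbons κ k = filter (isRibbon? κ) (partitionLists (sum κ + k))

-- The empty case is a placeholder: by `ribbon⁺` a shape with a ribbon added has at least one bead.
toMove : List ℕ → ℕ → Move
toMove []       h = 0 , [] , h
toMove (z ∷ ys) h = z , ys , h

newRows-cong : ∀ N {ρ σ τ : ℕ → ℕ} → (∀ r → σ r ≡ τ r) → newRows N ρ σ ≡ newRows N ρ τ
newRows-cong zero    eq = refl
newRows-cong (suc N) {ρ} {σ} {τ} eq with ρ 0 <? σ 0
... | yes new = cong suc (newRows-cong N (eq ∘ suc)) ∙ sym (newRows-new N ρ τ (subst (ρ 0 <_) (eq 0) new))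
... | no ¬new with ρ 0 <? τ 0
...   | yes new = contradiction (subst (ρ 0 <_) (sym (eq 0)) new) ¬new
...   | no _    = newRows-cong N (eq ∘ suc)

+-swapʳ : ∀ a b c → a + b + c ≡ a + c + b
+-swapʳ = ℕSolver.solve-∀

module _ {s k N κ} (0<k : 0 < k) (κ-part : IsPartition s κ) (s+k≤N : s + k ≤ N) where

  private
    decκ : Decreasing (row κ)
    decκ = row-decreasing (linked κ-part)

    f : List ℕ → Move
    f κ′ = toMove (beads N κ′) (occupiedRows κ κ′ ∸ 1)

    T : ℕ
    T = sum (beads N [])

    κ≤N : length κ ≤ N
    κ≤N = ℕ.≤-trans (length-≤-sum (pos κ-part)) (ℕ.≤-trans (ℕ.≤-trans (ℕ.≤-reflexive (total κ-part)) (ℕ.m≤m+n s k)) s+k≤N)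

    length≤N : ∀ {κ′} → IsPartition (sum κ + k) κ′ → length κ′ ≤ N
    length≤N p = ℕ.≤-trans (length-≤-sum (pos p)) (ℕ.≤-trans (ℕ.≤-reflexive (total p ∙ cong (_+ k) (total κ-part))) s+k≤N)

    ribbon⁺ : ∀ {κ′} → κ′ ∈ ribbons κ k →
      ∃ λ z → ∃ λ ys → beads N κ′ ≡ z ∷ ys × (z , ys , occupiedRows κ κ′ ∸ 1) ∈ moves k (beads N κ)
    ribbon⁺ {κ′} κ′∈ with κ′∈parts , isRib ← ∈-filter⁻ (isRibbon? κ) κ′∈
      with p ← ∈-partitionLists⁻ κ′∈parts
      with z , ys , β≡ , m∈ ← ribbon⇒move N 0<k (IsRibbon⇒Ribbon {κ} {κ′} decκ (row-decreasing (linked p)) isRib) decκ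
             (row-decreasing (linked p)) (λ r N≤r → row-vanishes κ′ r (ℕ.≤-trans (length≤N p) N≤r))
             (sum-beads N κ′ (length≤N p) ∙ cong (_+ T) (total p) ∙ +-swapʳ (sum κ) k T ∙ cong (_+ k) (sym (sum-beads N κ κ≤N)))
      = z , ys , β≡ , subst (λ h → (z , ys , h ∸ 1) ∈ moves k (beads N κ)) (newRows≡occupiedRows κ κ′ (length≤N p)) m∈

    to : ∀ {m} → m ∈ map f (ribbons κ k) → m ∈ moves k (beads N κ)
    to m∈ =
      let κ′ , κ′∈ , m≡ = ∈-map⁻ f m∈
          z , ys , β≡ , m∈′ = ribbon⁺ κ′∈
      in subst (_∈ moves k (beads N κ)) (sym (m≡ ∙ cong (λ b → toMove b (occupiedRows κ κ′ ∸ 1)) β≡)) m∈′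

    from : ∀ {m} → m ∈ moves k (beads N κ) → m ∈ map f (ribbons κ k)
    from {z , ys , h} m∈ = subst (_∈ map f (ribbons κ k)) f≡
        (∈-map⁺ f (∈-filter⁺ (isRibbon? κ) (∈-partitionLists⁺ p) (Ribbon⇒IsRibbon {κ} {κ′} decκ decκ′ rib)))
      where
      open RibbonFrom (move⇒ribbon N 0<k decκ (λ r N≤r → row-vanishes κ r (ℕ.≤-trans κ≤N N≤r)) m∈)
        renaming (decreasing to decσ; isRibbon to ribσ; total to totalσ; beads to beadsσ)
      κ′ = fromRows N σ
      rows : ∀ r → row κ′ r ≡ σ r
      rows = row-fromRows N decσ vanishes
      decκ′ : Decreasing (row κ′)
      decκ′ r = subst₂ _≤_ (sym (rows (suc r))) (sym (rows r)) (decσ r)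
      β≡ : beads N κ′ ≡ z ∷ ys
      β≡ = β-cong N rows ∙ beadsσ
      rib : Ribbon (row κ) (row κ′)
      rib = record
        { grows     = λ r → subst (row κ r ≤_) (sym (rows r)) (Ribbon.grows ribσ r)
        ; thin      = λ r → subst (_≤ suc (row κ r)) (sym (rows (suc r))) (Ribbon.thin ribσ r)
        ; connected = λ r {s} {t} s≤r r<t s-new t-new → subst (row κ r <_) (sym (rows (suc r)))
            (Ribbon.connected ribσ r s≤r r<t (subst (row κ s <_) (rows s) s-new) (subst (row κ t <_) (rows t) t-new))
        }
      p : IsPartition (sum κ + k) κ′
      p = isPartition (row-linked κ′ decκ′) (fromRows-positive N σ) (ℕ.+-cancelʳ-≡ T _ _
        (sym (sum-beads N κ′ (fromRows-length N σ)) ∙ cong sum β≡ ∙ totalσ ∙ cong (_+ k) (sum-beads N κ κ≤N) ∙ +-swapʳ (sum κ) T k))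
      f≡ : f κ′ ≡ (z , ys , h)
      f≡ = cong₂ toMove β≡ (cong (_∸ 1) (sym (newRows≡occupiedRows κ κ′ (fromRows-length N σ)) ∙ newRows-cong N rows ∙ height))

    f-injective : ∀ {κ′ κ″} → κ′ ∈ ribbons κ k → κ″ ∈ ribbons κ k → f κ′ ≡ f κ″ → κ′ ≡ κ″
    f-injective {κ′} {κ″} κ′∈ κ″∈ eq =
      let p  = ∈-partitionLists⁻ (proj₁ (∈-filter⁻ (isRibbon? κ) κ′∈))
          p′ = ∈-partitionLists⁻ (proj₁ (∈-filter⁻ (isRibbon? κ) κ″∈))
          _ , _ , β≡  , _ = ribbon⁺ κ′∈
          _ , _ , β≡′ , _ = ribbon⁺ κ″∈
      in beads-injective (pos p) (pos p′) (length≤N p) (length≤N p′)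
          (β≡ ∙ cong (λ (z , ys , _) → z ∷ ys)
            (cong (λ b → toMove b (occupiedRows κ κ′ ∸ 1)) (sym β≡) ∙ eq ∙ cong (λ b → toMove b (occupiedRows κ κ″ ∸ 1)) β≡′)
            ∙ sym β≡′)

  -- Ribbons and collision-free bead moves correspond under `f`, with the height of the ribbon as
  -- number of transpositions; colliding moves contribute 0. The bound `s + k ≤ N` provides a bead
  -- for every row of the larger shape.
  ∑-ribbons : ∀ {g} → Alternating g →
    ∑ (λ κ′ → ribbonSign κ κ′ ⊛ g (beads N κ′)) (ribbons κ k) ≡ der (up k) g (beads N κ)
  ∑-ribbons {g} alt =
    ∑-cong (ribbons κ k) term ∙ sym (∑-map (signed g) f (ribbons κ k)) ∙ ∑-↭ (signed g) ribbons↭moves ∙ sym (der-up-moves alt k (beads N κ))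
    where
    ribbons↭moves : map f (ribbons κ k) ↭ moves k (beads N κ)
    ribbons↭moves = ∼bag⇒↭ (unique∧set⇒bag
      (map-unique f f-injective (Unique.filter⁺ (isRibbon? κ) (partitionLists-unique (sum κ + k))))
      (moves-unique 0<k (beads N κ)) (mk⇔ to from))
    term : ∀ {κ′} → κ′ ∈ ribbons κ k → ribbonSign κ κ′ ⊛ g (beads N κ′) ≡ signed g (f κ′)
    term {κ′} κ′∈ =
      let _ , _ , β≡ , _ = ribbon⁺ κ′∈
      in cong (λ b → ribbonSign κ κ′ ⊛ g b) β≡ ∙ cong (λ b → signed g (toMove b (occupiedRows κ κ′ ∸ 1))) (sym β≡)

-- The recurrence for the column sum

-- Evaluated at a shape, the first part of `μ` is the first ribbon added, and the last part acts
-- directly on `g`. Hence the recurrence peels parts off the end of the list.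
raise : List ℕ → (List ℕ → ℤ) → List ℕ → ℤ
raise μ g = foldr (λ m → der (up m)) g μ

raise-Alternating : ∀ μ {g} → Alternating g → Alternating (raise μ g)
raise-Alternating []      alt = alt
raise-Alternating (m ∷ μ) alt = der-Alternating (up m) (raise-Alternating μ alt)

∈-ribbons⁻ : ∀ {κ k κ′ s} → IsPartition s κ → κ′ ∈ ribbons κ k → IsPartition (s + k) κ′
∈-ribbons⁻ {κ} {k} {κ′} p κ′∈ =
  subst (λ s → IsPartition (s + k) κ′) (total p) (∈-partitionLists⁻ (proj₁ (∈-filter⁻ (isRibbon? κ) κ′∈)))

tableau-head : ∀ κ μ ν {P} → P ∈ ribbonTableaux κ μ ν → ∃ λ P′ → P ≡ κ ∷ P′
tableau-head κ []      ν P∈ with List.≡-dec _≟_ κ ν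
tableau-head κ []      ν (here refl) | yes _ = [] , refl
tableau-head κ []      ν ()          | no _
tableau-head κ (m ∷ μ) ν P∈ =
  let κ′ , P∈′ = Any.satisfied (∈-concatMap⁻ (λ κ′ → map (κ ∷_) (ribbonTableaux κ′ μ ν)) {ribbons κ m} P∈)
      P′ , _ , P≡ = ∈-map⁻ (κ ∷_) P∈′
  in P′ , P≡

∑-ε-extend : ∀ κ κ′ μ ν →
  ∑ ε (map (κ ∷_) (ribbonTableaux κ′ μ ν)) ≡ ribbonSign κ κ′ ⊛ ∑ ε (ribbonTableaux κ′ μ ν)
∑-ε-extend κ κ′ μ ν =
  ∑-map ε (κ ∷_) (ribbonTableaux κ′ μ ν) ∙
  ∑-cong (ribbonTableaux κ′ μ ν) (λ P∈ → first-step (tableau-head κ′ μ ν P∈)) ∙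
  ∑-*ˡ (ribbonSign κ κ′) ε (ribbonTableaux κ′ μ ν)
  where
  first-step : ∀ {P} → (∃ λ P′ → P ≡ κ′ ∷ P′) → ε (κ ∷ P) ≡ ribbonSign κ κ′ ⊛ ε P
  first-step (_ , refl) = refl

∑-tableaux-[] : ∀ {κ νs} → Unique νs → κ ∈ νs → ∑ (λ ν → ∑ ε (ribbonTableaux κ [] ν)) νs ≡ 1ℤ
∑-tableaux-[] {κ} {ν ∷ νs} (ν≢ ∷ u) κ∈ with List.≡-dec _≟_ κ ν
... | yes refl = cong (1ℤ ⊕_) (∑-zero νs λ ν′∈ → none (All.lookup ν≢ ν′∈))
  where
  none : ∀ {ν′} → κ ≢ ν′ → ∑ ε (ribbonTableaux κ [] ν′) ≡ 0ℤ
  none {ν′} κ≢ν′ with List.≡-dec _≟_ κ ν′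
  ... | yes κ≡ν′ = contradiction κ≡ν′ κ≢ν′
  ... | no _     = refl
∑-tableaux-[] {κ} {ν ∷ νs} (ν≢ ∷ u) (here κ≡ν) | no κ≢ν = contradiction κ≡ν κ≢ν
∑-tableaux-[] {κ} {ν ∷ νs} (ν≢ ∷ u) (there κ∈) | no κ≢ν = ℤ.+-identityˡ _ ∙ ∑-tableaux-[] u κ∈

-- With the final shape left free, a completed tableau counts 1 whatever its shape. This 1 is
-- represented by `Sgn` and not by a constant function, because `∑-ribbons` needs an alternating
-- one.
∑-tableaux : ∀ {n N s} μ κ → All (0 <_) μ → IsPartition s κ → s + sum μ ≡ n → n ≤ N →
  ∑ (λ ν → ∑ ε (ribbonTableaux κ μ ν)) (partitionLists n) ≡ raise μ Sgn (beads N κ)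
∑-tableaux {n} {N} {s} [] κ _ p s≡n _ =
  ∑-tableaux-[] (partitionLists-unique n) (∈-partitionLists⁺ (subst (λ s → IsPartition s κ) (sym (ℕ.+-identityʳ s) ∙ s≡n) p)) ∙
  sym (Sgn-β N (row-decreasing (linked p)))
∑-tableaux {n} {N} {s} (m ∷ μ) κ (0<m ∷ 0<μ) p s+m+μ≡n n≤N =
  ∑-cong νs (λ {ν} _ → ∑-concatMap ε (λ κ′ → map (κ ∷_) (ribbonTableaux κ′ μ ν)) κ′s ∙
                       ∑-cong κ′s (λ {κ′} _ → ∑-ε-extend κ κ′ μ ν)) ∙
  ∑-swap (λ ν κ′ → ribbonSign κ κ′ ⊛ ∑ ε (ribbonTableaux κ′ μ ν)) νs κ′s ∙
  ∑-cong κ′s (λ {κ′} κ′∈ → ∑-*ˡ (ribbonSign κ κ′) (λ ν → ∑ ε (ribbonTableaux κ′ μ ν)) νs ∙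
    cong (ribbonSign κ κ′ ⊛_) (∑-tableaux μ κ′ 0<μ (∈-ribbons⁻ p κ′∈) (ℕ.+-assoc s m (sum μ) ∙ s+m+μ≡n) n≤N)) ∙
  ∑-ribbons 0<m p s+m≤N (raise-Alternating μ Sgn-Alternating)
  where
  νs = partitionLists n
  κ′s = ribbons κ m
  s+m≤N : s + m ≤ N
  s+m≤N = ℕ.≤-trans (ℕ.+-monoʳ-≤ s (ℕ.m≤m+n m (sum μ))) (ℕ.≤-trans (ℕ.≤-reflexive s+m+μ≡n) n≤N)

_≈[_,_]_ : (List ℕ → ℤ) → ℕ → ℕ → (List ℕ → ℤ) → Set
g ≈[ N , s ] h = ∀ {κ} → IsPartition s κ → g (beads N κ) ≡ h (beads N κ)

-- `der (up k)` also evaluates its argument at unsorted and colliding lists, where nothing is known.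
-- For alternating functions `∑-ribbons` rewrites it in terms of partitions of `s + k` only.
der-up-cong : ∀ {N s k g h} → 0 < k → s + k ≤ N → Alternating g → Alternating h →
  g ≈[ N , s + k ] h → der (up k) g ≈[ N , s ] der (up k) h
der-up-cong {k = k} 0<k s+k≤N altg alth g≈h {κ} p =
  sym (∑-ribbons 0<k p s+k≤N altg) ∙
  ∑-cong (ribbons κ k) (λ {κ′} κ′∈ → cong (ribbonSign κ κ′ ⊛_) (g≈h (∈-ribbons⁻ p κ′∈))) ∙
  ∑-ribbons 0<k p s+k≤N alth

raise-cong : ∀ {N s g h} μ → All (0 <_) μ → s + sum μ ≤ N → Alternating g → Alternating h →
  g ≈[ N , s + sum μ ] h → raise μ g ≈[ N , s ] raise μ h
raise-cong {s = s} [] _ _ altg alth g≈h {κ} p = g≈h (subst (λ s → IsPartition s κ) (sym (ℕ.+-identityʳ s)) p)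
raise-cong {N} {s} {g} {h} (m ∷ μ) (0<m ∷ 0<μ) s≤N altg alth g≈h =
  der-up-cong 0<m (ℕ.≤-trans (ℕ.m≤m+n (s + m) (sum μ)) s+m≤N) (raise-Alternating μ altg) (raise-Alternating μ alth)
    (raise-cong μ 0<μ s+m≤N altg alth (subst (λ s → g ≈[ N , s ] h) (sym assoc) g≈h))
  where
  assoc = ℕ.+-assoc s m (sum μ)
  s+m≤N = subst (_≤ N) (sym assoc) s≤N

raise-+ : ∀ μ g h b → raise μ (λ c → g c ⊕ h c) b ≡ raise μ g b ⊕ raise μ h b
raise-+ []      g h b = refl
raise-+ (m ∷ μ) g h b = der-cong (up m) b (raise-+ μ g h) ∙ der-+ (up m) (raise μ g) (raise μ h) b

raise-* : ∀ μ a g b → raise μ (λ c → a ⊛ g c) b ≡ a ⊛ raise μ g b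
raise-* []      a g b = refl
raise-* (m ∷ μ) a g b = der-cong (up m) b (raise-* μ a g) ∙ der-* (up m) a (raise μ g) b

Alternating-+ : ∀ {g h} → Alternating g → Alternating h → Alternating (λ c → g c ⊕ h c)
Alternating-+ {g} {h} altg alth .Alternating.transpose as x y bs =
  cong₂ _⊕_ (Alternating.transpose altg as x y bs) (Alternating.transpose alth as x y bs) ∙
  sym (ℤ.neg-distrib-+ (g (as ++ y ∷ x ∷ bs)) _)

Alternating-* : ∀ a {g} → Alternating g → Alternating (λ c → a ⊛ g c)
Alternating-* a alt .Alternating.transpose as x y bs =
  cong (a ⊛_) (Alternating.transpose alt as x y bs) ∙ sym (ℤ.neg-distribʳ-* a _)

Alternating-∑ : ∀ {A : Set} (g : A → List ℕ → ℤ) → (∀ r → Alternating (g r)) → ∀ rs → Alternating (λ c → ∑ (λ r → g r c) rs)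
Alternating-∑ g alt []       .Alternating.transpose as x y bs = refl
Alternating-∑ g alt (r ∷ rs) = Alternating-+ (alt r) (Alternating-∑ g alt rs)

-- One list for each occurrence of `m`, repetitions kept, so that summing over it produces the
-- multiplicity of `m` as a coefficient.
removals : ℕ → List ℕ → List (List ℕ)
removals m []      = []
removals m (k ∷ ρ) with m ≟ k
... | yes _ = ρ ∷ map (k ∷_) (removals m ρ)
... | no  _ = map (k ∷_) (removals m ρ)

module _ {n m} (0<m : 0 < m) (m≤n : m ≤ n) where

  private
    -- At most n beads belong to nonzero rows of a partition of size at most n; the other n keep all
    -- positions below n occupied, as both cases of the commutation rule require.
    N = n + n

    partition-full : ∀ {s κ y} → IsPartition s κ → s ≤ n → y < n → y ∈ beads N κ
    partition-full {κ = κ} p s≤n y<n = β-full N (length κ) (row-vanishes κ)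
      (ℕ.+-mono-<-≤ y<n (ℕ.≤-trans (length-≤-sum (pos p)) (ℕ.≤-trans (ℕ.≤-reflexive (total p)) s≤n)))

    partition-below : ∀ {s κ} → IsPartition s κ → s ≤ n → below m (beads N κ) ≡ m
    partition-below {κ = κ} p s≤n = below-β N (length κ) (row-vanishes κ)
      (ℕ.+-mono-≤ m≤n (ℕ.≤-trans (length-≤-sum (pos p)) (ℕ.≤-trans (ℕ.≤-reflexive (total p)) s≤n)))

    crossTerm : ℕ → (List ℕ → ℤ) → List ℕ → ℤ
    crossTerm k g b with m ≟ k
    ... | yes _ = ℤ.+ m ⊛ g b
    ... | no  _ = 0ℤ

  der-up-down : ∀ {g s k} → Alternating g → s ≤ n → k ≤ n → ∀ {κ} → IsPartition s κ →
    der (up k) (der (down m) g) (beads N κ) ≡ der (down m) (der (up k) g) (beads N κ) ⊕ crossTerm k g (beads N κ)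
  der-up-down {g} {s} {k} alt s≤n k≤n {κ} p =
    up-down k m g (beads N κ) ∙ cong (der (down m) (der (up k) g) (beads N κ) ⊕_) crossed
    where
    crossed : der (cross k m) g (beads N κ) ≡ crossTerm k g (beads N κ)
    crossed with m ≟ k
    ... | yes refl = cross-diagonal m g (beads N κ) ∙ cong (λ a → ℤ.+ a ⊛ g (beads N κ)) (partition-below p s≤n)
    ... | no m≢k   = cross-vanish alt (m≢k ∘ sym) (beads N κ) (λ y<k → partition-full p s≤n (ℕ.<-≤-trans y<k k≤n))

  -- The product rule for a commutator: passing a part k costs `crossTerm k`, that is, m times the
  -- same product with this part deleted if k = m, and nothing otherwise.
  raise-down : ∀ ρ {g s} → All (0 <_) ρ → Alternating g → s + sum ρ ≤ n → ∀ {κ} → IsPartition s κ →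
    raise ρ (der (down m) g) (beads N κ) ≡
    der (down m) (raise ρ g) (beads N κ) ⊕ ℤ.+ m ⊛ ∑ (λ r → raise r g (beads N κ)) (removals m ρ)
  raise-down [] {g} _ alt _ {κ} p =
    sym (ℤ.+-identityʳ _) ∙ cong (der (down m) g (beads N κ) ⊕_) (sym (ℤ.*-zeroʳ (ℤ.+ m)))
  raise-down (k ∷ ρ) {g} {s} (0<k ∷ 0<ρ) alt s≤n {κ} p = begin
    der (up k) (raise ρ (der (down m) g)) b
      ≡⟨ der-up-cong 0<k (ℕ.≤-trans (ℕ.m≤m+n (s + k) (sum ρ)) (ℕ.≤-trans s+k≤n (ℕ.m≤m+n n n)))
           (raise-Alternating ρ (der-Alternating (down m) alt))
           (Alternating-+ (der-Alternating (down m) altρ)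
             (Alternating-* (ℤ.+ m) (Alternating-∑ (λ r → raise r g) (λ r → raise-Alternating r alt) rs)))
           (raise-down ρ 0<ρ alt s+k≤n) p ⟩
    der (up k) (λ c → der (down m) (raise ρ g) c ⊕ ℤ.+ m ⊛ ∑ (λ r → raise r g c) rs) b
      ≡⟨ der-+ (up k) (der (down m) (raise ρ g)) _ b ∙
         cong (der (up k) (der (down m) (raise ρ g)) b ⊕_)
           (der-* (up k) (ℤ.+ m) _ b ∙ cong (ℤ.+ m ⊛_) (der-∑ (up k) (λ r → raise r g) rs b)) ⟩
    der (up k) (der (down m) (raise ρ g)) b ⊕ ℤ.+ m ⊛ S
      ≡⟨ cong (_⊕ ℤ.+ m ⊛ S) (der-up-down altρ (ℕ.≤-trans (ℕ.m≤m+n s (k + sum ρ)) s≤n)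
           (ℕ.≤-trans (ℕ.≤-trans (ℕ.m≤m+n k (sum ρ)) (ℕ.m≤n+m (k + sum ρ) s)) s≤n) p) ⟩
    (der (down m) (raise (k ∷ ρ) g) b ⊕ crossTerm k (raise ρ g) b) ⊕ ℤ.+ m ⊛ S
      ≡⟨ ℤ.+-assoc (der (down m) (raise (k ∷ ρ) g) b) _ _ ⟩
    der (down m) (raise (k ∷ ρ) g) b ⊕ (crossTerm k (raise ρ g) b ⊕ ℤ.+ m ⊛ S)
      ≡⟨ cong (der (down m) (raise (k ∷ ρ) g) b ⊕_) collect ⟩
    der (down m) (raise (k ∷ ρ) g) b ⊕ ℤ.+ m ⊛ ∑ (λ r → raise r g b) (removals m (k ∷ ρ)) ∎
    where
    open ≡-Reasoning
    b = beads N κ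
    rs = removals m ρ
    altρ = raise-Alternating ρ alt
    S = ∑ (λ r → der (up k) (raise r g) b) rs
    s+k≤n : s + k + sum ρ ≤ n
    s+k≤n = subst (_≤ n) (sym (ℕ.+-assoc s k (sum ρ))) s≤n
    collect : crossTerm k (raise ρ g) b ⊕ ℤ.+ m ⊛ S ≡ ℤ.+ m ⊛ ∑ (λ r → raise r g b) (removals m (k ∷ ρ))
    collect with m ≟ k
    ... | yes _ = cong (λ x → ℤ.+ m ⊛ raise ρ g b ⊕ ℤ.+ m ⊛ x) (sym (∑-map (λ r → raise r g b) (k ∷_) rs)) ∙
                  sym (ℤ.*-distribˡ-+ (ℤ.+ m) (raise ρ g b) _)
    ... | no _  = ℤ.+-identityˡ _ ∙ cong (ℤ.+ m ⊛_) (sym (∑-map (λ r → raise r g b) (k ∷_) rs))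

  -- Adding the part m last: it is either cancelled at once against the boundary, at the cost
  -- of parity m, or turned into a ribbon removal, which must cancel one of the parts m of ρ.
  column-recurrence : ∀ ρ → All (0 <_) ρ → sum ρ ≤ n →
    raise (ρ ∷ʳ m) Sgn (beads N []) ≡
    ℤ.+ m ⊛ ∑ (λ r → raise r Sgn (beads N [])) (removals m ρ) ⊕ parity m ⊛ raise ρ Sgn (beads N [])
  column-recurrence ρ 0<ρ ρ≤n = begin
    raise (ρ ∷ʳ m) Sgn b
      ≡⟨ cong (λ g → g b) (List.foldr-∷ʳ (λ m → der (up m)) Sgn m ρ) ⟩
    raise ρ (der (up m) Sgn) b
      ≡⟨ raise-cong ρ 0<ρ (ℕ.≤-trans ρ≤n (ℕ.m≤m+n n n)) (der-Alternating (up m) Sgn-Alternating)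
           (Alternating-+ (der-Alternating (down m) Sgn-Alternating) (Alternating-* (parity m) Sgn-Alternating)) reflect empty ⟩
    raise ρ (λ c → der (down m) Sgn c ⊕ parity m ⊛ Sgn c) b
      ≡⟨ raise-+ ρ (der (down m) Sgn) _ b ∙ cong (raise ρ (der (down m) Sgn) b ⊕_) (raise-* ρ (parity m) Sgn b) ⟩
    raise ρ (der (down m) Sgn) b ⊕ parity m ⊛ raise ρ Sgn b
      ≡⟨ cong (_⊕ parity m ⊛ raise ρ Sgn b) (raise-down ρ 0<ρ Sgn-Alternating ρ≤n empty ∙
           cong (_⊕ ℤ.+ m ⊛ ∑ (λ r → raise r Sgn b) (removals m ρ)) (down-vacuum (raise-Alternating ρ Sgn-Alternating) 0<m N) ∙
           ℤ.+-identityˡ (ℤ.+ m ⊛ ∑ (λ r → raise r Sgn b) (removals m ρ))) ⟩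
    ℤ.+ m ⊛ ∑ (λ r → raise r Sgn b) (removals m ρ) ⊕ parity m ⊛ raise ρ Sgn b ∎
    where
    open ≡-Reasoning
    b = beads N []
    empty : IsPartition 0 []
    empty = isPartition [] [] refl
    reflect : der (up m) Sgn ≈[ N , sum ρ ] (λ c → der (down m) Sgn c ⊕ parity m ⊛ Sgn c)
    reflect {κ} p =
      up≡down+parity 0<m (β-unique N dec) (Sgn-β N dec) (β-below-head N dec) (partition-below p ρ≤n) ∙
      cong (der (down m) Sgn (beads N κ) ⊕_) (sym (ℤ.*-identityʳ (parity m)) ∙ cong (parity m ⊛_) (sym (Sgn-β N dec)))
      where dec = row-decreasing (linked p)

-- The recurrence for the factors

C-absorption : ∀ n k → suc k * (suc n C suc k) ≡ suc n * (n C k)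
C-absorption zero    zero    = refl
C-absorption zero    (suc k) =
  cong (suc (suc k) *_) (k>n⇒nCk≡0 {1} {suc (suc k)} (s≤s (s≤s z≤n))) ∙ ℕ.*-zeroʳ k ∙ sym (cong (1 *_) (k>n⇒nCk≡0 {0} {suc k} (s≤s z≤n)))
C-absorption (suc n) k = begin
  suc k * (suc (suc n) C suc k)                      ≡⟨ cong (suc k *_) (nCk+nC[k+1]≡[n+1]C[k+1] (suc n) k) ⟨
  suc k * (suc n C k + suc n C suc k)                ≡⟨ ℕ.*-distribˡ-+ (suc k) (suc n C k) _ ⟩
  suc k * (suc n C k) + suc k * (suc n C suc k)      ≡⟨ cong (suc k * (suc n C k) +_) (C-absorption n k) ⟩
  (suc n C k + k * (suc n C k)) + suc n * (n C k)    ≡⟨ lower k ⟩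
  suc n C k + suc n * (suc n C k)                    ∎
  where
  open ≡-Reasoning
  lower : ∀ k → (suc n C k + k * (suc n C k)) + suc n * (n C k) ≡ suc n C k + suc n * (suc n C k)
  lower zero    = cong (_+ suc n * 1) (ℕ.+-identityʳ 1)
  lower (suc k) = begin
    (suc n C suc k + suc k * (suc n C suc k)) + suc n * (n C suc k)   ≡⟨ ℕ.+-assoc (suc n C suc k) _ _ ⟩
    suc n C suc k + (suc k * (suc n C suc k) + suc n * (n C suc k))   ≡⟨ cong (λ x → suc n C suc k + (x + suc n * (n C suc k))) (C-absorption n k) ⟩
    suc n C suc k + (suc n * (n C k) + suc n * (n C suc k))           ≡⟨ cong (suc n C suc k +_) (ℕ.*-distribˡ-+ (suc n) (n C k) _) ⟨
    suc n C suc k + suc n * (n C k + n C suc k)                       ≡⟨ cong (λ x → suc n C suc k + suc n * x) (nCk+nC[k+1]≡[n+1]C[k+1] n k) ⟩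
    suc n C suc k + suc n * (suc n C suc k)                           ∎

sum-cong : ∀ {f g : ℕ → ℕ} n → (∀ {k} → k < n → f k ≡ g k) → sum (applyUpTo f n) ≡ sum (applyUpTo g n)
sum-cong zero    f≡g = refl
sum-cong (suc n) f≡g = cong₂ _+_ (f≡g (s≤s z≤n)) (sum-cong n λ k<n → f≡g (s≤s k<n))

sum-zero : ∀ {f : ℕ → ℕ} n → (∀ k → f k ≡ 0) → sum (applyUpTo f n) ≡ 0
sum-zero zero    f≡0 = refl
sum-zero (suc n) f≡0 = cong₂ _+_ (f≡0 0) (sum-zero n (f≡0 ∘ suc))

sum-extend : ∀ {f : ℕ → ℕ} {l n} → l ≤ n → (∀ k → l ≤ k → f k ≡ 0) → sum (applyUpTo f l) ≡ sum (applyUpTo f n)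
sum-extend {n = n} z≤n       f≡0 = sym (sum-zero n λ k → f≡0 k z≤n)
sum-extend {f}     (s≤s l≤n) f≡0 = cong (f 0 +_) (sum-extend l≤n λ k l≤k → f≡0 (suc k) (s≤s l≤k))

sum-linear : ∀ (f g : ℕ → ℕ) c n → sum (applyUpTo (λ k → f k + c * g k) n) ≡ sum (applyUpTo f n) + c * sum (applyUpTo g n)
sum-linear f g c zero    = sym (ℕ.*-zeroʳ c)
sum-linear f g c (suc n) = cong (f 0 + c * g 0 +_) (sum-linear (f ∘ suc) (g ∘ suc) c n) ∙ lemma (f 0) c (g 0) _ _
  where
  lemma : ∀ a c b x y → a + c * b + (x + c * y) ≡ a + x + c * (b + y)
  lemma = ℕSolver.solve-∀

-- For j = 2k, the number of ways to choose k disjoint pairs among m objects, each pair with weight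
-- i. Keeping `j` apart from `k` allows `2 * suc k` to be rewritten without disturbing the exponent.
matchings : ℕ → ℕ → ℕ → ℕ → ℕ
matchings i m j k = (m C j) * ((j ∸ 1) ‼) * i ^ k

oddTerm : ℕ → ℕ → ℕ → ℕ
oddTerm i m k = matchings i m (2 * k) k

2*suc : ∀ k → 2 * suc k ≡ suc (suc (2 * k))
2*suc = ℕSolver.solve-∀

suc-‼ : ∀ k → suc k ‼ ≡ suc k * ((k ∸ 1) ‼)
suc-‼ zero    = refl
suc-‼ (suc k) = refl

-- Among m + 2 objects a distinguished one is either unpaired or paired, with weight i, with one of
-- the m + 1 others. In terms of binomials this is Pascal's rule followed by `C-absorption`.
oddTerm-suc : ∀ i m k → oddTerm i (suc (suc m)) (suc k) ≡ oddTerm i (suc m) (suc k) + i * suc m * oddTerm i m k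
oddTerm-suc i m k = begin
  oddTerm i (suc (suc m)) (suc k)
    ≡⟨ cong (λ j → matchings i (suc (suc m)) j (suc k)) (2*suc k) ⟩
  (suc (suc m) C suc (suc j)) * (suc j ‼) * (i * i ^ k)
    ≡⟨ cong (λ c → c * (suc j ‼) * (i * i ^ k)) (nCk+nC[k+1]≡[n+1]C[k+1] (suc m) (suc j)) ⟨
  (suc m C suc j + suc m C suc (suc j)) * (suc j ‼) * (i * i ^ k)
    ≡⟨ lemma (suc m C suc j) (suc m C suc (suc j)) (suc j ‼) (i * i ^ k) ⟩
  (suc m C suc (suc j)) * (suc j ‼) * (i * i ^ k) + (suc m C suc j) * (suc j ‼) * (i * i ^ k)
    ≡⟨ cong₂ _+_ (cong (λ j → matchings i (suc m) j (suc k)) (sym (2*suc k))) absorb ⟩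
  oddTerm i (suc m) (suc k) + i * suc m * oddTerm i m k ∎
  where
  open ≡-Reasoning
  j = 2 * k
  lemma : ∀ a b d e → (a + b) * d * e ≡ b * d * e + a * d * e
  lemma = ℕSolver.solve-∀
  rearrange : ∀ c j d i p → c * (j * d) * (i * p) ≡ j * c * (d * i * p)
  rearrange = ℕSolver.solve-∀
  rearrange′ : ∀ n c d i p → n * c * (d * i * p) ≡ i * n * (c * d * p)
  rearrange′ = ℕSolver.solve-∀
  absorb : (suc m C suc j) * (suc j ‼) * (i * i ^ k) ≡ i * suc m * ((m C j) * ((j ∸ 1) ‼) * i ^ k)
  absorb = cong (λ d → (suc m C suc j) * d * (i * i ^ k)) (suc-‼ j) ∙
    rearrange (suc m C suc j) (suc j) ((j ∸ 1) ‼) i (i ^ k) ∙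
    cong (_* (((j ∸ 1) ‼) * i * i ^ k)) (C-absorption m j) ∙
    rearrange′ (suc m) (m C j) ((j ∸ 1) ‼) i (i ^ k)

oddSum : ℕ → ℕ → ℕ → ℕ
oddSum i m n = sum (applyUpTo (oddTerm i m) n)

oddSum-suc : ∀ i m n → oddSum i (suc (suc m)) (suc n) ≡ oddSum i (suc m) (suc n) + i * suc m * oddSum i m n
oddSum-suc i m n =
  cong (1 +_) (sum-cong n (λ {k} _ → oddTerm-suc i m k) ∙ sum-linear (oddTerm i (suc m) ∘ suc) (oddTerm i m) (i * suc m) n)

-- Terms beyond m / 2 vanish because `2 * k` exceeds m. The freedom in `n` lets the sums for
-- consecutive values of m be compared term by term.
factor-odd : ∀ {i} m n → ¬ 2 ∣ i → suc (m / 2) ≤ n → factor i m ≡ oddSum i m n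
factor-odd {i} m n odd m/2<n with 2 ∣? i
... | yes even = contradiction even odd
... | no _ = cong sum (List.map-upTo _ (suc (m / 2))) ∙ sum-cong (suc (m / 2)) reflect ∙ sum-extend m/2<n beyond
  where
  reflect : ∀ {k} → k < suc (m / 2) → (m C (m ∸ 2 * k)) * ((2 * k ∸ 1) ‼) * i ^ k ≡ oddTerm i m k
  reflect {k} (s≤s k≤m/2) = cong (λ c → c * ((2 * k ∸ 1) ‼) * i ^ k) (sym (nCk≡nC[n∸k] 2k≤m))
    where
    2k≤m : 2 * k ≤ m
    2k≤m = ℕ.≤-trans (ℕ.*-monoʳ-≤ 2 k≤m/2) (subst (_≤ m) (ℕ.*-comm (m / 2) 2) (m/n*n≤m m 2))
  beyond : ∀ k → suc (m / 2) ≤ k → oddTerm i m k ≡ 0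
  beyond k m/2<k = cong (λ c → c * ((2 * k ∸ 1) ‼) * i ^ k) (k>n⇒nCk≡0 (ℕ.≰⇒> λ 2k≤m →
    ℕ.n≮n k (ℕ.≤-trans (s≤s (half 2k≤m)) m/2<k)))
    where
    half : 2 * k ≤ m → k ≤ m / 2
    half 2k≤m = subst (_≤ m / 2) (m*n/n≡m k 2) (/-monoˡ-≤ 2 (subst (_≤ m) (ℕ.*-comm 2 k) 2k≤m))

-- At a = 0 the truncated `a ∸ 1` is harmless, since its coefficient is 0.
factor-odd-suc : ∀ {i} a → ¬ 2 ∣ i → factor i (suc a) ≡ factor i a + i * a * factor i (a ∸ 1)
factor-odd-suc {i} zero    odd = factor-odd 1 1 odd (s≤s z≤n) ∙ sym (cong₂ _+_ (factor-odd 0 1 odd (s≤s z≤n)) (cong (_* factor i 0) (ℕ.*-zeroʳ i)))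
factor-odd-suc {i} (suc b) odd =
  factor-odd (suc (suc b)) (suc n) odd (s≤s (m/n≤m (suc (suc b)) 2)) ∙ oddSum-suc i b n ∙
  sym (cong₂ (λ x y → x + i * suc b * y) (factor-odd (suc b) (suc n) odd (s≤s (ℕ.m≤n⇒m≤1+n (m/n≤m (suc b) 2)))) (factor-odd b n odd (s≤s (ℕ.m≤n⇒m≤1+n (m/n≤m b 2)))))
  where
  n = suc (suc b)

2∣2+⇒2∣ : ∀ {m} → 2 ∣ suc (suc m) → 2 ∣ m
2∣2+⇒2∣ 2∣2+m = ∣m+n∣m⇒∣n 2∣2+m ∣-refl

2∣⇒2∣2+ : ∀ {m} → 2 ∣ m → 2 ∣ suc (suc m)
2∣⇒2∣2+ = ∣m∣n⇒∣m+n ∣-refl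

factor-even-suc : ∀ {i} a → 2 ∣ i → factor i (suc a) ≡ i * a * factor i (a ∸ 1)
factor-even-suc {i} zero even with 2 ∣? i
... | no odd = contradiction even odd
... | yes _  = sym (cong (_* 1) (ℕ.*-zeroʳ i))
factor-even-suc {i} (suc b) even with 2 ∣? i | 2 ∣? suc (suc b) | 2 ∣? b
... | no odd | _       | _      = contradiction even odd
... | yes _  | yes 2∣  | no 2∤  = contradiction (2∣2+⇒2∣ 2∣) 2∤
... | yes _  | no 2∤   | yes 2∣ = contradiction (2∣⇒2∣2+ 2∣) 2∤
... | yes _  | no _    | no _   = sym (ℕ.*-zeroʳ (i * suc b))
... | yes _  | yes _   | yes _  =
  cong₂ (λ d e → d * i ^ e) (suc-‼ b) (m/n≡1+[m∸n]/n {suc (suc b)} {2} (s≤s (s≤s z≤n))) ∙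
  lemma (suc b) ((b ∸ 1) ‼) i (i ^ (b / 2))
  where
  lemma : ∀ n d i p → n * d * (i * p) ≡ i * n * (d * p)
  lemma = ℕSolver.solve-∀

parity-suc-suc : ∀ i → parity (suc (suc i)) ≡ parity i
parity-suc-suc i = lemma (parity i)
  where
  lemma : ∀ a → 1ℤ ⊖ (1ℤ ⊖ a) ≡ a
  lemma = solve-∀

parity-even : ∀ i → 2 ∣ i → parity i ≡ 0ℤ
parity-even zero          _    = refl
parity-even (suc zero)    even = contradiction (∣1⇒≡1 even) λ ()
parity-even (suc (suc i)) even = parity-suc-suc i ∙ parity-even i (2∣2+⇒2∣ even)

parity-odd : ∀ i → ¬ 2 ∣ i → parity i ≡ 1ℤ
parity-odd zero          odd = contradiction (2 ∣0) odd
parity-odd (suc zero)    odd = refl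
parity-odd (suc (suc i)) odd = parity-suc-suc i ∙ parity-odd i (odd ∘ 2∣⇒2∣2+)

-- Both parities of `i` in the shape of `column-recurrence`: a pairing term with coefficient i a,
-- plus `parity i` times the previous factor.
factor-suc : ∀ i a → ℤ.+ factor i (suc a) ≡ ℤ.+ (i * a * factor i (a ∸ 1)) ⊕ parity i ⊛ ℤ.+ factor i a
factor-suc i a = by (2 ∣? i)
  where
  by : Dec (2 ∣ i) → ℤ.+ factor i (suc a) ≡ ℤ.+ (i * a * factor i (a ∸ 1)) ⊕ parity i ⊛ ℤ.+ factor i a
  by (yes even) = cong ℤ.+_ (factor-even-suc a even) ∙
    sym (cong (λ p → ℤ.+ (i * a * factor i (a ∸ 1)) ⊕ p ⊛ ℤ.+ factor i a) (parity-even i even) ∙ ℤ.+-identityʳ _)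
  by (no odd) = cong ℤ.+_ (factor-odd-suc a odd ∙ ℕ.+-comm (factor i a) _) ∙
    ℤ.pos-+ (i * a * factor i (a ∸ 1)) (factor i a) ∙
    cong (ℤ.+ (i * a * factor i (a ∸ 1)) ⊕_) (sym (cong (_⊛ ℤ.+ factor i a) (parity-odd i odd) ∙ ℤ.*-identityˡ _))

-- The product formula

multiplicity-↭ : ∀ i {ρ σ} → ρ ↭ σ → multiplicity i ρ ≡ multiplicity i σ
multiplicity-↭ i p = ↭-length (filter-↭ (i ≟_) p)

multiplicity-same : ∀ m ρ → multiplicity m (m ∷ ρ) ≡ suc (multiplicity m ρ)
multiplicity-same m ρ = cong length (List.filter-accept (m ≟_) refl)

multiplicity-other : ∀ {i m} ρ → i ≢ m → multiplicity i (m ∷ ρ) ≡ multiplicity i ρ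
multiplicity-other {i} ρ i≢m = cong length (List.filter-reject (i ≟_) i≢m)

∈-removals⁻ : ∀ {m r} ρ → r ∈ removals m ρ → ρ ↭ m ∷ r
∈-removals⁻ {m} (k ∷ ρ) r∈ with m ≟ k
∈-removals⁻ {m} (k ∷ ρ) (here refl) | yes refl = Perm.refl
∈-removals⁻ {m} (k ∷ ρ) (there r∈)  | yes refl with r′ , r′∈ , refl ← ∈-map⁻ (k ∷_) r∈ =
  Perm.prep k (∈-removals⁻ ρ r′∈)
∈-removals⁻ {m} (k ∷ ρ) r∈          | no _ with r′ , r′∈ , refl ← ∈-map⁻ (k ∷_) r∈ =
  Perm.trans (Perm.prep k (∈-removals⁻ ρ r′∈)) (Perm.swap k m Perm.refl)

length-removals : ∀ m ρ → length (removals m ρ) ≡ multiplicity m ρ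
length-removals m []      = refl
length-removals m (k ∷ ρ) with m ≟ k
... | yes refl = cong suc (List.length-map (m ∷_) (removals m ρ) ∙ length-removals m ρ) ∙ sym (multiplicity-same m ρ)
... | no m≢k   = List.length-map (k ∷_) (removals m ρ) ∙ length-removals m ρ ∙ sym (multiplicity-other ρ m≢k)

factorsUpTo : ℕ → List ℕ → ℕ
factorsUpTo n ρ = product (map (λ i → factor i (multiplicity i ρ)) (applyUpTo suc n))

module _ {n m} (0<m : 0 < m) (m≤n : m ≤ n) where

  private
    m∈ : m ∈ applyUpTo suc n
    m∈ = subst (_∈ applyUpTo suc n) (ℕ.suc-pred m {{>-nonZero 0<m}})
           (∈-applyUpTo⁺ suc (subst (_≤ n) (sym (ℕ.suc-pred m {{>-nonZero 0<m}})) m≤n))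

    as bs : List ℕ
    as = proj₁ (∈-∃++ m∈)
    bs = proj₁ (proj₂ (∈-∃++ m∈))

    split : applyUpTo suc n ≡ as ++ m ∷ bs
    split = proj₂ (proj₂ (∈-∃++ m∈))

    m∉others : m ∉ as ++ bs
    m∉others = ∉-delete as (subst Unique split (Unique.applyUpTo⁺₁ suc n λ i<j _ → ℕ.<⇒≢ i<j ∘ ℕ.suc-injective))

  otherFactors : List ℕ → ℕ
  otherFactors ρ = product (map (λ i → factor i (multiplicity i ρ)) (as ++ bs))

  factorsUpTo-split : ∀ ρ → factorsUpTo n ρ ≡ factor m (multiplicity m ρ) * otherFactors ρ
  factorsUpTo-split ρ =
    cong (product ∘ map _) split ∙ product-↭ (map⁺ (λ i → factor i (multiplicity i ρ)) (shift m as bs))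

  otherFactors-∷ : ∀ {ρ r} → ρ ↭ m ∷ r → otherFactors ρ ≡ otherFactors r
  otherFactors-∷ {ρ} {r} ρ↭ = cong product (List.map-cong-local (All.tabulate λ {i} i∈ → cong (factor i)
    (multiplicity-↭ i ρ↭ ∙ multiplicity-other r λ i≡m → m∉others (subst (_∈ as ++ bs) i≡m i∈))))

∑-const : ∀ {A : Set} {f : A → ℤ} {v} xs → (∀ {x} → x ∈ xs → f x ≡ ℤ.+ v) → ∑ f xs ≡ ℤ.+ (length xs * v)
∑-const []              _   = refl
∑-const {v = v} (x ∷ xs) f≡v =
  cong₂ _⊕_ (f≡v (here refl)) (∑-const xs (f≡v ∘ there)) ∙ sym (ℤ.pos-+ v (length xs * v))

factor-0 : ∀ i → factor i 0 ≡ 1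
factor-0 i with 2 ∣? i
... | yes _ = refl
... | no _  = refl

factorsUpTo-[] : ∀ n → factorsUpTo n [] ≡ 1
factorsUpTo-[] n = go (applyUpTo suc n)
  where
  go : ∀ is → product (map (λ i → factor i 0) is) ≡ 1
  go []       = refl
  go (i ∷ is) = cong₂ _*_ (factor-0 i) (go is)

-- The recurrence refers to the list without its last part and to lists with one more part deleted
-- somewhere inside. These are shorter without being tails, hence the induction on a bound `l` for
-- the length.
column-product : ∀ n l ρ → length ρ ≤ l → All (0 <_) ρ → sum ρ ≤ n →
  raise ρ Sgn (beads (n + n) []) ≡ ℤ.+ factorsUpTo n ρ
column-product n l ρ ρ≤l 0<ρ ρ≤n with initLast ρ
column-product n l       _ _   _   _   | [] =
  Sgn-β (n + n) (λ _ → z≤n) ∙ cong ℤ.+_ (sym (factorsUpTo-[] n))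
column-product n zero    _ ρ≤0 _   _   | ρ ∷ʳ′ m =
  contradiction (subst (_≤ 0) (sym (↭-length (∷↭∷ʳ m ρ))) ρ≤0) λ ()
column-product n (suc l) _ ρ≤l 0<ρ ρ≤n | ρ ∷ʳ′ m = begin
  raise (ρ ∷ʳ m) Sgn b
    ≡⟨ column-recurrence 0<m m≤n ρ 0<ρ′ ρ′≤n ⟩
  ℤ.+ m ⊛ ∑ (λ r → raise r Sgn b) (removals m ρ) ⊕ parity m ⊛ raise ρ Sgn b
    ≡⟨ cong₂ (λ x y → ℤ.+ m ⊛ x ⊕ parity m ⊛ y) (∑-const (removals m ρ) removed)
         (column-product n l ρ ρ′≤l 0<ρ′ ρ′≤n ∙ cong ℤ.+_ (factorsUpTo-split 0<m m≤n ρ) ∙ ℤ.pos-* (factor m a) Q) ⟩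
  ℤ.+ m ⊛ ℤ.+ (length (removals m ρ) * (factor m (a ∸ 1) * Q)) ⊕ parity m ⊛ (ℤ.+ factor m a ⊛ ℤ.+ Q)
    ≡⟨ cong (_⊕ parity m ⊛ (ℤ.+ factor m a ⊛ ℤ.+ Q))
         (sym (ℤ.pos-* m _) ∙ cong (λ c → ℤ.+ (m * (c * (factor m (a ∸ 1) * Q)))) (length-removals m ρ) ∙
          cong ℤ.+_ (assoc m a (factor m (a ∸ 1)) Q) ∙ ℤ.pos-* (m * a * factor m (a ∸ 1)) Q) ⟩
  ℤ.+ (m * a * factor m (a ∸ 1)) ⊛ ℤ.+ Q ⊕ parity m ⊛ (ℤ.+ factor m a ⊛ ℤ.+ Q)
    ≡⟨ collect (ℤ.+ (m * a * factor m (a ∸ 1))) (ℤ.+ Q) (parity m) (ℤ.+ factor m a) ⟩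
  (ℤ.+ (m * a * factor m (a ∸ 1)) ⊕ parity m ⊛ ℤ.+ factor m a) ⊛ ℤ.+ Q
    ≡⟨ cong (_⊛ ℤ.+ Q) (factor-suc m a) ⟨
  ℤ.+ factor m (suc a) ⊛ ℤ.+ Q
    ≡⟨ ℤ.pos-* (factor m (suc a)) Q ⟨
  ℤ.+ (factor m (suc a) * Q)
    ≡⟨ cong₂ (λ c q → ℤ.+ (factor m c * q)) (sym (multiplicity-↭ m ρm↭ ∙ multiplicity-same m ρ)) (sym (otherFactors-∷ 0<m m≤n ρm↭)) ⟩
  ℤ.+ (factor m (multiplicity m (ρ ∷ʳ m)) * otherFactors 0<m m≤n (ρ ∷ʳ m))
    ≡⟨ cong ℤ.+_ (factorsUpTo-split 0<m m≤n (ρ ∷ʳ m)) ⟨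
  ℤ.+ factorsUpTo n (ρ ∷ʳ m) ∎
  where
  open ≡-Reasoning
  b = beads (n + n) []
  ρm↭ : ρ ∷ʳ m ↭ m ∷ ρ
  ρm↭ = Perm.↭-sym (∷↭∷ʳ m ρ)
  0<m∷ρ : All (0 <_) (m ∷ ρ)
  0<m∷ρ = All-resp-↭ ρm↭ 0<ρ
  0<m = All.head 0<m∷ρ
  0<ρ′ = All.tail 0<m∷ρ
  m+ρ≤n : m + sum ρ ≤ n
  m+ρ≤n = subst (_≤ n) (sum-↭ ρm↭) ρ≤n
  m≤n = ℕ.≤-trans (ℕ.m≤m+n m (sum ρ)) m+ρ≤n
  ρ′≤n = ℕ.≤-trans (ℕ.m≤n+m (sum ρ) m) m+ρ≤n
  ρ′≤l : length ρ ≤ l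
  ρ′≤l = s≤s⁻¹ (subst (_≤ suc l) (↭-length ρm↭) ρ≤l)
  a = multiplicity m ρ
  Q = otherFactors 0<m m≤n ρ
  removed : ∀ {r} → r ∈ removals m ρ → raise r Sgn b ≡ ℤ.+ (factor m (a ∸ 1) * Q)
  removed {r} r∈ =
    column-product n l r
      (ℕ.≤-trans (ℕ.≤-trans (ℕ.n≤1+n _) (ℕ.≤-reflexive (sym (↭-length ρ↭)))) ρ′≤l)
      (All.tail (All-resp-↭ ρ↭ 0<ρ′))
      (ℕ.≤-trans (ℕ.≤-trans (ℕ.m≤n+m (sum r) m) (ℕ.≤-reflexive (sym (sum-↭ ρ↭)))) ρ′≤n) ∙
    cong ℤ.+_ (factorsUpTo-split 0<m m≤n r ∙
      cong₂ (λ c q → factor m c * q) (cong (_∸ 1) (sym (multiplicity-↭ m ρ↭ ∙ multiplicity-same m r)))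
            (sym (otherFactors-∷ 0<m m≤n ρ↭)))
    where ρ↭ = ∈-removals⁻ ρ r∈
  assoc : ∀ m a f q → m * (a * (f * q)) ≡ m * a * f * q
  assoc = ℕSolver.solve-∀
  collect : ∀ x q p f → x ⊛ q ⊕ p ⊛ (f ⊛ q) ≡ (x ⊕ p ⊛ f) ⊛ q
  collect = solve-∀

∑-signedRibbonCount : ∀ {n} (μ : Partition n) →
  ∑ (λ ν → signedRibbonCount (parts ν) (parts μ)) (partitions n) ≡ ℤ.+ factorProduct μ
∑-signedRibbonCount {n} μ =
  sym (∑-map (λ ν → signedRibbonCount ν (parts μ)) parts (partitions n)) ∙
  ∑-tableaux (parts μ) [] (positive μ) (isPartition [] [] refl) (size μ) (ℕ.m≤m+n n n) ∙
  column-product n (length (parts μ)) (parts μ) ℕ.≤-refl (positive μ) (ℕ.≤-reflexive (size μ))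

-- Transfer of the integer identity to the field.

module _ {c ℓ₁ ℓ₂} (K : HeytingField c ℓ₁ ℓ₂) where

  open CommutativeRing (HeytingCommutativeRing.commutativeRing (HeytingField.heytingCommutativeRing K))
    renaming (_+_ to _+ᴷ_; -_ to -ᴷ_; sym to ≈-sym; trans to ≈-trans; refl to ≈-refl)
  open MonoidMult +-monoid using (×-homo-+)
  open AbelianGroupProperties +-abelianGroup using (⁻¹-∙-comm; ε⁻¹≈ε)
  open SetoidReasoning setoid

  fromℤ-⊖ : ∀ m n → fromℤ K (m ℤ.⊖ n) ≈ fromℕ K m +ᴷ -ᴷ fromℕ K n
  fromℤ-⊖ m       zero    = ≈-sym (≈-trans (+-congˡ ε⁻¹≈ε) (+-identityʳ _))
  fromℤ-⊖ zero    (suc n) = ≈-sym (+-identityˡ _)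
  fromℤ-⊖ (suc m) (suc n) = begin
    fromℤ K (suc m ℤ.⊖ suc n)                           ≡⟨ cong (fromℤ K) (ℤ.[1+m]⊖[1+n]≡m⊖n m n) ⟩
    fromℤ K (m ℤ.⊖ n)                                   ≈⟨ fromℤ-⊖ m n ⟩
    fromℕ K m +ᴷ -ᴷ fromℕ K n                           ≈⟨ +-identityˡ _ ⟨
    0# +ᴷ (fromℕ K m +ᴷ -ᴷ fromℕ K n)                   ≈⟨ +-congʳ (-‿inverseʳ 1#) ⟨
    (1# +ᴷ -ᴷ 1#) +ᴷ (fromℕ K m +ᴷ -ᴷ fromℕ K n)        ≈⟨ interchange 1# (-ᴷ 1#) (fromℕ K m) (-ᴷ fromℕ K n) ⟩
    (1# +ᴷ fromℕ K m) +ᴷ (-ᴷ 1# +ᴷ -ᴷ fromℕ K n)        ≈⟨ +-congˡ (⁻¹-∙-comm 1# (fromℕ K n)) ⟩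
    fromℕ K (suc m) +ᴷ -ᴷ fromℕ K (suc n)               ∎
    where
    open CommutativeSemigroupProperties +-commutativeSemigroup using (interchange)

  fromℤ-+ : ∀ a b → fromℤ K (a ⊕ b) ≈ fromℤ K a +ᴷ fromℤ K b
  fromℤ-+ (ℤ.+ m)    (ℤ.+ n)    = ×-homo-+ 1# m n
  fromℤ-+ (ℤ.+ m)    ℤ.-[1+ n ] = fromℤ-⊖ m (suc n)
  fromℤ-+ ℤ.-[1+ m ] (ℤ.+ n)    = ≈-trans (fromℤ-⊖ n (suc m)) (+-comm _ _)
  fromℤ-+ ℤ.-[1+ m ] ℤ.-[1+ n ] = begin
    -ᴷ fromℕ K (suc (suc (m + n)))               ≡⟨ cong (λ k → -ᴷ fromℕ K (suc k)) (ℕ.+-suc m n) ⟨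
    -ᴷ fromℕ K (suc m + suc n)                   ≈⟨ -‿cong (×-homo-+ 1# (suc m) (suc n)) ⟩
    -ᴷ (fromℕ K (suc m) +ᴷ fromℕ K (suc n))      ≈⟨ ⁻¹-∙-comm (fromℕ K (suc m)) (fromℕ K (suc n)) ⟨
    -ᴷ fromℕ K (suc m) +ᴷ -ᴷ fromℕ K (suc n)     ∎

  foldr-fromℤ : ∀ {A : Set} (f : A → Carrier) (g : A → ℤ) xs → (∀ x → f x ≈ fromℤ K (g x)) →
    foldr _+ᴷ_ 0# (map f xs) ≈ fromℤ K (∑ g xs)
  foldr-fromℤ f g []       f≈g = ≈-refl
  foldr-fromℤ f g (x ∷ xs) f≈g =
    ≈-trans (+-cong (f≈g x) (foldr-fromℤ f g xs f≈g)) (≈-sym (fromℤ-+ (g x) (∑ g xs)))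

theorem22 : ∀ {c ℓ₁ ℓ₂} (K : HeytingField c ℓ₁ ℓ₂) →
    AlgebraicallyClosed K → CharacteristicZero K →
    (n : ℕ) (R : IrreducibleRepresentations K n) → MurnaghanNakayama K R →
    (μ : Partition n) (w : Permutation′ n) → HasCycleType w (parts μ) →
    HeytingField._≈_ K (columnSum K R w) (fromℕ K (factorProduct μ))
theorem22 K _ _ n R murnaghanNakayama μ w w-type =
  HeytingField.trans K
    (foldr-fromℤ K (λ ν → χ K R ν w) (λ ν → signedRibbonCount (parts ν) (parts μ)) (partitions n)
      (λ ν → murnaghanNakayama ν μ w w-type))
    (HeytingField.reflexive K (cong (fromℤ K) (∑-signedRibbonCount μ)))
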